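{- Let \[B(t,x,y)=\sum_{n\ge 0}\ \sum_{\pi\in \mathfrak{S}_n^{[3]}(231)} t^{c_1(\pi)}x^{c_2(\pi)}y^{c_3(\pi)}.\] Then \[ B(t,x,y) = \dfrac{(1-x)^2(1-2y)}{1 - 3 x - 3 y - t + 2 x^2 + 5 x y + t x - 5 x^2 y - 4 t x y - t^2y}. \]
   Context: $\mathfrak{S}_n$ is the symmetric group on $[n]=\{1,\dots,n\}$; permutations are written in one-line notation $\pi=\pi_1\cdots\pi_n$ with $\pi_i=\pi(i)$. A permutation $\pi$ contains a pattern $\sigma\in\mathfrak{S}_k$ if some subsequence of $\pi_1\cdots\pi_n$ of length $k$ is in the same relative order as $\sigma$; otherwise $\pi$ avoids $\sigma$. $\mathfrak{S}_n^{[3]}(231)$ is the set of permutations in $\mathfrak{S}_n$ that avoid $231$ and all of whose cycles (in the disjoint cycle decomposition) have length $1$, $2$ or $3$; $\mathfrak{S}_0^{[3]}(231)$ consists of the empty permutation. $c_k(\pi)$ denotes the number of $k$-cycles of $\pi$. -}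

module Defs where

open import Algebra.Bundles using (RawRing)
import Algebra.Definitions.RawSemiring as RawSemiringOps
open import Data.Fin.Base as Fin using (Fin; zero; suc; toℕ)
import Data.Fin.Properties as Fin
open import Data.Integer.Base as ℤ using (ℤ)
open import Data.List.Base
  using (List; []; _∷_; allFin; cartesianProductWith; filter; foldr; iterate; length; map; takeWhile)
open import Data.List.Membership.Propositional using (_∈_; lose; find)
open import Data.List.Membership.Propositional.Properties
  using (∈-allFin; ∈-cartesianProductWith⁺)
import Data.List.Membership.DecPropositional as DecMembership
open import Data.List.Relation.Unary.All as All using (All)
open import Data.List.Relation.Unary.Any as Any using (here)
open import Data.Nat.Base as ℕ using (ℕ; zero; suc; _∸_; _≥_)
import Data.Nat.Properties as ℕ
open import Data.Product.Base using (∃; ∃-syntax; _×_; _,_; proj₁; proj₂)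
open import Data.Vec.Base as Vec using (Vec; []; _∷_; lookup)
open import Function.Bundles using (_⇔_; mk⇔; Equivalence)
open import Function.Definitions using (Injective; Surjective; Bijective)
open import Level using (Level; 0ℓ)
open import Relation.Binary.PropositionalEquality using (_≡_; refl)
open import Relation.Nullary.Decidable using (Dec; map′; ¬?; _×-dec_; _→-dec_)
open import Relation.Unary using (Decidable)

-- The letters are 0-based: the word w stands for the permutation
-- i ↦ lookup w i of Fin n = {0, …, n-1}.
Word : ℕ → ℕ → Set
Word m n = Vec (Fin m) n

IsPermutation : ∀ {n} → Word n n → Set
IsPermutation w = Bijective _≡_ _≡_ (lookup w)

isPermutation? : ∀ {n} → Decidable (IsPermutation {n})
isPermutation? w = injective? ×-dec surjective?
  where
  injective? : Dec (Injective _≡_ _≡_ (lookup w))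
  injective? = map′ (λ f {i} {j} → f i j) (λ f i j → f {i} {j})
    (Fin.all? λ i → Fin.all? λ j → (lookup w i Fin.≟ lookup w j) →-dec (i Fin.≟ j))

  surjective? : Dec (Surjective _≡_ _≡_ (lookup w))
  surjective? = map′
    (λ f y → proj₁ (f y) , λ { refl → proj₂ (f y) })
    (λ f y → proj₁ (f y) , proj₂ (f y) refl)
    (Fin.all? λ y → Fin.any? λ x → lookup w x Fin.≟ y)

words : ∀ m n → List (Word m n)
words m zero    = [] ∷ []
words m (suc n) = cartesianProductWith _∷_ (allFin m) (words m n)

∈-words : ∀ {m n} (w : Word m n) → w ∈ words m n
∈-words []      = here refl
∈-words (i ∷ w) = ∈-cartesianProductWith⁺ _∷_ (∈-allFin i) (∈-words w)

𝔖 : ∀ n → List (Word n n)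
𝔖 n = filter isPermutation? (words n n)

-- The vector e lists the positions of the subsequence.
IsOccurrence : ∀ {k n} → Word k k → Word n n → Word n k → Set
IsOccurrence σ π e =
  (∀ a b → a Fin.< b → lookup e a Fin.< lookup e b) ×
  (∀ a b → (lookup σ a Fin.< lookup σ b) ⇔
           (lookup π (lookup e a) Fin.< lookup π (lookup e b)))

Contains : ∀ {k n} → Word k k → Word n n → Set
Contains σ π = ∃[ e ] IsOccurrence σ π e

isOccurrence? : ∀ {k n} (σ : Word k k) (π : Word n n) → Decidable (IsOccurrence σ π)
isOccurrence? σ π e =
  (Fin.all? λ a → Fin.all? λ b → (a Fin.<? b) →-dec (lookup e a Fin.<? lookup e b))
  ×-dec
  (Fin.all? λ a → Fin.all? λ b →
    (lookup σ a Fin.<? lookup σ b) ⇔-dec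
    (lookup π (lookup e a) Fin.<? lookup π (lookup e b)))
  where
  _⇔-dec_ : ∀ {A B : Set} → Dec A → Dec B → Dec (A ⇔ B)
  a? ⇔-dec b? = map′ (λ (f , g) → mk⇔ f g)
                     (λ e → Equivalence.to e , Equivalence.from e)
                     ((a? →-dec b?) ×-dec (b? →-dec a?))

contains? : ∀ {k n} (σ : Word k k) → Decidable (Contains {k} {n} σ)
contains? {k} {n} σ π = map′
  (λ p → let e , _ , occ = find p in e , occ)
  (λ (e , occ) → lose (∈-words e) occ)
  (Any.any? (isOccurrence? σ π) (words n k))

[231] : Word 3 3
[231] = suc zero ∷ suc (suc zero) ∷ zero ∷ []

-- The cycle (i, π(i), π²(i), …) through i, written starting from i; a
-- cycle has at most n entries, so n ∸ 1 iterates after i always suffice.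
cycleFrom : ∀ {n} → Word n n → Fin n → List (Fin n)
cycleFrom {n} π i =
  i ∷ takeWhile (λ j → ¬? (j Fin.≟ i)) (iterate (lookup π) (lookup π i) (n ∸ 1))

-- Each cycle (fixed points included) is listed once, starting from its
-- least element.
cycles : ∀ {n} → Word n n → List (List (Fin n))
cycles {n} π =
  map (cycleFrom π) (filter (λ i → All.all? (i Fin.≤?_) (cycleFrom π i)) (allFin n))

c : ∀ {n} → ℕ → Word n n → ℕ
c k π = length (filter (λ C → length C ℕ.≟ k) (cycles π))

open DecMembership ℕ._≟_ using (_∈?_)

𝔖[3]⟨231⟩ : ∀ n → List (Word n n)
𝔖[3]⟨231⟩ n =
  filter (λ π → ¬? (contains? [231] π))
    (filter (λ π → All.all? (λ C → length C ∈? 1 ∷ 2 ∷ 3 ∷ []) (cycles π)) (𝔖 n))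

module _ {r ℓ : Level} (R : RawRing r ℓ) where
  private module R = RawRing R
  open RawSemiringOps R.rawSemiring using (sum)

  constant : R.Carrier → ℕ → R.Carrier
  constant a zero    = a
  constant a (suc _) = R.0#

  -- A series is its coefficient sequence.
  PowerSeries : RawRing r ℓ
  PowerSeries = record
    { Carrier = ℕ → R.Carrier
    ; _≈_     = λ f g → ∀ n → f n R.≈ g n
    ; _+_     = λ f g n → f n R.+ g n
    ; _*_     = λ f g n → sum {suc n} (λ i → f (toℕ i) R.* g (n ∸ toℕ i))
    ; -_      = λ f n → R.- f n
    ; 0#      = λ _ → R.0#
    ; 1#      = constant R.1#
    }

  variable₁ : ℕ → R.Carrier
  variable₁ 1 = R.1#
  variable₁ _ = R.0#

-- ℤ⟦y⟧⟦x⟧⟦t⟧: the coefficient of tᵃxᵇyᵈ in F is F a b d.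
ℤ⟦y⟧ ℤ⟦x,y⟧ ℤ⟦t,x,y⟧ : RawRing 0ℓ 0ℓ
ℤ⟦y⟧     = PowerSeries ℤ.+-*-rawRing
ℤ⟦x,y⟧   = PowerSeries ℤ⟦y⟧
ℤ⟦t,x,y⟧ = PowerSeries ℤ⟦x,y⟧

open RawRing ℤ⟦t,x,y⟧ public
  using (_≈_; _+_; _*_; -_; 0#; 1#)
  renaming (Carrier to Series)
open RawSemiringOps (RawRing.rawSemiring ℤ⟦t,x,y⟧) public
  using (_^_; sum)
  renaming (_×_ to _·_)

infixl 6 _-_
_-_ : Series → Series → Series
F - G = F + - G

t x y : Series
t = variable₁ ℤ⟦x,y⟧
x = constant ℤ⟦x,y⟧ (variable₁ ℤ⟦y⟧)
y = constant ℤ⟦x,y⟧ (constant ℤ⟦y⟧ (variable₁ ℤ.+-*-rawRing))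

-- F = Σ_{n ≥ 0} P n in the topology of coefficientwise convergence: every
-- coefficient of the partial sums is eventually that of F.
_IsSumOf_ : Series → (ℕ → Series) → Set
F IsSumOf P = ∀ a b d → ∃[ N ] ∀ m → m ≥ N →
  sum {m} (λ i → P (toℕ i)) a b d ≡ F a b d

_IsQuotientOf_By_ : Series → Series → Series → Set
F IsQuotientOf N By D = (∃[ E ] D * E ≈ 1#) × D * F ≈ N

weight : ∀ {n} → Word n n → Series
weight π = t ^ c 1 π * x ^ c 2 π * y ^ c 3 π

B-summand : ℕ → Series
B-summand n = foldr (λ π F → weight π + F) 0# (𝔖[3]⟨231⟩ n)

{-# OPTIONS --safe #-}

-- In a 231-avoiding permutation with first entry k (letters 0, …, n - 1), the entries below k precede those
-- above k. Hence positions 0, …, k form a block, and what remains is again a 231-avoiding permutation. If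
-- positions 0 and k of the block form a 2-cycle or coincide, the block is a decreasing word. Otherwise they
-- lie on a 3-cycle 0 ↦ k ↦ s + 1 ↦ 0, and the other entries form a 231-avoiding word whose first s entries
-- decrease and whose values from s on decrease. Such a word is a sum of two decreasing words, or a decreasing
-- word, or again a block with a 3-cycle, whose middle position is determined by s up to two choices.
-- Peel off fixed points, 2-cycles and 3-cycles one at a time. Let Q count the permutations in question preceded
-- by a decreasing word, P those preceded by a nonempty decreasing word, R those preceded by two decreasing
-- words, S those preceded by a decreasing word with a marked interior cut, and G those preceded by a word
-- of the kind found inside a 3-cycle. Then
--   B = 1 + P + yG,  Q = (1 + t)B + xQ,  P = (t + x)B + xP,
--   R = (1 + t)Q + xR,  S = xQ + xP + xS,  G = R + S + 2yG,
-- a linear system whose solution is the stated fraction.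

module Submission where

-- A word inside a 3-cycle is counted together with its split s, because the same inner word with
-- another s gives another block. Hence a decreasing inner word occurs once for every cut; cuts at
-- its two ends are already sums with an empty part, and only the interior ones need a mark. The
-- grammar is unambiguous because word and split together determine the code of a core. Short cycles
-- replace counting: every point returns after two or three steps, so injectivity, surjectivity and
-- the invariance of complements are all read off from orbits. The equations concern infinitely many
-- words. They are proved for lists of codes of one fixed size, where peeling a cycle lowers the
-- size by 1, 2 or 3. The sum over all sizes then makes sense because the coefficient of t^a x^b y^d
-- comes from size a + 2b + 3d alone. A quotient requires an invertible denominator. Elimination
-- gives den * B = num with num a product of invertible factors, so B divided by num is the inverse
-- of den.

-- The commutative ring of power series

module PowerSeriesRings where

  open import Algebra.Bundles using (CommutativeRing; RawRing)
  open import Data.Nat.Base using (zero; suc)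
  open import Level using (Level)
  open import Data.Product.Base using (_,_)
  import Relation.Binary.Reasoning.Setoid as SetoidReasoning
  open import Algebra.Properties.CommutativeSemigroup using (interchange)
  import Defs

  module PowerSeriesRing {r ℓ : Level} (R : CommutativeRing r ℓ) where
    private module R = CommutativeRing R
    open R using (_≈_; _+_; _*_; -_; 0#; 1#; Carrier)
    open SetoidReasoning R.setoid

    private module S = RawRing (Defs.PowerSeries R.rawRing)
    open S using () renaming (_≈_ to _≋_; _+_ to _⊞_; _*_ to _⊠_)

    tail : S.Carrier → S.Carrier
    tail f n = f (suc n)

    ⊠-cong : ∀ {f f′ g g′} → f ≋ f′ → g ≋ g′ → (f ⊠ g) ≋ (f′ ⊠ g′)
    ⊠-cong p q zero    = R.+-congʳ (R.*-cong (p 0) (q 0))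
    ⊠-cong p q (suc n) = R.+-cong (R.*-cong (p 0) (q (suc n))) (⊠-cong (λ i → p (suc i)) q n)

    -- The Cauchy product unfolds by definition at the term `f 0 * g (suc n)`. Commutativity
    -- exchanges the two ends of the sum, so the other end has to be split off as well.
    ⊠-suc : ∀ f g n → (f ⊠ g) (suc n) ≈ (f ⊠ tail g) n + f (suc n) * g 0
    ⊠-suc f g zero    = begin
      f 0 * g 1 + (f 1 * g 0 + 0#)  ≈⟨ R.+-congˡ (R.+-identityʳ _) ⟩
      f 0 * g 1 + f 1 * g 0         ≈⟨ R.+-congʳ (R.+-identityʳ _) ⟨
      f 0 * g 1 + 0# + f 1 * g 0    ∎
    ⊠-suc f g (suc n) = R.trans (R.+-congˡ (⊠-suc (tail f) g n)) (R.sym (R.+-assoc _ _ _))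

    ⊠-comm : ∀ f g → (f ⊠ g) ≋ (g ⊠ f)
    ⊠-comm f g zero    = R.+-congʳ (R.*-comm (f 0) (g 0))
    ⊠-comm f g (suc n) = begin
      f 0 * g (suc n) + (tail f ⊠ g) n  ≈⟨ R.+-cong (R.*-comm _ _) (⊠-comm (tail f) g n) ⟩
      g (suc n) * f 0 + (g ⊠ tail f) n  ≈⟨ R.+-comm _ _ ⟩
      (g ⊠ tail f) n + g (suc n) * f 0  ≈⟨ ⊠-suc g f n ⟨
      (g ⊠ f) (suc n)                   ∎

    ⊠-distribʳ : ∀ h f g → ((f ⊞ g) ⊠ h) ≋ ((f ⊠ h) ⊞ (g ⊠ h))
    ⊠-distribʳ h f g zero    = begin
      (f 0 + g 0) * h 0 + 0#               ≈⟨ R.+-cong (R.distribʳ _ _ _) (R.sym (R.+-identityʳ 0#)) ⟩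
      f 0 * h 0 + g 0 * h 0 + (0# + 0#)    ≈⟨ interchange R.+-commutativeSemigroup _ _ _ _ ⟩
      (f 0 * h 0 + 0#) + (g 0 * h 0 + 0#)  ∎
    ⊠-distribʳ h f g (suc n) =
      R.trans (R.+-cong (R.distribʳ _ _ _) (⊠-distribʳ h (tail f) (tail g) n))
              (interchange R.+-commutativeSemigroup _ _ _ _)

    scale-⊠ : ∀ a f g n → ((λ i → a * f i) ⊠ g) n ≈ a * (f ⊠ g) n
    scale-⊠ a f g zero    = begin
      a * f 0 * g 0 + 0#      ≈⟨ R.+-identityʳ _ ⟩
      a * f 0 * g 0           ≈⟨ R.*-assoc _ _ _ ⟩
      a * (f 0 * g 0)         ≈⟨ R.*-congˡ (R.+-identityʳ _) ⟨
      a * (f 0 * g 0 + 0#)    ∎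
    scale-⊠ a f g (suc n) =
      R.trans (R.+-cong (R.*-assoc _ _ _) (scale-⊠ a (tail f) g n)) (R.sym (R.distribˡ _ _ _))

    -- Induction on the coefficient works because the tail of `f ⊠ g` is `f 0` times `tail g` plus
    -- `tail f ⊠ g`; distributivity and scaling then lead back to the tail of `f`.
    ⊠-assoc : ∀ f g h → ((f ⊠ g) ⊠ h) ≋ (f ⊠ (g ⊠ h))
    ⊠-assoc f g h zero    = begin
      (f 0 * g 0 + 0#) * h 0 + 0#    ≈⟨ R.+-congʳ (R.*-congʳ (R.+-identityʳ _)) ⟩
      f 0 * g 0 * h 0 + 0#           ≈⟨ R.+-congʳ (R.*-assoc _ _ _) ⟩
      f 0 * (g 0 * h 0) + 0#         ≈⟨ R.+-congʳ (R.*-congˡ (R.+-identityʳ _)) ⟨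
      f 0 * (g 0 * h 0 + 0#) + 0#    ∎
    ⊠-assoc f g h (suc n) = begin
      (f 0 * g 0 + 0#) * h (suc n) + (((λ i → f 0 * tail g i) ⊞ (tail f ⊠ g)) ⊠ h) n
        ≈⟨ R.+-cong (R.trans (R.*-congʳ (R.+-identityʳ _)) (R.*-assoc _ _ _))
                    (⊠-distribʳ h (λ i → f 0 * tail g i) (tail f ⊠ g) n) ⟩
      f 0 * (g 0 * h (suc n)) + (((λ i → f 0 * tail g i) ⊠ h) n + ((tail f ⊠ g) ⊠ h) n)
        ≈⟨ R.+-congˡ (R.+-cong (scale-⊠ (f 0) (tail g) h n) (⊠-assoc (tail f) g h n)) ⟩
      f 0 * (g 0 * h (suc n)) + (f 0 * (tail g ⊠ h) n + (tail f ⊠ (g ⊠ h)) n)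
        ≈⟨ R.+-assoc _ _ _ ⟨
      f 0 * (g 0 * h (suc n)) + f 0 * (tail g ⊠ h) n + (tail f ⊠ (g ⊠ h)) n
        ≈⟨ R.+-congʳ (R.distribˡ _ _ _) ⟨
      f 0 * (g 0 * h (suc n) + (tail g ⊠ h) n) + (tail f ⊠ (g ⊠ h)) n  ∎

    0⊠ : ∀ f n → ((λ _ → 0#) ⊠ f) n ≈ 0#
    0⊠ f zero    = R.trans (R.+-identityʳ _) (R.zeroˡ _)
    0⊠ f (suc n) = R.trans (R.+-cong (R.zeroˡ _) (0⊠ f n)) (R.+-identityʳ _)

    constant-⊠ : ∀ a f n → (Defs.constant R.rawRing a ⊠ f) n ≈ a * f n
    constant-⊠ a f zero    = R.+-identityʳ _
    constant-⊠ a f (suc n) = R.trans (R.+-congˡ (0⊠ f n)) (R.+-identityʳ _)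

    variable₁-⊠-zero : ∀ f → (Defs.variable₁ R.rawRing ⊠ f) 0 ≈ 0#
    variable₁-⊠-zero f = R.trans (R.+-identityʳ _) (R.zeroˡ _)

    variable₁-⊠-suc : ∀ f n → (Defs.variable₁ R.rawRing ⊠ f) (suc n) ≈ f n
    variable₁-⊠-suc f n = begin
      0# * f (suc n) + (tail (Defs.variable₁ R.rawRing) ⊠ f) n
        ≈⟨ R.+-cong (R.zeroˡ _) (⊠-cong {g = f} tail-variable₁ (λ _ → R.refl) n) ⟩
      0# + (Defs.constant R.rawRing 1# ⊠ f) n  ≈⟨ R.+-identityˡ _ ⟩
      (Defs.constant R.rawRing 1# ⊠ f) n       ≈⟨ constant-⊠ 1# f n ⟩
      1# * f n                                 ≈⟨ R.*-identityˡ _ ⟩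
      f n                                      ∎
      where
      tail-variable₁ : tail (Defs.variable₁ R.rawRing) ≋ Defs.constant R.rawRing 1#
      tail-variable₁ zero    = R.refl
      tail-variable₁ (suc _) = R.refl

    ring : CommutativeRing r ℓ
    ring = record
      { _≈_ = _≋_
      ; _+_ = _⊞_
      ; _*_ = _⊠_
      ; -_  = S.-_
      ; 0#  = S.0#
      ; 1#  = S.1#
      ; isCommutativeRing = record
        { isRing = record
          { +-isAbelianGroup = record
            { isGroup = record
              { isMonoid = record
                { isSemigroup = record
                  { isMagma = record
                    { isEquivalence = record
                      { refl  = λ _ → R.refl
                      ; sym   = λ p n → R.sym (p n)
                      ; trans = λ p q n → R.trans (p n) (q n)
                      }
                    ; ∙-cong = λ p q n → R.+-cong (p n) (q n)
                    }
                  ; assoc = λ f g h n → R.+-assoc (f n) (g n) (h n)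
                  }
                ; identity = (λ f n → R.+-identityˡ (f n)) , (λ f n → R.+-identityʳ (f n))
                }
              ; inverse = (λ f n → R.-‿inverseˡ (f n)) , (λ f n → R.-‿inverseʳ (f n))
              ; ⁻¹-cong = λ p n → R.-‿cong (p n)
              }
            ; comm = λ f g n → R.+-comm (f n) (g n)
            }
          ; *-cong = λ {f f′ g g′} → ⊠-cong {f} {f′} {g} {g′}
          ; *-assoc = ⊠-assoc
          ; *-identity = identityˡ , (λ f n → R.trans (⊠-comm f S.1# n) (identityˡ f n))
          ; distrib = (λ h f g n → R.trans (⊠-comm h (f ⊞ g) n) (R.trans (⊠-distribʳ h f g n)
                        (R.+-cong (⊠-comm f h n) (⊠-comm g h n))))
                    , ⊠-distribʳ
          }
        ; *-comm = ⊠-comm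
        }
      }
      where
      identityˡ : ∀ f → (S.1# ⊠ f) ≋ f
      identityˡ f n = R.trans (constant-⊠ 1# f n) (R.*-identityˡ (f n))

-- Solving the linear system

module GrammarAlgebra where

  open import Algebra.Bundles using (CommutativeRing; RawRing)
  open import Algebra.Solver.Ring.AlmostCommutativeRing using (fromCommutativeRing; _-Raw-AlmostCommutative⟶_)
  import Algebra.Solver.Ring as RingSolver
  open import Data.Nat.Base as ℕ using (ℕ; zero; suc)
  open import Data.Integer.Base as ℤ using (ℤ; +_; -[1+_])
  import Data.Integer.Properties as ℤ
  open import Data.Maybe.Base using (Maybe; just; nothing)
  open import Level using (Level)
  import Relation.Binary.Reasoning.Setoid as SetoidReasoning
  import Relation.Binary.PropositionalEquality as ≡
  open import Relation.Nullary.Decidable using (yes; no)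
  import Algebra.Definitions.RawSemiring as RawSemiringOps
  import Algebra.Properties.Ring as RingProperties
  import Algebra.Properties.AbelianGroup as AbelianGroupProperties

  -- Equality of power series cannot be decided, so polynomial identities are normalised with
  -- integer coefficients, which `ι` maps into the ring.
  module IntegerPolynomials {r ℓ : Level} (A : CommutativeRing r ℓ) where
    open CommutativeRing A
    open RingProperties ring
    open AbelianGroupProperties +-abelianGroup using (⁻¹-∙-comm)
    open SetoidReasoning setoid

    private
      -- The separate clause at 1 makes the constant 1 evaluate to `1#` itself and not to `1# + 0#`;
      -- this is the form in which it occurs in `num` and `den`.
      ν : ℕ → Carrier
      ν 0             = 0#
      ν 1             = 1#
      ν (suc (suc n)) = 1# + ν (suc n)

      ν-suc : ∀ n → ν (suc n) ≈ 1# + ν n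
      ν-suc zero    = sym (+-identityʳ 1#)
      ν-suc (suc n) = refl

      ν-+ : ∀ m n → ν (m ℕ.+ n) ≈ ν m + ν n
      ν-+ zero    n = sym (+-identityˡ _)
      ν-+ (suc m) n = begin
        ν (suc (m ℕ.+ n))   ≈⟨ ν-suc (m ℕ.+ n) ⟩
        1# + ν (m ℕ.+ n)    ≈⟨ +-congˡ (ν-+ m n) ⟩
        1# + (ν m + ν n)    ≈⟨ +-assoc _ _ _ ⟨
        1# + ν m + ν n      ≈⟨ +-congʳ (ν-suc m) ⟨
        ν (suc m) + ν n     ∎

      ν-* : ∀ m n → ν (m ℕ.* n) ≈ ν m * ν n
      ν-* zero    n = sym (zeroˡ _)
      ν-* (suc m) n = begin
        ν (n ℕ.+ m ℕ.* n)      ≈⟨ ν-+ n (m ℕ.* n) ⟩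
        ν n + ν (m ℕ.* n)      ≈⟨ +-cong (sym (*-identityˡ _)) (ν-* m n) ⟩
        1# * ν n + ν m * ν n   ≈⟨ distribʳ _ _ _ ⟨
        (1# + ν m) * ν n       ≈⟨ *-congʳ (ν-suc m) ⟨
        ν (suc m) * ν n        ∎

      ι : ℤ → Carrier
      ι (+ n)    = ν n
      ι -[1+ n ] = - ν (suc n)

      ι-⊖ : ∀ m n → ι (m ℤ.⊖ n) ≈ ν m - ν n
      ι-⊖ m       zero    = begin
        ν m          ≈⟨ +-identityʳ _ ⟨
        ν m + 0#     ≈⟨ +-congˡ -0#≈0# ⟨
        ν m - 0#     ∎
      ι-⊖ zero    (suc n) = sym (+-identityˡ _)
      ι-⊖ (suc m) (suc n) = begin
        ι (suc m ℤ.⊖ suc n)            ≡⟨ ≡.cong ι (ℤ.[1+m]⊖[1+n]≡m⊖n m n) ⟩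
        ι (m ℤ.⊖ n)                    ≈⟨ ι-⊖ m n ⟩
        ν m - ν n                      ≈⟨ +-identityˡ _ ⟨
        0# + (ν m - ν n)               ≈⟨ +-congʳ (-‿inverseʳ 1#) ⟨
        1# - 1# + (ν m - ν n)          ≈⟨ +-assoc _ _ _ ⟩
        1# + (- 1# + (ν m - ν n))      ≈⟨ +-congˡ (+-assoc _ _ _) ⟨
        1# + (- 1# + ν m - ν n)        ≈⟨ +-congˡ (+-congʳ (+-comm _ _)) ⟩
        1# + (ν m - 1# - ν n)          ≈⟨ +-congˡ (+-assoc _ _ _) ⟩
        1# + (ν m + (- 1# - ν n))      ≈⟨ +-assoc _ _ _ ⟨
        1# + ν m + (- 1# - ν n)        ≈⟨ +-cong (sym (ν-suc m)) (⁻¹-∙-comm _ _) ⟩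
        ν (suc m) - (1# + ν n)         ≈⟨ +-congˡ (-‿cong (ν-suc n)) ⟨
        ν (suc m) - ν (suc n)          ∎

      ι-+ : ∀ i j → ι (i ℤ.+ j) ≈ ι i + ι j
      ι-+ (+ m)    (+ n)    = ν-+ m n
      ι-+ (+ m)    -[1+ n ] = ι-⊖ m (suc n)
      ι-+ -[1+ m ] (+ n)    = trans (ι-⊖ n (suc m)) (+-comm _ _)
      ι-+ -[1+ m ] -[1+ n ] = begin
        - (1# + ν (suc (m ℕ.+ n)))          ≈⟨ -‿cong (+-congˡ (ν-+ (suc m) n)) ⟩
        - (1# + (ν (suc m) + ν n))          ≈⟨ -‿cong (+-assoc _ _ _) ⟨
        - (1# + ν (suc m) + ν n)            ≈⟨ -‿cong (+-congʳ (+-comm _ _)) ⟩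
        - (ν (suc m) + 1# + ν n)            ≈⟨ -‿cong (+-assoc _ _ _) ⟩
        - (ν (suc m) + (1# + ν n))          ≈⟨ -‿cong (+-congˡ (ν-suc n)) ⟨
        - (ν (suc m) + ν (suc n))           ≈⟨ ⁻¹-∙-comm _ _ ⟨
        - ν (suc m) - ν (suc n)             ∎

      ι-neg : ∀ i → ι (ℤ.- i) ≈ - ι i
      ι-neg (+ zero)  = sym -0#≈0#
      ι-neg (+ suc n) = refl
      ι-neg -[1+ n ]  = sym (-‿involutive _)

      ι-+* : ∀ m j → ι (+ m ℤ.* j) ≈ ν m * ι j
      ι-+* m (+ n)    = trans (reflexive (≡.cong ι (≡.sym (ℤ.pos-* m n)))) (ν-* m n)
      ι-+* m -[1+ n ] = begin
        ι (+ m ℤ.* -[1+ n ])      ≡⟨ ≡.cong ι (ℤ.neg-distribʳ-* (+ m) (+ suc n)) ⟨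
        ι (ℤ.- (+ m ℤ.* + suc n)) ≡⟨ ≡.cong (λ k → ι (ℤ.- k)) (ℤ.pos-* m (suc n)) ⟨
        ι (ℤ.- + (m ℕ.* suc n))   ≈⟨ ι-neg (+ (m ℕ.* suc n)) ⟩
        - ν (m ℕ.* suc n)         ≈⟨ -‿cong (ν-* m (suc n)) ⟩
        - (ν m * ν (suc n))       ≈⟨ -‿distribʳ-* _ _ ⟩
        ν m * - ν (suc n)         ∎

      ι-* : ∀ i j → ι (i ℤ.* j) ≈ ι i * ι j
      ι-* (+ m)    j = ι-+* m j
      ι-* -[1+ m ] j = begin
        ι (-[1+ m ] ℤ.* j)       ≡⟨ ≡.cong ι (ℤ.neg-distribˡ-* (+ suc m) j) ⟨
        ι (ℤ.- (+ suc m ℤ.* j))  ≈⟨ ι-neg (+ suc m ℤ.* j) ⟩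
        - ι (+ suc m ℤ.* j)      ≈⟨ -‿cong (ι-+* (suc m) j) ⟩
        - (ν (suc m) * ι j)      ≈⟨ -‿distribˡ-* _ _ ⟩
        - ν (suc m) * ι j        ∎

      morphism : ℤ.+-*-rawRing -Raw-AlmostCommutative⟶ fromCommutativeRing A
      morphism = record
        { ⟦_⟧    = ι
        ; +-homo = ι-+
        ; *-homo = ι-*
        ; -‿homo = ι-neg
        ; 0-homo = refl
        ; 1-homo = refl
        }

      ι-≟ : ∀ i j → Maybe (ι i ≈ ι j)
      ι-≟ i j with i ℤ.≟ j
      ... | yes ≡.refl = just refl
      ... | no _          = nothing

    open RingSolver ℤ.+-*-rawRing (fromCommutativeRing A) morphism ι-≟ public
      using (solve; _:=_; _:+_; _:*_; _:-_; con; Polynomial)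

  module GrammarSolution {r ℓ : Level} (A : CommutativeRing r ℓ) where
    open CommutativeRing A
    open RawSemiringOps (RawRing.rawSemiring rawRing) using (_^_) renaming (_×_ to _·_)
    open IntegerPolynomials A
    open SetoidReasoning setoid

    module _ (t x y : Carrier) where
      num den : Carrier
      num = (1# - x) ^ 2 * (1# - 2 · y)
      den = 1# - 3 · x - 3 · y - t + 2 · x ^ 2 + 5 · (x * y) + t * x
              - 5 · (x ^ 2 * y) - 4 · (t * x * y) - t ^ 2 * y

      private
        diff≈0 : ∀ {u v} → u ≈ v → u - v ≈ 0#
        diff≈0 {u} {v} p = trans (+-congʳ p) (-‿inverseʳ v)

        _∙0 : ∀ {k u} → u ≈ 0# → k * u ≈ 0#
        _∙0 {k} p = trans (*-congˡ p) (zeroʳ k)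

        _+0_ : ∀ {u v} → u ≈ 0# → v ≈ 0# → u + v ≈ 0#
        p +0 q = trans (+-cong p q) (+-identityʳ 0#)

        :1 : ∀ {n} → Polynomial n
        :1 = con (+ 1)

        infixr 9 _:·_ _:^_
        -- These repeat the recursions of `_·_` and `_^_`, so that `:num` and `:den` evaluate to
        -- `num` and `den` by mere unfolding.
        _:·_ : ∀ {n} → ℕ → Polynomial n → Polynomial n
        zero  :· p = con (+ 0)
        suc k :· p = p :+ (k :· p)

        _:^_ : ∀ {n} → Polynomial n → ℕ → Polynomial n
        p :^ zero  = :1
        p :^ suc k = p :* (p :^ k)

        :num : ∀ {n} → Polynomial n → Polynomial n → Polynomial n
        :num x y = ((:1 :- x) :^ 2) :* (:1 :- (2 :· y))

        :den : ∀ {n} → Polynomial n → Polynomial n → Polynomial n → Polynomial n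
        :den t x y = :1 :- (3 :· x) :- (3 :· y) :- t :+ (2 :· (x :^ 2)) :+ (5 :· (x :* y)) :+ (t :* x)
              :- (5 :· ((x :^ 2) :* y)) :- (4 :· (t :* x :* y)) :- ((t :^ 2) :* y)

      -- The products `t * B`, `x * Q` and so on enter as separate series because in the application
      -- they are sums of shifted sequences, equal to the products only up to `≈`.
      den*B≈num : ∀ B Q P R S G u tB tQ xB xQ xP xR xS yG →
        u ≈ 1# → tB ≈ t * B → tQ ≈ t * Q →
        xB ≈ x * B → xQ ≈ x * Q → xP ≈ x * P → xR ≈ x * R → xS ≈ x * S → yG ≈ y * G →
        B ≈ u + (P + yG) →
        Q ≈ B + tB + xQ →
        P ≈ tB + xB + xP →
        R ≈ Q + tQ + xR →
        S ≈ xQ + xP + xS →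
        G ≈ R + S + (yG + yG) →
        den * B ≈ num
      den*B≈num B Q P R S G u tB tQ xB xQ xP xR xS yG eu etB etQ exB exQ exP exR exS eyG hB hQ hP hR hS hG = begin
        den * B
          ≈⟨ solve 9 (λ t x y B Q P R S G → :den t x y :* B :=
               :num x y :+
               -- Once the equation for `B` is multiplied by `num`, the other multipliers are
               -- forced: cancelling `G` gives `y (1 - x)^2`, then cancelling `R` and `S` gives
               -- `y (1 - x)`, and cancelling `P` and `Q` gives the remaining two.
               ( (:1 :- x) :* (:1 :- x) :* (:1 :- y :- y) :* (B :- (:1 :+ (P :+ y :* G)))
               :+ ((:1 :- y :- y) :* (:1 :- x) :+ y :* x) :* (P :- (t :* B :+ x :* B :+ x :* P))
               :+ y :* (:1 :- x) :* (:1 :- x) :* (G :- (R :+ S :+ (y :* G :+ y :* G)))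
               :+ y :* (:1 :- x) :* (R :- (Q :+ t :* Q :+ x :* R))
               :+ y :* (:1 :- x) :* (S :- (x :* Q :+ x :* P :+ x :* S))
               :+ y :* (:1 :+ t :+ x) :* (Q :- (B :+ t :* B :+ x :* Q)))) refl t x y B Q P R S G ⟩
        num + _  ≈⟨ +-congˡ ((((((diff≈0 hB′ ∙0) +0 (diff≈0 hP′ ∙0)) +0 (diff≈0 hG′ ∙0)) +0 (diff≈0 hR′ ∙0)) +0 (diff≈0 hS′ ∙0)) +0 (diff≈0 hQ′ ∙0)) ⟩
        num + 0# ≈⟨ +-identityʳ _ ⟩
        num      ∎
        where
        hB′ = trans hB (+-cong eu (+-congˡ eyG))
        hQ′ = trans hQ (+-cong (+-congˡ etB) exQ)
        hP′ = trans hP (+-cong (+-cong etB exB) exP)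
        hR′ = trans hR (+-cong (+-congˡ etQ) exR)
        hS′ = trans hS (+-cong (+-cong exQ exP) exS)
        hG′ = trans hG (+-congˡ (+-cong eyG eyG))

      -- `X` and `Y` are inverses of `1 - x` and `1 - 2y`, so `X * X * Y` inverts `num`, and a
      -- solution of `den * B ≈ num` brings an inverse of `den` with it.
      den-inverse : ∀ {B X Y} → den * B ≈ num → X ≈ 1# + x * X → Y ≈ 1# + (y * Y + y * Y) →
        den * (B * (X * X * Y)) ≈ 1#
      den-inverse {B} {X} {Y} h hX hY = begin
        den * (B * (X * X * Y))  ≈⟨ *-assoc _ _ _ ⟨
        den * B * (X * X * Y)    ≈⟨ *-congʳ h ⟩
        num * (X * X * Y)
          ≈⟨ solve 4 (λ x y X Y → :num x y :* (X :* X :* Y) :=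
                -- With a = (1 - x) X and b = (1 - 2y) Y this is the identity a^2 b = 1 + b (a +
                -- 1)(a - 1) + (b - 1).
                :1 :+ (((:1 :- y :- y) :* Y :* ((:1 :- x) :* X :+ :1) :* (X :- (:1 :+ x :* X)))
                  :+ :1 :* (Y :- (:1 :+ (y :* Y :+ y :* Y))))) refl x y X Y ⟩
        1# + _    ≈⟨ +-congˡ ((diff≈0 hX ∙0) +0 (diff≈0 hY ∙0)) ⟩
        1# + 0#   ≈⟨ +-identityʳ _ ⟩
        1#        ∎

-- Codes for the words and their enumeration by size

module Trees where

  open import Data.Nat.Base using (ℕ; zero; suc; _+_)
  open import Data.Nat.Properties using (+-assoc)
  open import Data.List.Base using (List; []; _∷_; _++_; map)
  open import Data.List.Membership.Propositional using (_∈_)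
  open import Data.List.Membership.Propositional.Properties using (∈-map⁺; ∈-map⁻; ∈-++⁺ˡ; ∈-++⁺ʳ; ∈-++⁻)
  open import Data.List.Relation.Binary.Disjoint.Propositional using (Disjoint)
  open import Data.List.Relation.Unary.All as All using (All; []; _∷_)
  import Data.List.Relation.Unary.All.Properties as All
  open import Data.List.Relation.Unary.Any using (here)
  open import Data.List.Relation.Unary.Unique.Propositional using (Unique; []; _∷_)
  import Data.List.Relation.Unary.Unique.Propositional.Properties as Unique
  open import Data.Product.Base using (_×_; _,_; map₁; uncurry)
  open import Data.Sum.Base using (inj₁; inj₂)
  open import Function.Base using (_∘_)
  open import Relation.Binary.PropositionalEquality using (_≡_; _≢_; refl; sym; trans; cong; subst)

  -- A word of 𝔖[3]⟨231⟩ is a direct sum of indecomposable blocks, each starting with its largest entry.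
  -- dec k is the decreasing block of length k + 1, and cyc γ is the block whose extreme positions lie on a
  -- 3-cycle 0 ↦ last ↦ s + 1 ↦ 0, where s = split γ and γ encodes the pattern of the remaining entries:
  -- pair s r is the direct sum of two decreasing words of lengths s and r, nest s r is a single decreasing
  -- word of length s + r + 2 with split s + 1, and cycA and cycB wrap a 3-cycle around a smaller core, the
  -- split being just before or just after the middle position of that 3-cycle.
  data Core : Set where
    pair nest : (s r : ℕ) → Core
    cycA cycB : Core → Core

  data Tree : Set where
    nil : Tree
    dec : (k : ℕ) → Tree → Tree
    cyc : Core → Tree → Tree

  split : Core → ℕ
  split (pair s r) = s
  split (nest s r) = suc s
  split (cycA γ)   = suc (split γ)
  split (cycB γ)   = suc (suc (split γ))

  size : Core → ℕ
  size (pair s r) = s + r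
  size (nest s r) = suc (suc (s + r))
  size (cycA γ)   = suc (suc (suc (size γ)))
  size (cycB γ)   = suc (suc (suc (size γ)))

  sizeᵀ : Tree → ℕ
  sizeᵀ nil       = 0
  sizeᵀ (dec k τ) = suc (k + sizeᵀ τ)
  sizeᵀ (cyc γ τ) = suc (suc (suc (size γ + sizeᵀ τ)))

  module _ {A : Set} where

    -- The index measures a decreasing word: raising it by 2 puts a 2-cycle around the word, and 0
    -- and 1 are the base cases. The three lists become the three terms of the equations for Q, P, R
    -- and S.
    step : List A → List A → List (ℕ × A) → List (ℕ × A)
    step us vs ws = map (0 ,_) us ++ map (1 ,_) vs ++ map (map₁ (suc ∘ suc)) ws

    All-step : ∀ {P : ℕ × A → Set} {us vs ws} →
      All (λ a → P (0 , a)) us → All (λ a → P (1 , a)) vs → All (λ (k , a) → P (suc (suc k) , a)) ws →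
      All P (step us vs ws)
    All-step p q r = All.++⁺ (All.map⁺ p) (All.++⁺ (All.map⁺ q) (All.map⁺ r))

    ∈-step₀ : ∀ {a us} vs ws → a ∈ us → (0 , a) ∈ step us vs ws
    ∈-step₀ vs ws p = ∈-++⁺ˡ {ys = map (1 ,_) vs ++ map (map₁ (suc ∘ suc)) ws} (∈-map⁺ _ p)

    ∈-step₁ : ∀ {a} us {vs} ws → a ∈ vs → (1 , a) ∈ step us vs ws
    ∈-step₁ us ws p = ∈-++⁺ʳ (map (0 ,_) us) (∈-++⁺ˡ {ys = map (map₁ (suc ∘ suc)) ws} (∈-map⁺ _ p))

    ∈-step₂ : ∀ {k a} us vs {ws} → (k , a) ∈ ws → (suc (suc k) , a) ∈ step us vs ws
    ∈-step₂ us vs p = ∈-++⁺ʳ (map (0 ,_) us) (∈-++⁺ʳ (map (1 ,_) vs) (∈-map⁺ _ p))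

  map-disjoint : ∀ {A B C : Set} {f : A → C} {g : B → C} as bs → (∀ a b → f a ≢ g b) →
    Disjoint (map f as) (map g bs)
  map-disjoint as bs f≢g (p , q) with ∈-map⁻ _ p | ∈-map⁻ _ q
  ... | a , _ , refl | b , _ , eq = f≢g a b eq

  disjoint-++ : ∀ {A : Set} {as} (bs : List A) {cs} → Disjoint as bs → Disjoint as cs → Disjoint as (bs ++ cs)
  disjoint-++ bs p q (a , b) with ∈-++⁻ bs b
  ... | inj₁ c = p (a , c)
  ... | inj₂ c = q (a , c)

  Unique-step : ∀ {A : Set} {us vs : List A} {ws} → Unique us → Unique vs → Unique ws → Unique (step us vs ws)
  Unique-step {us = us} {vs} {ws} p q r =
    Unique.++⁺ (Unique.map⁺ (λ { refl → refl }) p)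
      (Unique.++⁺ (Unique.map⁺ (λ { refl → refl }) q) (Unique.map⁺ (λ { refl → refl }) r)
        (map-disjoint vs ws λ _ _ ()))
      (disjoint-++ (map (1 ,_) vs) (map-disjoint us vs λ _ _ ()) (map-disjoint us ws λ _ _ ()))

  pairᵀ nestᵀ : ℕ × ℕ × Tree → Core × Tree
  pairᵀ (s , r , τ) = pair s r , τ
  nestᵀ (s , r , τ) = nest s r , τ

  -- An item (k , τ) of decs n stands for a decreasing word of length k, one of decs⁺ n for a decreasing word
  -- of length k + 1, followed by τ; the total size is n.
  trees : ℕ → List Tree
  decs decs⁺ : ℕ → List (ℕ × Tree)
  pairs nests : ℕ → List (ℕ × ℕ × Tree)
  cores cycs : ℕ → List (Core × Tree)

  trees zero    = nil ∷ []
  -- The first block is nonempty, so `decs⁺ (suc n)` and `cycs (suc n)` use only trees of smaller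
  -- size, whereas `decs n` uses `trees n` itself. This keeps the mutual recursion well founded.
  trees (suc n) = map (uncurry dec) (decs⁺ (suc n)) ++ map (uncurry cyc) (cycs (suc n))

  decs 0             = step (trees 0) [] []
  decs 1             = step (trees 1) (trees 0) []
  decs (suc (suc n)) = step (trees (suc (suc n))) (trees (suc n)) (decs n)

  decs⁺ 0             = step [] [] []
  decs⁺ 1             = step (trees 0) [] []
  decs⁺ (suc (suc n)) = step (trees (suc n)) (trees n) (decs⁺ n)

  pairs 0             = step (decs 0) [] []
  pairs 1             = step (decs 1) (decs 0) []
  pairs (suc (suc n)) = step (decs (suc (suc n))) (decs (suc n)) (pairs n)

  nests 0             = step [] [] []
  nests 1             = step [] [] []
  -- Removing the outer 2-cycle from a decreasing word of length `s + r + 2` leaves length `r` if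
  -- `s = 0` and the positive length `r + 1` if `s = 1`; for larger `s` an interior cut survives,
  -- moved by 2.
  nests (suc (suc n)) = step (decs n) (decs⁺ n) (nests n)

  cores n = map pairᵀ (pairs n) ++ map nestᵀ (nests n) ++ map (map₁ cycA) (cycs n) ++ map (map₁ cycB) (cycs n)

  cycs 0                   = []
  cycs 1                   = []
  cycs 2                   = []
  cycs (suc (suc (suc n))) = cores n

  trees-unique : ∀ n → Unique (trees n)
  decs-unique : ∀ n → Unique (decs n)
  decs⁺-unique : ∀ n → Unique (decs⁺ n)
  pairs-unique : ∀ n → Unique (pairs n)
  nests-unique : ∀ n → Unique (nests n)
  cores-unique : ∀ n → Unique (cores n)
  cycs-unique : ∀ n → Unique (cycs n)

  trees-unique zero    = [] ∷ []
  trees-unique (suc n) =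
    Unique.++⁺ (Unique.map⁺ (λ { refl → refl }) (decs⁺-unique (suc n)))
      (Unique.map⁺ (λ { refl → refl }) (cycs-unique (suc n)))
      (map-disjoint (decs⁺ (suc n)) (cycs (suc n)) λ _ _ ())

  decs-unique 0             = Unique-step (trees-unique 0) [] []
  decs-unique 1             = Unique-step (trees-unique 1) (trees-unique 0) []
  decs-unique (suc (suc n)) = Unique-step (trees-unique (suc (suc n))) (trees-unique (suc n)) (decs-unique n)

  decs⁺-unique 0             = []
  decs⁺-unique 1             = Unique-step (trees-unique 0) [] []
  decs⁺-unique (suc (suc n)) = Unique-step (trees-unique (suc n)) (trees-unique n) (decs⁺-unique n)

  pairs-unique 0             = Unique-step (decs-unique 0) [] []
  pairs-unique 1             = Unique-step (decs-unique 1) (decs-unique 0) []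
  pairs-unique (suc (suc n)) = Unique-step (decs-unique (suc (suc n))) (decs-unique (suc n)) (pairs-unique n)

  nests-unique 0             = []
  nests-unique 1             = []
  nests-unique (suc (suc n)) = Unique-step (decs-unique n) (decs⁺-unique n) (nests-unique n)

  cores-unique n =
    Unique.++⁺ (Unique.map⁺ (λ { refl → refl }) (pairs-unique n))
      (Unique.++⁺ (Unique.map⁺ (λ { refl → refl }) (nests-unique n))
        (Unique.++⁺ (Unique.map⁺ (λ { refl → refl }) (cycs-unique n))
          (Unique.map⁺ (λ { refl → refl }) (cycs-unique n))
          (map-disjoint γs γs λ _ _ ()))
        (disjoint-++ (map (map₁ cycA) γs) (map-disjoint ns γs λ _ _ ()) (map-disjoint ns γs λ _ _ ())))
      (disjoint-++ (map nestᵀ ns) (map-disjoint ps ns λ _ _ ())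
        (disjoint-++ (map (map₁ cycA) γs) (map-disjoint ps γs λ _ _ ()) (map-disjoint ps γs λ _ _ ())))
    where
    ps = pairs n
    ns = nests n
    γs = cycs n

  cycs-unique 0                   = []
  cycs-unique 1                   = []
  cycs-unique 2                   = []
  cycs-unique (suc (suc (suc n))) = cores-unique n

  trees-size : ∀ n → All (λ τ → sizeᵀ τ ≡ n) (trees n)
  decs-size : ∀ n → All (λ (k , τ) → k + sizeᵀ τ ≡ n) (decs n)
  decs⁺-size : ∀ n → All (λ (k , τ) → suc (k + sizeᵀ τ) ≡ n) (decs⁺ n)
  pairs-size : ∀ n → All (λ (s , r , τ) → s + (r + sizeᵀ τ) ≡ n) (pairs n)
  nests-size : ∀ n → All (λ (s , r , τ) → suc (suc (s + (r + sizeᵀ τ))) ≡ n) (nests n)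
  cores-size : ∀ n → All (λ (γ , τ) → size γ + sizeᵀ τ ≡ n) (cores n)
  cycs-size : ∀ n → All (λ (γ , τ) → suc (suc (suc (size γ + sizeᵀ τ))) ≡ n) (cycs n)

  private
    s≡ : ∀ {A : Set} {f : A → ℕ} {n as} → All (λ a → f a ≡ n) as → All (λ a → suc (f a) ≡ suc n) as
    s≡ = All.map (cong suc)

  trees-size zero    = refl ∷ []
  trees-size (suc n) = All.++⁺ (All.map⁺ (decs⁺-size (suc n))) (All.map⁺ (cycs-size (suc n)))

  decs-size 0             = All-step (trees-size 0) [] []
  decs-size 1             = All-step (trees-size 1) (s≡ (trees-size 0)) []
  decs-size (suc (suc n)) = All-step (trees-size (suc (suc n))) (s≡ (trees-size (suc n))) (s≡ (s≡ (decs-size n)))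

  decs⁺-size 0             = []
  decs⁺-size 1             = All-step (s≡ (trees-size 0)) [] []
  decs⁺-size (suc (suc n)) = All-step (s≡ (trees-size (suc n))) (s≡ (s≡ (trees-size n))) (s≡ (s≡ (decs⁺-size n)))

  pairs-size 0             = All-step (decs-size 0) [] []
  pairs-size 1             = All-step (decs-size 1) (s≡ (decs-size 0)) []
  pairs-size (suc (suc n)) = All-step (decs-size (suc (suc n))) (s≡ (decs-size (suc n))) (s≡ (s≡ (pairs-size n)))

  nests-size 0             = []
  nests-size 1             = []
  nests-size (suc (suc n)) = All-step (s≡ (s≡ (decs-size n))) (s≡ (s≡ (decs⁺-size n))) (s≡ (s≡ (nests-size n)))

  cores-size n =
    All.++⁺ (All.map⁺ (All.map (λ {(s , r , τ)} → trans (+-assoc s r (sizeᵀ τ))) (pairs-size n)))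
      (All.++⁺ (All.map⁺ (All.map (λ {(s , r , τ)} → trans (cong (suc ∘ suc) (+-assoc s r (sizeᵀ τ)))) (nests-size n)))
        (All.++⁺ (All.map⁺ (cycs-size n)) (All.map⁺ (cycs-size n))))

  cycs-size 0                   = []
  cycs-size 1                   = []
  cycs-size 2                   = []
  cycs-size (suc (suc (suc n))) = s≡ (s≡ (s≡ (cores-size n)))

  ∈-decs : ∀ k {τ} m → τ ∈ trees m → (k , τ) ∈ decs (k + m)
  ∈-decs 0 0             p = ∈-step₀ [] [] p
  ∈-decs 0 1             p = ∈-step₀ (trees 0) [] p
  ∈-decs 0 (suc (suc m)) p = ∈-step₀ (trees (suc m)) (decs m) p
  ∈-decs 1 0             p = ∈-step₁ (trees 1) [] p
  ∈-decs 1 (suc m)       p = ∈-step₁ (trees (suc (suc m))) (decs m) p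
  ∈-decs (suc (suc k)) m p = ∈-step₂ (trees (suc (suc (k + m)))) (trees (suc (k + m))) (∈-decs k m p)

  ∈-decs⁺ : ∀ k {τ} m → τ ∈ trees m → (k , τ) ∈ decs⁺ (suc (k + m))
  ∈-decs⁺ 0 0             p = ∈-step₀ [] [] p
  ∈-decs⁺ 0 (suc m)       p = ∈-step₀ (trees m) (decs⁺ m) p
  ∈-decs⁺ 1 m             p = ∈-step₁ (trees (suc m)) (decs⁺ m) p
  ∈-decs⁺ (suc (suc k)) m p = ∈-step₂ (trees (suc (suc (k + m)))) (trees (suc (k + m))) (∈-decs⁺ k m p)

  ∈-pairs : ∀ s {a} m → a ∈ decs m → (s , a) ∈ pairs (s + m)
  ∈-pairs 0 0             p = ∈-step₀ [] [] p
  ∈-pairs 0 1             p = ∈-step₀ (decs 0) [] p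
  ∈-pairs 0 (suc (suc m)) p = ∈-step₀ (decs (suc m)) (pairs m) p
  ∈-pairs 1 0             p = ∈-step₁ (decs 1) [] p
  ∈-pairs 1 (suc m)       p = ∈-step₁ (decs (suc (suc m))) (pairs m) p
  ∈-pairs (suc (suc s)) m p = ∈-step₂ (decs (suc (suc (s + m)))) (decs (suc (s + m))) (∈-pairs s m p)

  ∈-nests : ∀ s r {τ} m → τ ∈ trees m → (s , r , τ) ∈ nests (suc (suc (s + (r + m))))
  ∈-nests 0 r m p             = ∈-step₀ (decs⁺ (r + m)) (nests (r + m)) (∈-decs r m p)
  ∈-nests 1 r m p             = ∈-step₁ (decs (suc (r + m))) (nests (suc (r + m))) (∈-decs⁺ r m p)
  ∈-nests (suc (suc s)) r m p =
    ∈-step₂ (decs (suc (suc (s + (r + m))))) (decs⁺ (suc (suc (s + (r + m))))) (∈-nests s r m p)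

  ∈-cores : ∀ γ {τ} m → τ ∈ trees m → (γ , τ) ∈ cores (size γ + m)
  ∈-cores (pair s r) {τ} m p = subst (λ n → (pair s r , τ) ∈ cores n) (sym (+-assoc s r m))
    (∈-++⁺ˡ (∈-map⁺ pairᵀ (∈-pairs s (r + m) (∈-decs r m p))))
  ∈-cores (nest s r) {τ} m p = subst (λ n → (nest s r , τ) ∈ cores n) (cong (suc ∘ suc) (sym (+-assoc s r m)))
    (∈-++⁺ʳ (map pairᵀ (pairs n)) (∈-++⁺ˡ (∈-map⁺ nestᵀ (∈-nests s r m p))))
    where n = suc (suc (s + (r + m)))
  ∈-cores (cycA γ) m p =
    ∈-++⁺ʳ (map pairᵀ (pairs n)) (∈-++⁺ʳ (map nestᵀ (nests n)) (∈-++⁺ˡ (∈-map⁺ (map₁ cycA) (∈-cores γ m p))))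
    where n = suc (suc (suc (size γ + m)))
  ∈-cores (cycB γ) m p =
    ∈-++⁺ʳ (map pairᵀ (pairs n)) (∈-++⁺ʳ (map nestᵀ (nests n))
      (∈-++⁺ʳ (map (map₁ cycA) (cycs n)) (∈-map⁺ (map₁ cycB) (∈-cores γ m p))))
    where n = suc (suc (suc (size γ + m)))

  ∈-trees : ∀ τ → τ ∈ trees (sizeᵀ τ)
  ∈-trees nil       = here refl
  ∈-trees (dec k τ) = ∈-++⁺ˡ (∈-map⁺ (uncurry dec) (∈-decs⁺ k (sizeᵀ τ) (∈-trees τ)))
  ∈-trees (cyc γ τ) =
    ∈-++⁺ʳ (map (uncurry dec) (decs⁺ (sizeᵀ (cyc γ τ)))) (∈-map⁺ (uncurry cyc) (∈-cores γ (sizeᵀ τ) (∈-trees τ)))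

-- Weights of codes and the equations graded by size

module TreeSeries where

  open import Algebra.Bundles using (CommutativeRing)
  import Algebra.Properties.CommutativeSemigroup as CommutativeSemigroupProperties
  open import Data.Nat.Base as ℕ using (ℕ; zero; suc)
  open import Data.List.Base using (List; []; _∷_; _++_; map; foldr)
  open import Data.List.Relation.Binary.Permutation.Propositional as ↭ using (_↭_)
  open import Data.List.Relation.Unary.All using (All; []; _∷_)
  open import Data.Product.Base using (_×_; _,_; map₁; uncurry)
  open import Level using (Level)
  open import Function.Base using (_∘_)
  import Relation.Binary.Reasoning.Setoid as SetoidReasoning
  open Trees

  module TreeWeights {r ℓ : Level} (A : CommutativeRing r ℓ) (t x y : CommutativeRing.Carrier A) where
    open CommutativeRing A
    open CommutativeSemigroupProperties *-commutativeSemigroup using (x∙yz≈y∙xz)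
    open SetoidReasoning setoid

    -- A decreasing word is the reversal, a product of nested 2-cycles with a central fixed point
    -- when the length is odd.
    decWeight : ℕ → Carrier
    decWeight 0             = 1#
    decWeight 1             = t
    decWeight (suc (suc k)) = x * decWeight k

    coreWeight : Core → Carrier
    coreWeight (pair s r) = decWeight s * decWeight r
    coreWeight (nest s r) = decWeight (suc (suc (s ℕ.+ r)))
    coreWeight (cycA γ)   = y * coreWeight γ
    coreWeight (cycB γ)   = y * coreWeight γ

    treeWeight : Tree → Carrier
    treeWeight nil       = 1#
    treeWeight (dec k τ) = decWeight (suc k) * treeWeight τ
    treeWeight (cyc γ τ) = y * (coreWeight γ * treeWeight τ)

    Σ : ∀ {B : Set} → (B → Carrier) → List B → Carrier
    Σ w = foldr (λ b s → w b + s) 0#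

    Σ-cong : ∀ {B : Set} {v w : B → Carrier} → (∀ b → v b ≈ w b) → ∀ bs → Σ v bs ≈ Σ w bs
    Σ-cong v≈w []       = refl
    Σ-cong v≈w (b ∷ bs) = +-cong (v≈w b) (Σ-cong v≈w bs)

    Σ-congᴬ : ∀ {B : Set} {v w : B → Carrier} {bs} → All (λ b → v b ≈ w b) bs → Σ v bs ≈ Σ w bs
    Σ-congᴬ []       = refl
    Σ-congᴬ (p ∷ ps) = +-cong p (Σ-congᴬ ps)

    Σ-↭ : ∀ {B : Set} (w : B → Carrier) {as bs} → as ↭ bs → Σ w as ≈ Σ w bs
    Σ-↭ w ↭.refl          = refl
    Σ-↭ w (↭.prep a p)    = +-congˡ (Σ-↭ w p)
    Σ-↭ w (↭.swap a b p)  = trans (+-congˡ (+-congˡ (Σ-↭ w p)))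
      (trans (sym (+-assoc _ _ _)) (trans (+-congʳ (+-comm _ _)) (+-assoc _ _ _)))
    Σ-↭ w (↭.trans p q)   = trans (Σ-↭ w p) (Σ-↭ w q)

    Σ-++ : ∀ {B : Set} (w : B → Carrier) as bs → Σ w (as ++ bs) ≈ Σ w as + Σ w bs
    Σ-++ w []       bs = sym (+-identityˡ _)
    Σ-++ w (a ∷ as) bs = trans (+-congˡ (Σ-++ w as bs)) (sym (+-assoc _ _ _))

    Σ-map : ∀ {B C : Set} (w : C → Carrier) (f : B → C) bs → Σ w (map f bs) ≈ Σ (w ∘ f) bs
    Σ-map w f []       = refl
    Σ-map w f (b ∷ bs) = +-congˡ (Σ-map w f bs)

    Σ-*ˡ : ∀ {B : Set} k (w : B → Carrier) bs → Σ (λ b → k * w b) bs ≈ k * Σ w bs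
    Σ-*ˡ k w []       = sym (zeroʳ k)
    Σ-*ˡ k w (b ∷ bs) = trans (+-congˡ (Σ-*ˡ k w bs)) (sym (distribˡ _ _ _))

    Σ-map-*ˡ : ∀ {B C : Set} k (w : C → Carrier) (v : B → Carrier) (f : B → C) → (∀ b → w (f b) ≈ k * v b) →
      ∀ bs → Σ w (map f bs) ≈ k * Σ v bs
    Σ-map-*ˡ k w v f h bs = trans (Σ-map w f bs) (trans (Σ-cong h bs) (Σ-*ˡ k v bs))

    Σ-map-≈ : ∀ {B C : Set} (w : C → Carrier) (v : B → Carrier) (f : B → C) → (∀ b → w (f b) ≈ v b) →
      ∀ bs → Σ w (map f bs) ≈ Σ v bs
    Σ-map-≈ w v f h bs = trans (Σ-map w f bs) (Σ-cong h bs)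

    Σ-++₃ : ∀ {B : Set} (w : B → Carrier) as bs cs {α β γ} → Σ w as ≈ α → Σ w bs ≈ β → Σ w cs ≈ γ →
      Σ w (as ++ bs ++ cs) ≈ α + β + γ
    Σ-++₃ w as bs cs p q r =
      trans (Σ-++ w as (bs ++ cs))
        (trans (+-cong p (trans (Σ-++ w bs cs) (+-cong q r))) (sym (+-assoc _ _ _)))

    -- The index is the size: peeling off a cycle of length j contributes its variable and j shifts.
    -- Summing over all sizes turns both together into multiplication by the variable.
    shift : (ℕ → Carrier) → ℕ → Carrier
    shift F zero    = 0#
    shift F (suc n) = F n

    decItem dec⁺Item : ℕ × Tree → Carrier
    decItem  (k , τ) = decWeight k * treeWeight τ
    dec⁺Item (k , τ) = decWeight (suc k) * treeWeight τ

    pairItem nestItem : ℕ × ℕ × Tree → Carrier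
    pairItem (s , a)     = decWeight s * decItem a
    nestItem (s , r , τ) = decWeight (suc (suc (s ℕ.+ r))) * treeWeight τ

    coreItem : Core × Tree → Carrier
    coreItem (γ , τ) = coreWeight γ * treeWeight τ

    T D P R N C : ℕ → Carrier
    T n = Σ treeWeight (trees n)
    D n = Σ decItem (decs n)
    P n = Σ dec⁺Item (decs⁺ n)
    R n = Σ pairItem (pairs n)
    N n = Σ nestItem (nests n)
    C n = Σ coreItem (cores n)

    unit : ℕ → Carrier
    unit zero    = 1#
    unit (suc _) = 0#

    shift³yC : ℕ → Carrier
    shift³yC = shift (shift (shift λ n → y * C n))

    private
      -- `cyc`, `cycA` and `cycB` each put one 3-cycle around a core, so all three contribute the
      -- same series.
      cycs-Σ : ∀ {B : Set} (w : B → Carrier) (f : Core × Tree → B) → (∀ b → w (f b) ≈ y * coreItem b) →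
        ∀ n → Σ w (map f (cycs n)) ≈ shift³yC n
      cycs-Σ w f h 0                   = refl
      cycs-Σ w f h 1                   = refl
      cycs-Σ w f h 2                   = refl
      cycs-Σ w f h (suc (suc (suc n))) = Σ-map-*ˡ y w coreItem f h (cores n)

    T-eq : ∀ n → T n ≈ unit n + (P n + shift³yC n)
    T-eq zero    = +-congˡ (sym (+-identityʳ 0#))
    T-eq (suc n) = begin
      T (suc n)
        ≈⟨ Σ-++ treeWeight (map (uncurry dec) (decs⁺ (suc n))) (map (uncurry cyc) (cycs (suc n))) ⟩
      Σ treeWeight (map (uncurry dec) (decs⁺ (suc n))) + Σ treeWeight (map (uncurry cyc) (cycs (suc n)))
        ≈⟨ +-cong (Σ-map treeWeight (uncurry dec) (decs⁺ (suc n)))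
                  (cycs-Σ treeWeight (uncurry cyc) (λ _ → refl) (suc n)) ⟩
      P (suc n) + shift³yC (suc n)
        ≈⟨ +-identityˡ _ ⟨
      0# + (P (suc n) + shift³yC (suc n)) ∎

    D-eq : ∀ n → D n ≈ T n + shift (λ m → t * T m) n + shift (shift (λ m → x * D m)) n
    D-eq n = by n
      where
      case₀ : ∀ τs → Σ decItem (map (0 ,_) τs) ≈ Σ treeWeight τs
      case₀ = Σ-map-≈ decItem treeWeight (0 ,_) (λ _ → *-identityˡ _)
      case₁ : ∀ τs → Σ decItem (map (1 ,_) τs) ≈ t * Σ treeWeight τs
      case₁ = Σ-map-*ˡ t decItem treeWeight (1 ,_) (λ _ → refl)
      by : ∀ n → D n ≈ T n + shift (λ m → t * T m) n + shift (shift (λ m → x * D m)) n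
      by 0             = Σ-++₃ decItem (map (0 ,_) (trees 0)) [] [] (case₀ (trees 0)) refl refl
      by 1             = Σ-++₃ decItem (map (0 ,_) (trees 1)) (map (1 ,_) (trees 0)) []
                           (case₀ (trees 1)) (case₁ (trees 0)) refl
      by (suc (suc n)) = Σ-++₃ decItem (map (0 ,_) (trees (suc (suc n)))) (map (1 ,_) (trees (suc n)))
                           (map (map₁ (suc ∘ suc)) (decs n))
                           (case₀ (trees (suc (suc n)))) (case₁ (trees (suc n)))
                           (Σ-map-*ˡ x decItem decItem (map₁ (suc ∘ suc)) (λ _ → *-assoc _ _ _) (decs n))

    P-eq : ∀ n → P n ≈ shift (λ m → t * T m) n + shift (shift (λ m → x * T m)) n + shift (shift (λ m → x * P m)) n
    P-eq 0             = sym (trans (+-identityʳ _) (+-identityʳ _))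
    P-eq 1             = Σ-++₃ dec⁺Item (map (0 ,_) (trees 0)) [] []
                           (Σ-map-*ˡ t dec⁺Item treeWeight (0 ,_) (λ _ → refl) (trees 0)) refl refl
    P-eq (suc (suc n)) = Σ-++₃ dec⁺Item (map (0 ,_) (trees (suc n))) (map (1 ,_) (trees n))
                           (map (map₁ (suc ∘ suc)) (decs⁺ n))
                           (Σ-map-*ˡ t dec⁺Item treeWeight (0 ,_) (λ _ → refl) (trees (suc n)))
                           (Σ-map-*ˡ x dec⁺Item treeWeight (1 ,_) (λ _ → *-congʳ (*-identityʳ x)) (trees n))
                           (Σ-map-*ˡ x dec⁺Item dec⁺Item (map₁ (suc ∘ suc)) (λ _ → *-assoc _ _ _) (decs⁺ n))

    R-eq : ∀ n → R n ≈ D n + shift (λ m → t * D m) n + shift (shift (λ m → x * R m)) n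
    R-eq n = by n
      where
      case₀ : ∀ as → Σ pairItem (map (0 ,_) as) ≈ Σ decItem as
      case₀ = Σ-map-≈ pairItem decItem (0 ,_) (λ _ → *-identityˡ _)
      case₁ : ∀ as → Σ pairItem (map (1 ,_) as) ≈ t * Σ decItem as
      case₁ = Σ-map-*ˡ t pairItem decItem (1 ,_) (λ _ → refl)
      by : ∀ n → R n ≈ D n + shift (λ m → t * D m) n + shift (shift (λ m → x * R m)) n
      by 0             = Σ-++₃ pairItem (map (0 ,_) (decs 0)) [] [] (case₀ (decs 0)) refl refl
      by 1             = Σ-++₃ pairItem (map (0 ,_) (decs 1)) (map (1 ,_) (decs 0)) []
                           (case₀ (decs 1)) (case₁ (decs 0)) refl
      by (suc (suc n)) = Σ-++₃ pairItem (map (0 ,_) (decs (suc (suc n)))) (map (1 ,_) (decs (suc n)))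
                           (map (map₁ (suc ∘ suc)) (pairs n))
                           (case₀ (decs (suc (suc n)))) (case₁ (decs (suc n)))
                           (Σ-map-*ˡ x pairItem pairItem (map₁ (suc ∘ suc)) (λ _ → *-assoc _ _ _) (pairs n))

    N-eq : ∀ n → N n ≈ shift (shift (λ m → x * D m)) n + shift (shift (λ m → x * P m)) n
                         + shift (shift (λ m → x * N m)) n
    N-eq 0             = sym (trans (+-identityʳ _) (+-identityʳ _))
    N-eq 1             = sym (trans (+-identityʳ _) (+-identityʳ _))
    N-eq (suc (suc n)) = Σ-++₃ nestItem (map (0 ,_) (decs n)) (map (1 ,_) (decs⁺ n))
                           (map (map₁ (suc ∘ suc)) (nests n))
                           (Σ-map-*ˡ x nestItem decItem (0 ,_) (λ _ → *-assoc _ _ _) (decs n))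
                           (Σ-map-*ˡ x nestItem dec⁺Item (1 ,_) (λ _ → *-assoc _ _ _) (decs⁺ n))
                           (Σ-map-*ˡ x nestItem nestItem (map₁ (suc ∘ suc)) (λ _ → *-assoc _ _ _) (nests n))

    C-eq : ∀ n → C n ≈ R n + N n + (shift³yC n + shift³yC n)
    C-eq n = Σ-++₃ coreItem (map pairᵀ (pairs n)) (map nestᵀ (nests n))
      (map (map₁ cycA) (cycs n) ++ map (map₁ cycB) (cycs n))
      (Σ-map-≈ coreItem pairItem pairᵀ (λ _ → *-assoc _ _ _) (pairs n))
      (Σ-map coreItem nestᵀ (nests n))
      (trans (Σ-++ coreItem (map (map₁ cycA) (cycs n)) (map (map₁ cycB) (cycs n)))
        (+-cong (cycs-Σ coreItem (map₁ cycA) (λ _ → *-assoc _ _ _) n)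
                (cycs-Σ coreItem (map₁ cycB) (λ _ → *-assoc _ _ _) n)))

-- Decomposing 231-avoiding words with cycles of length at most 3

module Permutations where

  open import Data.Nat.Base using (ℕ; zero; suc; _+_; _∸_; _≤_; _<_; z≤n; s≤s; pred)
  open import Data.Nat.Properties
  open import Data.Product.Base using (Σ-syntax; ∃-syntax; _×_; _,_; proj₁; proj₂)
  open import Data.Sum.Base using (_⊎_; inj₁; inj₂)
  open import Data.Empty using (⊥; ⊥-elim)
  open import Data.Unit.Base using (⊤; tt)
  open import Function.Base using (_∘_)
  open import Relation.Binary.Definitions using (tri<; tri≈; tri>)
  open import Relation.Binary.PropositionalEquality using (_≡_; _≢_; refl; sym; trans; cong; cong₂; subst; subst₂; module ≡-Reasoning)
  open import Relation.Nullary using (¬_; yes; no)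
  open import Relation.Nullary.Negation using (contradiction)
  open Trees

  -- A word of length n is represented by any function ℕ → ℕ with the prescribed values below n.
  record Good (n : ℕ) (f : ℕ → ℕ) : Set where
    field
      bounded : ∀ {i} → i < n → f i < n
      periodic : ∀ {i} → i < n → f (f i) ≡ i ⊎ f (f (f i)) ≡ i
      avoids : ∀ {i j k} → i < j → j < k → k < n → f k < f i → ¬ f i < f j

    -- Fixed points fall under the first alternative of `periodic`, so every period divides 2 or 3
    -- and the sixth iterate is the identity.
    injective : ∀ {i j} → i < n → j < n → f i ≡ f j → i ≡ j
    injective {i} {j} i<n j<n eq = trans (sym (f⁶ i<n)) (trans (cong (f ∘ f ∘ f ∘ f ∘ f) eq) (f⁶ j<n))
      where
      f⁶ : ∀ {i} → i < n → f (f (f (f (f (f i))))) ≡ i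
      f⁶ i<n with periodic i<n
      ... | inj₁ p = trans (cong (f ∘ f ∘ f ∘ f) p) (trans (cong (f ∘ f) p) p)
      ... | inj₂ p = trans (cong (f ∘ f ∘ f) p) p

    -- The form in which avoidance is mostly used: as soon as a later entry lies below `f i`,
    -- injectivity sharpens "not above" to "below" for everything in between.
    descent : ∀ {i j k} → i < j → j < k → k < n → f k < f i → f j < f i
    descent {i} {j} i<j j<k k<n q with <-cmp (f j) (f i)
    ... | tri< p _ _ = p
    ... | tri≈ _ p _ = contradiction (injective (<-trans i<j j<n) j<n (sym p)) (<⇒≢ i<j)
      where j<n = <-trans j<k k<n
    ... | tri> _ _ p = contradiction p (avoids i<j j<k k<n q)

  open Good

  module _ {n f} (good : Good n f) {k} (inv : ∀ {i} → i < k → f i < k) where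
    -- If `f j` fell into the invariant segment, the orbit of `j` would stay there, yet it returns
    -- to `j`.
    outside : ∀ {j} → k ≤ j → j < n → k ≤ f j
    outside {j} k≤j j<n with k ≤? f j
    ... | yes p = p
    ... | no ¬p with periodic good j<n | inv (≰⇒> ¬p)
    ...   | inj₁ q | r = contradiction (subst (_< k) q r) (≤⇒≯ k≤j)
    ...   | inj₂ q | r = contradiction (subst (_< k) q (inv r)) (≤⇒≯ k≤j)

  -- An increasing `ι` with `f ∘ ι = ι ∘ h` exhibits `h` as the pattern of `f` on an invariant set
  -- of positions. The second summand of a direct sum (`ι = k +_`) and the inside of a 3-cycle
  -- (`ι = inner s`) both arise in this way.
  module StrictlyMonotone (ι : ℕ → ℕ) (mono : ∀ {i j} → i < j → ι i < ι j) where
    reflects-< : ∀ {i j} → ι i < ι j → i < j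
    reflects-< {i} {j} p with <-cmp i j
    ... | tri< q _ _    = q
    ... | tri≈ _ refl _ = contradiction p (<-irrefl refl)
    ... | tri> _ _ q    = contradiction (mono q) (<-asym p)

    reflects-≡ : ∀ {i j} → ι i ≡ ι j → i ≡ j
    reflects-≡ {i} {j} p with <-cmp i j
    ... | tri< q _ _ = contradiction p (<⇒≢ (mono q))
    ... | tri≈ _ q _ = q
    ... | tri> _ _ q = contradiction (sym p) (<⇒≢ (mono q))

    module _ {m : ℕ} {h f : ℕ → ℕ} (h-bounded : ∀ {i} → i < m → h i < m) (commutes : ∀ {i} → i < m → f (ι i) ≡ ι (h i)) where
      commutes² : ∀ {i} → i < m → f (f (ι i)) ≡ ι (h (h i))
      commutes² p = trans (cong f (commutes p)) (commutes (h-bounded p))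

      commutes³ : ∀ {i} → i < m → f (f (f (ι i))) ≡ ι (h (h (h i)))
      commutes³ p = trans (cong f (commutes² p)) (commutes (h-bounded (h-bounded p)))

      pattern-good : ∀ {n} → (∀ {i} → i < m → ι i < n) → Good n f → Good m h
      pattern-good ι< good .bounded = h-bounded
      pattern-good ι< good .periodic p with periodic good (ι< p)
      ... | inj₁ q = inj₁ (reflects-≡ (trans (sym (commutes² p)) q))
      ... | inj₂ q = inj₂ (reflects-≡ (trans (sym (commutes³ p)) q))
      pattern-good ι< good .avoids {i} {j} {k} i<j j<k k<m p q =
        avoids good (mono i<j) (mono j<k) (ι< k<m)
          (subst₂ _<_ (sym (commutes k<m)) (sym (commutes i<m)) (mono p))
          (subst₂ _<_ (sym (commutes i<m)) (sym (commutes j<m)) (mono q))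
        where
        j<m = <-trans j<k k<m
        i<m = <-trans i<j j<m

  -- The second summand of a direct sum of words of lengths k and m is h; the first one is f itself, below k.
  Sum : ℕ → ℕ → (h f : ℕ → ℕ) → Set
  Sum k m h f = ∀ {i} → i < m → f (k + i) ≡ k + h i

  data SumView (k m : ℕ) : ℕ → Set where
    left  : ∀ {i} → i < k → SumView k m i
    right : ∀ i → i < m → SumView k m (k + i)

  sumView : ∀ k m {i} → i < k + m → SumView k m i
  sumView k m {i} i<k+m with i <? k
  ... | yes i<k = left i<k
  ... | no  i≮k = subst (SumView k m) eq (right (i ∸ k) (+-cancelˡ-< k (i ∸ k) m (subst (_< k + m) (sym eq) i<k+m)))
    where
    eq : k + (i ∸ k) ≡ i
    eq = m+[n∸m]≡n (≮⇒≥ i≮k)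

  -- The pattern 231 is not a direct sum of shorter patterns, so an occurrence stays inside one
  -- summand.
  sum-good : ∀ k m {f h} → Good k f → Sum k m h f → Good m h → Good (k + m) f
  sum-good k m {f} {h} gf sum gh = record { bounded = bd ; periodic = per ; avoids = av }
    where
    module ι = StrictlyMonotone (k +_) (+-monoʳ-< k)
    bd : ∀ {i} → i < k + m → f i < k + m
    bd p with sumView k m p
    ... | left q    = <-≤-trans (bounded gf q) (m≤m+n k m)
    ... | right i q = subst (_< k + m) (sym (sum q)) (+-monoʳ-< k (bounded gh q))
    per : ∀ {i} → i < k + m → f (f i) ≡ i ⊎ f (f (f i)) ≡ i
    per p with sumView k m p
    ... | left q = periodic gf q
    ... | right i q with periodic gh q
    ...   | inj₁ r = inj₁ (trans (ι.commutes² {f = f} (bounded gh) sum q) (cong (k +_) r))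
    ...   | inj₂ r = inj₂ (trans (ι.commutes³ {f = f} (bounded gh) sum q) (cong (k +_) r))
    av : ∀ {i j l} → i < j → j < l → l < k + m → f l < f i → ¬ f i < f j
    av i<j j<l l< p q with sumView k m l<
    ... | left l<k = avoids gf i<j j<l l<k p q
    ... | right l l<m with sumView k m (<-trans i<j (<-trans j<l l<))
    ...   | left i<k = <-irrefl refl (<-≤-trans (<-trans p (bounded gf i<k)) (subst (k ≤_) (sym (sum l<m)) (m≤m+n k (h l))))
    ...   | right i i<m with sumView k m (<-trans j<l l<)
    ...     | left j<k = <-irrefl refl (<-≤-trans (<-trans i<j j<k) (m≤m+n k i))
    ...     | right j j<m =
      avoids gh (ι.reflects-< i<j) (ι.reflects-< j<l) l<m
        (ι.reflects-< (subst₂ _<_ (sum l<m) (sum i<m) p)) (ι.reflects-< (subst₂ _<_ (sum i<m) (sum j<m) q))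

  restrict-good : ∀ {n k f} → Good n f → k ≤ n → (∀ {i} → i < k → f i < k) → Good k f
  restrict-good g k≤n inv .bounded = inv
  restrict-good g k≤n inv .periodic p = periodic g (<-≤-trans p k≤n)
  restrict-good g k≤n inv .avoids a b c = avoids g a b (<-≤-trans c k≤n)

  sum-split : ∀ k m {f} → Good (k + m) f → (∀ {i} → i < k → f i < k) → ∃[ h ] Sum k m h f × Good m h
  sum-split k m {f} g inv = h , sum , StrictlyMonotone.pattern-good (k +_) (+-monoʳ-< k) bd sum (+-monoʳ-< k) g
    where
    h : ℕ → ℕ
    h i = f (k + i) ∸ k
    sum : Sum k m h f
    sum {i} p = sym (m+[n∸m]≡n (outside g inv (m≤m+n k i) (+-monoʳ-< k p)))
    bd : ∀ {i} → i < m → h i < m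
    bd {i} p = +-cancelˡ-< k (h i) m (subst (_< k + m) (sum p) (bounded g (+-monoʳ-< k p)))

  -- The condition `f i = n - 1 - i` without truncated subtraction.
  Decreasing : ℕ → (ℕ → ℕ) → Set
  Decreasing n f = ∀ {i} → i < n → f i + suc i ≡ n

  decreasing-anti : ∀ {n f} → Decreasing n f → ∀ {i j} → i < j → j < n → f j < f i
  decreasing-anti {n} {f} d {i} {j} i<j j<n with f j <? f i
  ... | yes p = p
  ... | no ¬p = contradiction (trans (d (<-trans i<j j<n)) (sym (d j<n))) (<⇒≢ (+-mono-≤-< (≮⇒≥ ¬p) (s≤s i<j)))

  decreasing-good : ∀ {n f} → Decreasing n f → Good n f
  decreasing-good {n} {f} d .bounded {i} p = subst (f i <_) (d p) (m<m+n (f i) (s≤s z≤n))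
  decreasing-good {n} {f} d .periodic {i} p = inj₁ (+-cancelʳ-≡ (suc (f i)) (f (f i)) i (begin
    f (f i) + suc (f i)  ≡⟨ d (bounded (decreasing-good d) p) ⟩
    n                    ≡⟨ d p ⟨
    f i + suc i          ≡⟨ +-suc (f i) i ⟩
    suc (f i) + i        ≡⟨ +-comm (suc (f i)) i ⟩
    i + suc (f i)        ∎))
    where open ≡-Reasoning
  decreasing-good d .avoids i<j j<k k<n _ q = <-asym q (decreasing-anti d i<j (<-trans j<k k<n))

  -- The quantity `f i + suc i` never grows with `i`; it is at most `n` at the first position and at
  -- least `n` at the last, hence equal to `n` throughout.
  anti-decreasing : ∀ {n f} → (∀ {i} → i < n → f i < n) → (∀ {i j} → i < j → j < n → f j < f i) → Decreasing n f
  anti-decreasing {n} {f} bd anti {i} i<n =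
    ≤-antisym (upper i i<n) (lower (n ∸ suc i) i (trans (+-suc i _) (m+[n∸m]≡n i<n)))
    where
    upper : ∀ i → i < n → f i + suc i ≤ n
    upper zero    p = subst (_≤ n) (+-comm 1 (f 0)) (bd p)
    upper (suc i) p = begin
      f (suc i) + suc (suc i)    ≡⟨ +-suc (f (suc i)) (suc i) ⟩
      suc (f (suc i)) + suc i    ≤⟨ +-monoˡ-≤ (suc i) (anti (n<1+n i) p) ⟩
      f i + suc i                ≤⟨ upper i (<-trans (n<1+n i) p) ⟩
      n                          ∎
      where open ≤-Reasoning
    lower : ∀ d i → i + suc d ≡ n → n ≤ f i + suc i
    lower zero    i eq = subst (_≤ f i + suc i) (trans (sym (+-comm i 1)) eq) (m≤n+m (suc i) (f i))
    lower (suc d) i eq = begin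
      n                          ≤⟨ lower d (suc i) (trans (sym (+-suc i (suc d))) eq) ⟩
      f (suc i) + suc (suc i)    ≡⟨ +-suc (f (suc i)) (suc i) ⟩
      suc (f (suc i)) + suc i    ≤⟨ +-monoˡ-≤ (suc i) (anti (n<1+n i) si<n) ⟩
      f i + suc i                ∎
      where
      open ≤-Reasoning
      si<n : suc i < n
      si<n = subst (suc i <_) (trans (sym (+-suc i (suc d))) eq) (m<m+n (suc i) (s≤s z≤n))

  -- The entries below π(0) precede those above it, so a point i ≤ π(0) with π(i) > π(0) could never return to itself.
  first-block : ∀ {n f} → Good (suc n) f → ∀ {i} → i < suc (f 0) → f i < suc (f 0)
  first-block g {zero} _ = ≤-refl
  first-block {n} {f} g {suc i} (s≤s p) with f (suc i) ≤? f 0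
  ... | yes q = s≤s q
  ... | no ¬q = ⊥-elim (absurd (periodic g si<n))
    where
    q : f 0 < f (suc i)
    q = ≰⇒> ¬q
    si<n : suc i < suc n
    si<n = ≤-<-trans p (bounded g (s≤s z≤n))
    -- An entry below `f 0` after position `suc i` would complete a 231 with positions `0` and
    -- `suc i`. Since `f (suc i)` exceeds `f 0`, which is at least `suc i`, all further iterates
    -- stay to the right and above `f 0`.
    later : ∀ {j} → suc i < j → j < suc n → f 0 < f j
    later {j} p′ j<n with <-cmp (f 0) (f j)
    ... | tri< r _ _ = r
    ... | tri≈ _ r _ = contradiction (injective g (<-trans (s≤s z≤n) si<n) j<n r) (<⇒≢ (<-trans (s≤s z≤n) p′))
    ... | tri> _ _ r = contradiction q (avoids g (s≤s z≤n) p′ j<n r)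
    r₂ : f 0 < f (f (suc i))
    r₂ = later (≤-<-trans p q) (bounded g si<n)
    r₃ : f 0 < f (f (f (suc i)))
    r₃ = later (≤-<-trans p r₂) (bounded g (bounded g si<n))
    absurd : f (f (suc i)) ≡ suc i ⊎ f (f (f (suc i))) ≡ suc i → ⊥
    absurd (inj₁ e) = <-irrefl refl (<-≤-trans (subst (f 0 <_) e r₂) p)
    absurd (inj₂ e) = <-irrefl refl (<-≤-trans (subst (f 0 <_) e r₃) p)

  -- Inserting a 3-cycle around a word

  -- The increasing enumeration of the numbers other than `s`, as `punchIn` is for finite sets.
  skip : ℕ → ℕ → ℕ
  skip zero    i       = suc i
  skip (suc s) zero    = zero
  skip (suc s) (suc i) = suc (skip s i)

  unskip : ℕ → ℕ → ℕ
  unskip zero    v       = pred v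
  unskip (suc s) zero    = zero
  unskip (suc s) (suc v) = suc (unskip s v)

  skip-unskip : ∀ s v → v ≢ s → skip s (unskip s v) ≡ v
  skip-unskip zero    zero    v≢s = contradiction refl v≢s
  skip-unskip zero    (suc v) v≢s = refl
  skip-unskip (suc s) zero    v≢s = refl
  skip-unskip (suc s) (suc v) v≢s = cong suc (skip-unskip s v (v≢s ∘ cong suc))

  unskip-skip : ∀ s i → unskip s (skip s i) ≡ i
  unskip-skip zero    i       = refl
  unskip-skip (suc s) zero    = refl
  unskip-skip (suc s) (suc i) = cong suc (unskip-skip s i)

  skip≢ : ∀ s i → skip s i ≢ s
  skip≢ (suc s) (suc i) eq = skip≢ s i (suc-injective eq)

  skip-mono : ∀ s {i j} → i < j → skip s i < skip s j
  skip-mono zero    p             = s≤s p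
  skip-mono (suc s) {zero}  (s≤s p) = s≤s z≤n
  skip-mono (suc s) {suc i} (s≤s p) = s≤s (skip-mono s p)

  skip≤ : ∀ s i → skip s i ≤ suc i
  skip≤ zero    i       = ≤-refl
  skip≤ (suc s) zero    = z≤n
  skip≤ (suc s) (suc i) = s≤s (skip≤ s i)

  skip-<⁻ : ∀ s {i} → skip s i < s → i < s
  skip-<⁻ (suc s) {zero}  p       = s≤s z≤n
  skip-<⁻ (suc s) {suc i} (s≤s p) = s≤s (skip-<⁻ s p)

  skip-> : ∀ s {i} → s ≤ i → s < skip s i
  skip-> zero    p       = s≤s z≤n
  skip-> (suc s) (s≤s p) = s≤s (skip-> s p)

  skip->⁻ : ∀ s {i} → s < skip s i → s ≤ i
  skip->⁻ zero    p             = z≤n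
  skip->⁻ (suc s) {suc i} (s≤s p) = s≤s (skip->⁻ s p)

  skip-below : ∀ s {i} → i < s → skip s i ≡ i
  skip-below (suc s) {zero}  p       = refl
  skip-below (suc s) {suc i} (s≤s p) = cong suc (skip-below s p)

  skip-suc-<⁻ : ∀ s {i N} → s ≤ N → skip s i < suc N → i < N
  skip-suc-<⁻ zero    s≤N       (s≤s p)       = p
  skip-suc-<⁻ (suc s) {zero}  (s≤s s≤N) p       = s≤s z≤n
  skip-suc-<⁻ (suc s) {suc i} (s≤s s≤N) (s≤s p) = s≤s (skip-suc-<⁻ s s≤N p)

  -- The increasing enumeration of the positions other than `0` and `s + 1`. On arguments below `N`
  -- it also stays below `N + 2`, so it misses exactly the three points of the inserted cycle.
  inner : ℕ → ℕ → ℕ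
  inner s i = suc (skip s i)

  inner-mono : ∀ s {i j} → i < j → inner s i < inner s j
  inner-mono s p = s≤s (skip-mono s p)

  inner< : ∀ s {i N} → i < N → inner s i < suc (suc N)
  inner< s {i} p = s≤s (≤-trans (s≤s (skip≤ s i)) (s≤s p))

  module Inner s = StrictlyMonotone (inner s) (inner-mono s)

  -- f is g with the 3-cycle 0 ↦ N + 2 ↦ s + 1 ↦ 0 inserted.
  record Wrap (s N : ℕ) (g f : ℕ → ℕ) : Set where
    field
      at-zero  : f 0 ≡ suc (suc N)
      at-mid   : f (suc s) ≡ 0
      at-top   : f (suc (suc N)) ≡ suc s
      at-inner : ∀ {i} → i < N → f (inner s i) ≡ inner s (g i)

  open Wrap

  data WrapView (s N : ℕ) : ℕ → Set where
    vzero  : WrapView s N 0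
    vmid   : WrapView s N (suc s)
    vtop   : WrapView s N (suc (suc N))
    vinner : ∀ i → i < N → WrapView s N (inner s i)

  wrapView : ∀ {s N} → s ≤ N → ∀ {i} → i < suc (suc (suc N)) → WrapView s N i
  wrapView s≤N {zero}  p = vzero
  wrapView {s} {N} s≤N {suc v} (s≤s (s≤s p)) with v ≟ s
  ... | yes refl = vmid
  ... | no  v≢s with <-cmp v (suc N)
  ...   | tri≈ _ refl _ = vtop
  ...   | tri> _ _ q = contradiction q (≤⇒≯ p)
  ...   | tri< q _ _ = subst (WrapView s N ∘ suc) eq
                         (vinner (unskip s v) (skip-suc-<⁻ s s≤N (subst (_< suc N) (sym eq) q)))
    where eq = skip-unskip s v v≢s

  -- The pattern inside a 3-cycle 0 ↦ N + 2 ↦ s + 1 ↦ 0 of a 231-avoiding word: the entries before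
  -- position s + 1, followed by the value 0, must decrease, and so must the entries with larger values
  -- than s + 1, which is the last value.
  record CoreWord (s N : ℕ) (f : ℕ → ℕ) : Set where
    field
      good   : Good N f
      split≤ : s ≤ N
      early  : ∀ {i j} → i < j → j < s → f j < f i
      large  : ∀ {i j} → i < j → j < N → s ≤ f i → s ≤ f j → f j < f i

  open CoreWord

  module _ {s N g f} (core : CoreWord s N g) (w : Wrap s N g f) where
    private
      g-bd : ∀ {i} → i < N → g i < N
      g-bd = bounded (good core)

      mid<top : suc s < suc (suc N)
      mid<top = s≤s (s≤s (split≤ core))

    wrap-bounded : ∀ {i} → i < 3 + N → f i < 3 + N
    wrap-bounded p with wrapView (split≤ core) p
    ... | vzero      = subst (_< 3 + N) (sym (at-zero w)) ≤-refl
    ... | vmid       = subst (_< 3 + N) (sym (at-mid w)) (s≤s z≤n)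
    ... | vtop       = subst (_< 3 + N) (sym (at-top w)) (<-trans mid<top ≤-refl)
    ... | vinner i q = subst (_< 3 + N) (sym (at-inner w q)) (<-trans (inner< s (g-bd q)) ≤-refl)

    private
      below-zero : ∀ {j} → j < 3 + N → ¬ f 0 < f j
      below-zero {j} p q = <-irrefl refl (<-≤-trans (subst (_< f j) (at-zero w) q) (≤-pred (wrap-bounded p)))

      reflect : ∀ {i j} → i < N → j < N → f (inner s i) < f (inner s j) → g i < g j
      reflect p q r = Inner.reflects-< s (subst₂ _<_ (at-inner w p) (at-inner w q) r)

      preserve : ∀ {i j} → i < N → j < N → g i < g j → f (inner s i) < f (inner s j)
      preserve p q r = subst₂ _<_ (sym (at-inner w p)) (sym (at-inner w q)) (inner-mono s r)

      0≮mid : ∀ {i} {A : Set} → i < f (suc s) → A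
      0≮mid {i} p with subst (i <_) (at-mid w) p
      ... | ()

    -- Position `0` carries the largest value, `s + 1` the value 0, and `N + 2` comes last, so an
    -- inserted point can only be the final letter of a 231. At the middle position this is excluded
    -- by `early`, at the top position by `large`.
    wrap-good : Good (3 + N) f
    wrap-good .bounded = wrap-bounded
    wrap-good .periodic p with wrapView (split≤ core) p
    ... | vzero = inj₂ (trans (cong (f ∘ f) (at-zero w)) (trans (cong f (at-top w)) (at-mid w)))
    ... | vmid  = inj₂ (trans (cong (f ∘ f) (at-mid w)) (trans (cong f (at-zero w)) (at-top w)))
    ... | vtop  = inj₂ (trans (cong (f ∘ f) (at-top w)) (trans (cong f (at-mid w)) (at-zero w)))
    ... | vinner i q with periodic (good core) q
    ...   | inj₁ r = inj₁ (trans (Inner.commutes² s {f = f} g-bd (at-inner w) q) (cong (inner s) r))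
    ...   | inj₂ r = inj₂ (trans (Inner.commutes³ s {f = f} g-bd (at-inner w) q) (cong (inner s) r))
    wrap-good .avoids {i} {j} {k} i<j j<k k< p q
      with wrapView (split≤ core) (<-trans i<j (<-trans j<k k<)) | wrapView (split≤ core) (<-trans j<k k<)
         | wrapView (split≤ core) k<
    ... | vzero        | _            | _     = below-zero (<-trans j<k k<) q
    ... | vmid         | _            | _     = 0≮mid p
    ... | vtop         | _            | _     = <-irrefl refl (<-≤-trans (<-trans i<j j<k) (≤-pred k<))
    ... | vinner i′ i< | vmid         | _     = 0≮mid q
    ... | vinner i′ i< | vtop         | _     = <-irrefl refl (<-≤-trans j<k (≤-pred k<))
    ... | vinner i′ i< | vinner j′ j< | vmid  =
      <-asym (reflect i< j< q)
        (early core (Inner.reflects-< s i<j) (skip-<⁻ s (≤-pred j<k)))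
    ... | vinner i′ i< | vinner j′ j< | vtop  =
      <-asym (reflect i< j< q)
        (large core (Inner.reflects-< s i<j) j< s≤gi (<⇒≤ (≤-<-trans s≤gi (reflect i< j< q))))
      where
      s≤gi : s ≤ g i′
      s≤gi = skip->⁻ s (≤-pred (subst₂ _<_ (at-top w) (at-inner w i<) p))
    ... | vinner i′ i< | vinner j′ j< | vinner k′ k<N =
      avoids (good core) (Inner.reflects-< s i<j) (Inner.reflects-< s j<k) k<N (reflect k<N i< p) (reflect i< j< q)

    private
      below-first : ∀ {j} → 0 < j → j < 3 + N → f j < f 0
      below-first {j} 0<j p with <-cmp (f j) (f 0)
      ... | tri< q _ _ = q
      ... | tri≈ _ q _ = contradiction (injective wrap-good (s≤s z≤n) p (sym q)) (<⇒≢ 0<j)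
      ... | tri> _ _ q = contradiction q (below-zero p)

      mid-last : ∀ {i} → i < suc s → f (suc s) < f i
      mid-last {i} p = subst (_< f i) (sym (at-mid w)) (n≢0⇒n>0 λ q →
        <⇒≢ p (injective wrap-good (<-trans p (<-trans mid<top ≤-refl)) (<-trans mid<top ≤-refl) (trans q (sym (at-mid w)))))

    wrap-early : ∀ {i j} → i < j → j < suc s → f j < f i
    wrap-early i<j j< with wrapView (split≤ core) (<-trans (<-trans i<j j<) (<-trans mid<top ≤-refl))
                         | wrapView (split≤ core) (<-trans j< (<-trans mid<top ≤-refl))
    ... | vzero        | _            = below-first i<j (<-trans j< (<-trans mid<top ≤-refl))
    ... | vmid         | _            = contradiction (<-trans i<j j<) (<-irrefl refl)
    ... | vtop         | _            = contradiction (<-trans i<j j<) (<-asym mid<top)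
    ... | vinner i′ i< | vmid         = contradiction j< (<-irrefl refl)
    ... | vinner i′ i< | vtop         = contradiction j< (<-asym mid<top)
    ... | vinner i′ i< | vinner j′ j<N =
      preserve j<N i< (early core (Inner.reflects-< s i<j) (skip-<⁻ s (≤-pred j<)))

    wrap-large : ∀ {i j} → i < j → j < 3 + N → suc s ≤ f i → suc s ≤ f j → f j < f i
    wrap-large i<j j< p q with wrapView (split≤ core) (<-trans i<j j<) | wrapView (split≤ core) j<
    ... | vzero        | _            = below-first i<j j<
    ... | vmid         | _            = 0≮mid p
    ... | vtop         | _            = contradiction (<-≤-trans i<j (≤-pred j<)) (<-irrefl refl)
    ... | vinner i′ i< | vmid         = 0≮mid q
    ... | vinner i′ i< | vtop         = subst (_< f (inner s i′)) (sym (at-top w)) (≤∧≢⇒< p λ e →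
        <⇒≢ (inner< s i<) (injective wrap-good (<-trans (inner< s i<) ≤-refl) ≤-refl (trans (sym e) (sym (at-top w)))))
    ... | vinner i′ i< | vinner j′ j<N =
      preserve j<N i< (large core (Inner.reflects-< s i<j) j<N (s≤ i< p) (s≤ j<N q))
      where
      s≤ : ∀ {i} → i < N → suc s ≤ f (inner s i) → s ≤ g i
      s≤ {i} i< r = skip->⁻ s (≤∧≢⇒< (≤-pred (subst (suc s ≤_) (at-inner w i<) r)) (skip≢ s (g i) ∘ sym))

    wrap-mid-last : ∀ {i j} → i < j → j < suc (suc s) → f j < f i
    wrap-mid-last i<j j< with m≤n⇒m<n∨m≡n (≤-pred j<)
    ... | inj₁ q    = wrap-early i<j q
    ... | inj₂ refl = mid-last i<j

    -- The middle position `s + 1` carries the value 0, so the decreasing prefix may stop just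
    -- before it or include it. These are the two splits of `cycA` and `cycB`, and `outer-split`
    -- shows that there is no third.
    wrap-coreA : CoreWord (suc s) (3 + N) f
    wrap-coreA .good   = wrap-good
    wrap-coreA .split≤ = ≤-trans (<⇒≤ mid<top) (n≤1+n _)
    wrap-coreA .early  = wrap-early
    wrap-coreA .large  = wrap-large

    wrap-coreB : CoreWord (suc (suc s)) (3 + N) f
    wrap-coreB .good   = wrap-good
    wrap-coreB .split≤ = ≤-trans mid<top (n≤1+n _)
    wrap-coreB .early  = wrap-mid-last
    wrap-coreB .large i<j j< p q = wrap-large i<j j< (<⇒≤ p) (<⇒≤ q)

  -- The cases for a block and for the inside of a 3-cycle

  -- If the last entry is 0, it lies below all others and avoidance makes the whole word decrease.
  -- Otherwise `0` does not return after two steps, so it lies on a 3-cycle through the last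
  -- position.
  first-cycle : ∀ {N f} → Good (suc N) f → f 0 ≡ N →
    Decreasing (suc N) f ⊎ Σ[ s ∈ ℕ ] Σ[ M ∈ ℕ ] s ≤ M × N ≡ suc (suc M) × f N ≡ suc s × f (suc s) ≡ 0
  first-cycle {N} {f} g f0 with f N in fN
  ... | zero = inj₁ (anti-decreasing (bounded g) anti)
    where
    anti : ∀ {i j} → i < j → j < suc N → f j < f i
    anti {i} {j} i<j j< with m≤n⇒m<n∨m≡n (≤-pred j<)
    ... | inj₁ j<N = descent g i<j j<N ≤-refl (subst (_< f i) (sym fN) (n≢0⇒n>0 λ q →
            <⇒≢ (<-trans i<j j<N) (injective g (<-trans i<j j<) ≤-refl (trans q (sym fN)))))
    ... | inj₂ refl = subst (_< f i) (sym fN) (n≢0⇒n>0 λ q →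
            <⇒≢ i<j (injective g (<-trans i<j j<) ≤-refl (trans q (sym fN))))
  ... | suc s with periodic g {0} (s≤s z≤n)
  ...   | inj₁ q = contradiction (trans (sym fN) (trans (cong f (sym f0)) q)) λ ()
  ...   | inj₂ q = inj₂ (by N refl)
    where
    fm : f (suc s) ≡ 0
    fm = trans (cong f (sym fN)) (trans (cong (f ∘ f) (sym f0)) q)
    m<N : suc s < N
    m<N = ≤∧≢⇒< (≤-pred (subst (_< suc N) fN (bounded g ≤-refl)))
            λ e → contradiction (trans (sym fN) (trans (cong f (sym e)) fm)) λ ()
    by : ∀ N′ → N′ ≡ N → Σ[ s′ ∈ ℕ ] Σ[ M ∈ ℕ ] s′ ≤ M × N ≡ suc (suc M) × suc s ≡ suc s′ × f (suc s′) ≡ 0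
    by (suc (suc M)) refl = s , M , ≤-pred (≤-pred m<N) , refl , refl , fm
    by (suc zero)    refl = contradiction (≤-pred m<N) λ ()
    by zero          refl = contradiction m<N λ ()

  unwrap : ∀ {s N f} → Good (3 + N) f → s ≤ N → f 0 ≡ suc (suc N) → f (suc s) ≡ 0 → f (suc (suc N)) ≡ suc s →
    ∃[ h ] Wrap s N h f × CoreWord s N h
  unwrap {s} {N} {f} g s≤N f0 fm ft = h , w , record
    { good   = gh
    ; split≤ = s≤N
    ; early  = λ i<j j<s → reflect (<-≤-trans (<-trans i<j j<s) s≤N) (<-≤-trans j<s s≤N)
        (descent g (inner-mono s i<j)
          (s≤s (subst (_< s) (sym (skip-below s j<s)) j<s)) mid<
          (subst₂ _<_ (sym fm) (sym (commutes (<-≤-trans (<-trans i<j j<s) s≤N))) (s≤s z≤n)))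
    ; large  = λ i<j j<N p q → reflect (<-trans i<j j<N) j<N
        (descent g (inner-mono s i<j) (inner< s j<N) ≤-refl
          (subst₂ _<_ (sym ft) (sym (commutes (<-trans i<j j<N))) (s≤s (skip-> s p))))
    }
    where
    -- By injectivity the values at inner positions avoid `0`, `s + 1` and `N + 2`, which belong to
    -- the removed cycle, so `unskip s ∘ pred` undoes `inner s` on them.
    h : ℕ → ℕ
    h i = unskip s (pred (f (inner s i)))
    mid< : suc s < 3 + N
    mid< = s≤s (s≤s (≤-trans s≤N (n≤1+n N)))
    inner<3+ : ∀ {i} → i < N → inner s i < 3 + N
    inner<3+ p = <-trans (inner< s p) ≤-refl
    view : ∀ {i} → i < N → Σ[ j ∈ ℕ ] j < N × f (inner s i) ≡ inner s j
    view {i} p with f (inner s i) in eq | wrapView s≤N (bounded g (inner<3+ p))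
    ... | _ | vzero = contradiction (injective g (inner<3+ p) mid< (trans eq (sym fm))) (skip≢ s i ∘ suc-injective)
    ... | _ | vmid  = contradiction (injective g (inner<3+ p) ≤-refl (trans eq (sym ft))) (<⇒≢ (inner< s p))
    ... | _ | vtop  = contradiction (injective g (inner<3+ p) (s≤s z≤n) (trans eq (sym f0))) λ ()
    ... | _ | vinner j q = j , q , refl
    h≡ : ∀ {i} (p : i < N) → h i ≡ proj₁ (view p)
    h≡ p = trans (cong (unskip s ∘ pred) (proj₂ (proj₂ (view p)))) (unskip-skip s _)
    bd : ∀ {i} → i < N → h i < N
    bd p = subst (_< N) (sym (h≡ p)) (proj₁ (proj₂ (view p)))
    commutes : ∀ {i} → i < N → f (inner s i) ≡ inner s (h i)
    commutes p = trans (proj₂ (proj₂ (view p))) (cong (inner s) (sym (h≡ p)))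
    gh : Good N h
    gh = Inner.pattern-good s bd commutes inner<3+ g
    w : Wrap s N h f
    w = record { at-zero = f0 ; at-mid = fm ; at-top = ft ; at-inner = commutes }
    reflect : ∀ {i j} → i < N → j < N → f (inner s j) < f (inner s i) → h j < h i
    reflect p q r = Inner.reflects-< s (subst₂ _<_ (commutes q) (commutes p) r)

  PairWord : ℕ → ℕ → (ℕ → ℕ) → Set
  PairWord s r f = Decreasing s f × ∃[ h ] Sum s r h f × Decreasing r h

  -- For `s = 0` the condition `large` covers all entries. For `s > 0` put k = `f 0`; positions up
  -- to k form a block, and an entry at position k + 1 would exceed k. If k is at least `s`, this
  -- contradicts `large`, so the block is the whole word. If k is smaller, it contradicts `early`
  -- unless k + 1 = `s`, and the word splits at `s`.
  core-cases : ∀ {s N f} → CoreWord s N f →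
    (Σ[ r ∈ ℕ ] N ≡ s + r × PairWord s r f) ⊎ (0 < s × s < N × suc (f 0) ≡ N)
  core-cases {zero}  {N} {f} c =
    inj₁ (N , refl , (λ ()) , f , (λ _ → refl) ,
      anti-decreasing (bounded (good c)) (λ i<j j<N → large c i<j j<N z≤n z≤n))
  core-cases {suc s} {N} {f} c with split≤ c
  ... | s≤s {n = N′} s≤N′ with suc s ≤? f 0
  ...   | yes s<k with m≤n⇒m<n∨m≡n (≤-pred (bounded (good c) {0} (s≤s z≤n)))
  ...     | inj₂ k≡N′ = inj₂ (s≤s z≤n , s≤s (≤-trans s<k (≤-reflexive k≡N′)) , cong suc k≡N′)
  ...     | inj₁ k<N′ = contradiction (large c (s≤s z≤n) (s≤s k<N′) s<k (≤-trans s<k (<⇒≤ k<))) (<-asym k<)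
    where
    k< : f 0 < f (suc (f 0))
    k< = outside (good c) (first-block (good c)) ≤-refl (s≤s k<N′)
  core-cases {suc s} {N} {f} c | s≤s {n = N′} s≤N′ | no s≮k =
    inj₁ (N′ ∸ s , cong suc (sym (m+[n∸m]≡n s≤N′)) , anti-decreasing inv (early c) , h , sum , dec-h)
    where
    r = N′ ∸ s
    eqN : suc N′ ≡ suc s + r
    eqN = cong suc (sym (m+[n∸m]≡n s≤N′))
    k≡s : f 0 ≡ s
    k≡s with m≤n⇒m<n∨m≡n (≤-pred (≰⇒> s≮k))
    ... | inj₂ e = e
    ... | inj₁ k<s = contradiction (early c (s≤s z≤n) (s≤s k<s))
      (<-asym (outside (good c) (first-block (good c)) ≤-refl (s≤s (<-≤-trans k<s s≤N′))))
    inv : ∀ {i} → i < suc s → f i < suc s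
    inv p = subst (λ k → _ < suc k) k≡s (first-block (good c) (subst (λ k → _ < suc k) (sym k≡s) p))
    parts = sum-split (suc s) r (subst (λ n → Good n f) eqN (good c)) inv
    h = proj₁ parts
    sum : Sum (suc s) r h f
    sum = proj₁ (proj₂ parts)
    dec-h : Decreasing r h
    dec-h = anti-decreasing (bounded (proj₂ (proj₂ parts))) λ {i} {j} i<j j<r →
      +-cancelˡ-< (suc s) (h j) (h i) (subst₂ _<_ (sum j<r) (sum (<-trans i<j j<r))
        (large c (+-monoʳ-< (suc s) i<j) (subst (suc s + j <_) (sym eqN) (+-monoʳ-< (suc s) j<r))
          (≥s i (<-trans i<j j<r)) (≥s j j<r)))
      where
      ≥s : ∀ i → i < r → suc s ≤ f (suc s + i)
      ≥s i p = subst (suc s ≤_) (sym (sum p)) (m≤m+n (suc s) (h i))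

  -- If the prefix went beyond the middle position, it would have to descend below the 0 found
  -- there. If `s` were at most `s′`, the value `s` would occur before the larger last value
  -- `s′ + 1`, against `large`.
  outer-split : ∀ {s s′ N f} → CoreWord s (3 + N) f → s < 3 + N → s′ ≤ N → f (suc s′) ≡ 0 →
    f (suc (suc N)) ≡ suc s′ → s ≡ suc s′ ⊎ s ≡ suc (suc s′)
  outer-split {s} {s′} {N} {f} c s<top s′≤N fm ft with <-cmp s (suc s′)
  ... | tri≈ _ e _ = inj₁ e
  ... | tri> _ _ p with m≤n⇒m<n∨m≡n p
  ...   | inj₂ e = inj₂ (sym e)
  ...   | inj₁ q with subst (f (suc (suc s′)) <_) fm (early c ≤-refl q)
  ...     | ()
  outer-split {s} {s′} {N} {f} c s<top s′≤N fm ft | tri< s<m _ _ with at-s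
    where
    at-s : Σ[ j ∈ ℕ ] j < 3 + N × f j ≡ s
    at-s with periodic (good c) s<top
    ... | inj₁ e = f s , bounded (good c) s<top , e
    ... | inj₂ e = f (f s) , bounded (good c) (bounded (good c) s<top) , e
  ... | j , j< , fj with m≤n⇒m<n∨m≡n (≤-pred j<)
  ...   | inj₂ refl = contradiction (trans (sym fj) ft) (<⇒≢ s<m)
  ...   | inj₁ j<top = contradiction (subst₂ _<_ ft fj
          (large c j<top ≤-refl (≤-reflexive (sym fj)) (subst (s ≤_) (sym ft) (<⇒≤ s<m)))) (<-asym s<m)

  -- The words described by a code

  -- A relation rather than a function: it constrains `f` only below the size, so it can be
  -- established for a given word, and any two words related to one code agree there.
  IsCore : Core → (ℕ → ℕ) → Set
  IsCore (pair s r) f = PairWord s r f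
  IsCore (nest s r) f = Decreasing (2 + (s + r)) f
  IsCore (cycA γ)   f = ∃[ h ] Wrap (split γ) (size γ) h f × IsCore γ h
  IsCore (cycB γ)   f = ∃[ h ] Wrap (split γ) (size γ) h f × IsCore γ h

  IsTree : Tree → (ℕ → ℕ) → Set
  IsTree nil       f = ⊤
  IsTree (dec k τ) f = Decreasing (suc k) f × ∃[ h ] Sum (suc k) (sizeᵀ τ) h f × IsTree τ h
  IsTree (cyc γ τ) f = (∃[ g ] Wrap (split γ) (size γ) g f × IsCore γ g)
                         × ∃[ h ] Sum (3 + size γ) (sizeᵀ τ) h f × IsTree τ h

  core-sound : ∀ γ {f} → IsCore γ f → CoreWord (split γ) (size γ) f
  core-sound (pair s r) {f} (d , h , sum , d′) = record
    { good   = sum-good s r (decreasing-good d) sum (decreasing-good d′)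
    ; split≤ = m≤m+n s r
    ; early  = decreasing-anti d
    ; large  = lg
    }
    where
    lg : ∀ {i j} → i < j → j < s + r → s ≤ f i → s ≤ f j → f j < f i
    lg i<j j< p q with sumView s r (<-trans i<j j<) | sumView s r j<
    ... | left i<s   | _          = contradiction p (<⇒≱ (bounded (decreasing-good d) i<s))
    ... | right i a  | left j<s   = contradiction q (<⇒≱ (bounded (decreasing-good d) j<s))
    ... | right i a  | right j b  =
      subst₂ _<_ (sym (sum b)) (sym (sum a)) (+-monoʳ-< s (decreasing-anti d′ (+-cancelˡ-< s i j i<j) b))
  core-sound (nest s r) d = record
    { good   = decreasing-good d
    ; split≤ = s≤s (≤-trans (m≤m+n s r) (n≤1+n _))
    ; early  = λ i<j j< → decreasing-anti d i<j (<-trans j< (s≤s (s≤s (m≤m+n s r))))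
    ; large  = λ i<j j< _ _ → decreasing-anti d i<j j<
    }
  core-sound (cycA γ) (h , w , c) = wrap-coreA (core-sound γ c) w
  core-sound (cycB γ) (h , w , c) = wrap-coreB (core-sound γ c) w

  tree-sound : ∀ τ {f} → IsTree τ f → Good (sizeᵀ τ) f
  tree-sound nil       _                    = record { bounded = λ () ; periodic = λ () ; avoids = λ _ _ () }
  tree-sound (dec k τ) (d , h , sum , p)    =
    sum-good (suc k) (sizeᵀ τ) (decreasing-good d) sum (tree-sound τ p)
  tree-sound (cyc γ τ) ((g , w , c) , h , sum , p) =
    sum-good (3 + size γ) (sizeᵀ τ) (wrap-good (core-sound γ c) w) sum (tree-sound τ p)

  -- The bound `b` carries the recursion, since the word left after removing a 3-cycle is shorter by
  -- 3 but is not a structural part of the given one.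
  core-complete : ∀ b {s N f} → N < b → CoreWord s N f → Σ[ γ ∈ Core ] split γ ≡ s × size γ ≡ N × IsCore γ f
  core-complete (suc b) {s} {N} {f} (s≤s N≤b) c with core-cases c
  ... | inj₁ (r , refl , p) = pair s r , refl , refl , p
  ... | inj₂ (0<s , s<N , refl) with first-cycle (good c) refl
  core-complete (suc b) {suc s} {f = f} (s≤s N≤b) c | inj₂ (0<s , s≤s s<N , refl) | inj₁ d with m≤n⇒∃[o]m+o≡n s<N
  ...   | r , eq = nest s r , refl , cong suc eq , subst (λ n → Decreasing n f) (cong suc (sym eq)) d
  core-complete (suc b) {s} {N} {f} (s≤s N≤b) c | inj₂ (0<s , s<N , refl) | inj₂ (s′ , M , s′≤M , f0 , ft , fm)
    with f 0 in f0′
  core-complete (suc b) {s} {_} {f} (s≤s N≤b) c | inj₂ (0<s , s<N , refl) | inj₂ (s′ , M , s′≤M , refl , ft , fm) | _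
    with unwrap (good c) s′≤M f0′ fm ft | outer-split c s<N s′≤M fm ft
  ... | h , w , c′ | e with core-complete b (≤-trans (s≤s (≤-trans (n≤1+n M) (n≤1+n (suc M)))) N≤b) c′
  ...   | γ , refl , refl , p with e
  ...     | inj₁ refl = cycA γ , refl , refl , h , w , p
  ...     | inj₂ refl = cycB γ , refl , refl , h , w , p

  block-complete : ∀ {k f} → Good (suc k) f → f 0 ≡ k → Decreasing (suc k) f ⊎
    (Σ[ γ ∈ Core ] k ≡ 2 + size γ × ∃[ g ] Wrap (split γ) (size γ) g f × IsCore γ g)
  block-complete good₀ f0 with first-cycle good₀ f0
  ... | inj₁ d = inj₁ d
  ... | inj₂ (s , M , s≤M , refl , ft , fm) with unwrap good₀ s≤M f0 fm ft
  ...   | g , w , c with core-complete (suc M) ≤-refl c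
  ...     | γ , refl , refl , p = inj₂ (γ , refl , g , w , p)

  tree-complete : ∀ b {n f} → n < b → Good n f → Σ[ τ ∈ Tree ] sizeᵀ τ ≡ n × IsTree τ f
  tree-complete b       {zero}      n<b       g = nil , refl , tt
  tree-complete (suc b) {suc n} {f} (s≤s n<b) g
    with f 0 in f0 | m≤n⇒∃[o]m+o≡n (bounded g {0} (s≤s z≤n)) | first-block g
  ... | k | m , refl | inv with sum-split (suc k) m g inv
  ...   | h , sum , gh with tree-complete b (≤-<-trans (m≤n+m m k) n<b) gh
  ...     | τ , refl , p with block-complete (restrict-good g (s≤s (m≤m+n k (sizeᵀ τ))) inv) f0
  ...       | inj₁ d              = dec k τ , refl , d , h , sum , p
  ...       | inj₂ (γ , refl , c) = cyc γ τ , refl , c , h , sum , p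

  -- A code determines its word, and word and split determine the code

  Agree : ℕ → (f g : ℕ → ℕ) → Set
  Agree n f g = ∀ {i} → i < n → f i ≡ g i

  sum-agree : ∀ k {m f f′ h h′} → Agree k f f′ → Sum k m h f → Sum k m h′ f′ → Agree m h h′ → Agree (k + m) f f′
  sum-agree k {m} a p p′ b i< with sumView k m i<
  ... | left q    = a q
  ... | right i q = trans (p q) (trans (cong (k +_) (b q)) (sym (p′ q)))

  summand-agree : ∀ k {k′ m m′ f f′ h h′} → k ≡ k′ → m ≡ m′ → Agree (k + m) f f′ →
    Sum k m h f → Sum k′ m′ h′ f′ → Agree m h h′
  summand-agree k refl refl a p p′ {i} q =
    +-cancelˡ-≡ k _ _ (trans (sym (p q)) (trans (a (+-monoʳ-< k q)) (p′ q)))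

  decreasing-agree : ∀ {n f f′} → Decreasing n f → Decreasing n f′ → Agree n f f′
  decreasing-agree d d′ {i} p = +-cancelʳ-≡ (suc i) _ _ (trans (d p) (sym (d′ p)))

  wrap-agree : ∀ {s N f f′ g g′} → s ≤ N → Wrap s N g f → Wrap s N g′ f′ → Agree N g g′ → Agree (3 + N) f f′
  wrap-agree {s} s≤N w w′ a p with wrapView s≤N p
  ... | vzero      = trans (at-zero w) (sym (at-zero w′))
  ... | vmid       = trans (at-mid w) (sym (at-mid w′))
  ... | vtop       = trans (at-top w) (sym (at-top w′))
  ... | vinner i q = trans (at-inner w q) (trans (cong (inner s) (a q)) (sym (at-inner w′ q)))

  wrapped-agree : ∀ {s s′ N N′ f f′ g g′} → s ≡ s′ → N ≡ N′ → Agree (3 + N) f f′ →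
    Wrap s N g f → Wrap s′ N′ g′ f′ → Agree N g g′
  wrapped-agree {s} refl refl a w w′ p = Inner.reflects-≡ s
    (trans (sym (at-inner w p)) (trans (a (<-trans (inner< s p) ≤-refl)) (at-inner w′ p)))

  core-agree : ∀ γ {f f′} → IsCore γ f → IsCore γ f′ → Agree (size γ) f f′
  core-agree (pair s r) (d , h , p , e) (d′ , h′ , p′ , e′) =
    sum-agree s (decreasing-agree d d′) p p′ (decreasing-agree e e′)
  core-agree (nest s r) d d′ = decreasing-agree d d′
  core-agree (cycA γ) (h , w , c) (h′ , w′ , c′) = wrap-agree (split≤ (core-sound γ c)) w w′ (core-agree γ c c′)
  core-agree (cycB γ) (h , w , c) (h′ , w′ , c′) = wrap-agree (split≤ (core-sound γ c)) w w′ (core-agree γ c c′)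

  tree-agree : ∀ τ {f f′} → IsTree τ f → IsTree τ f′ → Agree (sizeᵀ τ) f f′
  tree-agree nil       _ _ ()
  tree-agree (dec k τ) (d , h , p , q) (d′ , h′ , p′ , q′) =
    sum-agree (suc k) (decreasing-agree d d′) p p′ (tree-agree τ q q′)
  tree-agree (cyc γ τ) ((g , w , c) , h , p , q) ((g′ , w′ , c′) , h′ , p′ , q′) =
    sum-agree (3 + size γ) (wrap-agree (split≤ (core-sound γ c)) w w′ (core-agree γ c c′)) p p′ (tree-agree τ q q′)

  decreasing-zero : ∀ {n f} → Decreasing (suc n) f → f 0 ≡ n
  decreasing-zero {n} {f} d = suc-injective (trans (+-comm 1 (f 0)) (d (s≤s z≤n)))

  decreasing-last : ∀ {n f} → Decreasing (suc n) f → f n ≡ 0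
  decreasing-last {n} {f} d = +-cancelʳ-≡ (suc n) (f n) 0 (d ≤-refl)

  -- The cores with an interior split whose first entry is the largest. `pair s 0` and `pair 0 r`
  -- are decreasing as well, but their split lies at an end.
  data Connected : Core → Set where
    nest : ∀ {s r} → Connected (nest s r)
    cycA : ∀ {γ} → Connected (cycA γ)
    cycB : ∀ {γ} → Connected (cycB γ)

  connected-first : ∀ {γ} → Connected γ → ∀ {f} → IsCore γ f → suc (f 0) ≡ size γ
  connected-first nest d           = cong suc (decreasing-zero d)
  connected-first cycA (h , w , c) = cong suc (at-zero w)
  connected-first cycB (h , w , c) = cong suc (at-zero w)

  lastValue : ∀ {γ} → Connected γ → ℕ
  lastValue nest         = 0
  lastValue (cycA {γ})   = suc (split γ)
  lastValue (cycB {γ})   = suc (split γ)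

  connected-last : ∀ {γ} (p : Connected γ) → ∀ {f} → IsCore γ f → ∀ {m} → suc m ≡ size γ → f m ≡ lastValue p
  connected-last nest d           refl = decreasing-last d
  connected-last cycA (h , w , c) refl = at-top w
  connected-last cycB (h , w , c) refl = at-top w

  split≤size : ∀ γ → split γ ≤ size γ
  split≤size (pair s r) = m≤m+n s r
  split≤size (nest s r) = s≤s (≤-trans (m≤m+n s r) (n≤1+n _))
  split≤size (cycA γ)   = s≤s (≤-trans (split≤size γ) (≤-trans (n≤1+n _) (n≤1+n _)))
  split≤size (cycB γ)   = s≤s (s≤s (≤-trans (split≤size γ) (n≤1+n _)))

  connected-split : ∀ {γ} → Connected γ → 0 < split γ × split γ < size γ
  connected-split (nest {s} {r}) = s≤s z≤n , s≤s (s≤s (m≤m+n s r))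
  connected-split (cycA {γ})     = s≤s z≤n , s≤s (s≤s (≤-trans (split≤size γ) (n≤1+n _)))
  connected-split (cycB {γ})     = s≤s z≤n , s≤s (s≤s (s≤s (split≤size γ)))

  pair≢connected : ∀ {γ} → Connected γ → ∀ {s r f f′} → s ≡ split γ → s + r ≡ size γ → Agree (s + r) f f′ →
    Decreasing s f → IsCore γ f′ → ⊥
  pair≢connected {γ} p {s} es eN a d c with connected-split p
  ... | 0<s , s<N with s
  ...   | zero  = contradiction (subst (0 <_) (sym es) 0<s) λ ()
  ...   | suc _ = <⇒≢ (subst (_< size γ) (sym es) s<N)
          (trans (cong suc (trans (sym (decreasing-zero d)) (a (s≤s z≤n)))) (connected-first p c))

  lastValue-agree : ∀ {γ γ′} (p : Connected γ) (p′ : Connected γ′) → ∀ {f f′} → size γ ≡ size γ′ →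
    Agree (size γ) f f′ → IsCore γ f → IsCore γ′ f′ → lastValue p ≡ lastValue p′
  lastValue-agree {γ} p p′ {f} eN a c c′ with connected-first p c
  ... | eq = trans (sym (connected-last p c eq))
    (trans (a (subst (f 0 <_) eq ≤-refl)) (connected-last p′ c′ (trans eq eN)))

  -- A pair with interior split starts with `s - 1`, a connected core with its largest value. Among
  -- connected cores the last value is 0 exactly for `nest`; otherwise it is the inner split plus 1,
  -- and comparing it with the outer split tells `cycA` from `cycB`.
  core-injective : ∀ γ γ′ {f f′} → split γ ≡ split γ′ → size γ ≡ size γ′ → Agree (size γ) f f′ →
    IsCore γ f → IsCore γ′ f′ → γ ≡ γ′
  connected-injective : ∀ {γ γ′} (p : Connected γ) (p′ : Connected γ′) → lastValue p ≡ lastValue p′ →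
    ∀ {f f′} → split γ ≡ split γ′ → size γ ≡ size γ′ → Agree (size γ) f f′ → IsCore γ f → IsCore γ′ f′ → γ ≡ γ′

  core-injective (pair s r) (pair s′ r′) refl eN a _ _ = cong (pair s) (+-cancelˡ-≡ s r r′ eN)
  core-injective (pair s r) (nest _ _) es eN a (d , _) c = ⊥-elim (pair≢connected nest es eN a d c)
  core-injective (pair s r) (cycA _)   es eN a (d , _) c = ⊥-elim (pair≢connected cycA es eN a d c)
  core-injective (pair s r) (cycB _)   es eN a (d , _) c = ⊥-elim (pair≢connected cycB es eN a d c)
  core-injective (nest _ _) (pair s r) es eN a c (d , _) =
    ⊥-elim (pair≢connected nest (sym es) (sym eN) (λ {i} p → sym (a (subst (i <_) (sym eN) p))) d c)
  core-injective (cycA γ)   (pair s r) es eN a c (d , _) =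
    ⊥-elim (pair≢connected (cycA {γ}) (sym es) (sym eN) (λ {i} p → sym (a (subst (i <_) (sym eN) p))) d c)
  core-injective (cycB γ)   (pair s r) es eN a c (d , _) =
    ⊥-elim (pair≢connected (cycB {γ}) (sym es) (sym eN) (λ {i} p → sym (a (subst (i <_) (sym eN) p))) d c)
  core-injective (nest _ _) (nest _ _) es eN a c c′ = connected-injective nest nest refl es eN a c c′
  core-injective (nest s r) (cycA γ) es eN a c c′ =
    contradiction (lastValue-agree (nest {s} {r}) (cycA {γ}) eN a c c′) λ ()
  core-injective (nest s r) (cycB γ) es eN a c c′ =
    contradiction (lastValue-agree (nest {s} {r}) (cycB {γ}) eN a c c′) λ ()
  core-injective (cycA γ) (nest s r) es eN a c c′ =
    contradiction (lastValue-agree (cycA {γ}) (nest {s} {r}) eN a c c′) λ ()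
  core-injective (cycB γ) (nest s r) es eN a c c′ =
    contradiction (lastValue-agree (cycB {γ}) (nest {s} {r}) eN a c c′) λ ()
  core-injective (cycA γ) (cycA δ) es eN a c c′ =
    connected-injective cycA cycA (lastValue-agree (cycA {γ}) (cycA {δ}) eN a c c′) es eN a c c′
  core-injective (cycA γ) (cycB δ) es eN a c c′ =
    connected-injective cycA cycB (lastValue-agree (cycA {γ}) (cycB {δ}) eN a c c′) es eN a c c′
  core-injective (cycB γ) (cycA δ) es eN a c c′ =
    connected-injective cycB cycA (lastValue-agree (cycB {γ}) (cycA {δ}) eN a c c′) es eN a c c′
  core-injective (cycB γ) (cycB δ) es eN a c c′ =
    connected-injective cycB cycB (lastValue-agree (cycB {γ}) (cycB {δ}) eN a c c′) es eN a c c′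

  connected-injective (nest {s} {r}) (nest {s} {r′}) _ refl eN a _ _ = cong (nest s) (+-cancelˡ-≡ (suc (suc s)) r r′ eN)
  connected-injective (cycA {γ}) (cycA {δ}) e es eN a (h , w , c) (h′ , w′ , c′) =
    cong cycA (core-injective γ δ (suc-injective e) e₃ (wrapped-agree (suc-injective e) e₃ a w w′) c c′)
    where e₃ = suc-injective (suc-injective (suc-injective eN))
  connected-injective (cycB {γ}) (cycB {δ}) e es eN a (h , w , c) (h′ , w′ , c′) =
    cong cycB (core-injective γ δ (suc-injective e) e₃ (wrapped-agree (suc-injective e) e₃ a w w′) c c′)
    where e₃ = suc-injective (suc-injective (suc-injective eN))
  connected-injective cycA cycB e es _ _ _ _ = contradiction (trans (sym e) es) (<⇒≢ ≤-refl)
  connected-injective cycB cycA e es _ _ _ _ = contradiction (trans e (sym es)) (<⇒≢ ≤-refl)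
  connected-injective nest cycA () 
  connected-injective nest cycB () 
  connected-injective cycA nest () 
  connected-injective cycB nest () 

  -- The value `f 0` fixes the length of the first block. The entry at the last position of the
  -- block is 0 for `dec` and `split γ + 1` for `cyc`, so its kind and its split can be read off.
  tree-injective : ∀ τ τ′ {f f′} → sizeᵀ τ ≡ sizeᵀ τ′ → Agree (sizeᵀ τ) f f′ → IsTree τ f → IsTree τ′ f′ → τ ≡ τ′
  tree-injective nil nil _ _ _ _ = refl
  tree-injective (dec k τ) (dec k′ τ′) eN a (d , h , p , q) (d′ , h′ , p′ , q′) =
    cong₂ dec ek (tree-injective τ τ′ em (summand-agree (suc k) (cong suc ek) em a p p′) q q′)
    where
    ek : k ≡ k′
    ek = trans (sym (decreasing-zero d)) (trans (a (s≤s z≤n)) (decreasing-zero d′))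
    em : sizeᵀ τ ≡ sizeᵀ τ′
    em = +-cancelˡ-≡ (suc k) _ _ (trans eN (cong (λ k → suc (k + sizeᵀ τ′)) (sym ek)))
  tree-injective (cyc γ τ) (cyc γ′ τ′) {f} {f′} eN a ((g , w , c) , h , p , q) ((g′ , w′ , c′) , h′ , p′ , q′) =
    cong₂ cyc
      (core-injective γ γ′ es ek (wrapped-agree es ek (λ i< → a (<-≤-trans i< (m≤m+n (3 + size γ) (sizeᵀ τ)))) w w′) c c′)
      (tree-injective τ τ′ em (summand-agree (3 + size γ) (cong (3 +_) ek) em a p p′) q q′)
    where
    ek : size γ ≡ size γ′
    ek = suc-injective (suc-injective (trans (sym (at-zero w)) (trans (a (s≤s z≤n)) (at-zero w′))))
    es : split γ ≡ split γ′
    es = suc-injective (trans (sym (at-top w)) (trans (a (m≤m+n (3 + size γ) (sizeᵀ τ)))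
           (trans (cong (λ n → f′ (2 + n)) ek) (at-top w′))))
    em : sizeᵀ τ ≡ sizeᵀ τ′
    em = +-cancelˡ-≡ (3 + size γ) _ _ (trans eN (cong (λ k → 3 + (k + sizeᵀ τ′)) (sym ek)))
  tree-injective (dec k τ) (cyc γ τ′) {f} {f′} eN a (d , _) ((g , w , _) , _) = contradiction
    (trans (sym (trans (sym (a (s≤s (m≤m+n k _)))) (decreasing-last d))) (trans (cong f′ ek) (at-top w))) λ ()
    where
    ek : k ≡ 2 + size γ
    ek = trans (sym (decreasing-zero d)) (trans (a (s≤s z≤n)) (at-zero w))
  tree-injective (cyc γ τ) (dec k τ′) {f} {f′} eN a ((g , w , _) , _) (d , _) = contradiction
    (trans (sym (at-top w)) (trans (a (m≤m+n (3 + size γ) (sizeᵀ τ))) (trans (cong f′ (sym ek)) (decreasing-last d)))) λ ()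
    where
    ek : k ≡ 2 + size γ
    ek = trans (sym (decreasing-zero d)) (trans (sym (a (s≤s z≤n))) (at-zero w))

  -- A word for every code

  decreasingWord : ℕ → ℕ → ℕ
  decreasingWord n i = n ∸ suc i

  decreasingWord-decreasing : ∀ n → Decreasing n (decreasingWord n)
  decreasingWord-decreasing n p = m∸n+n≡m p

  sumWord : ℕ → (g h : ℕ → ℕ) → ℕ → ℕ
  sumWord k g h i with i <? k
  ... | yes _ = g i
  ... | no  _ = k + h (i ∸ k)

  sumWord-left : ∀ k g h → Agree k (sumWord k g h) g
  sumWord-left k g h {i} p with i <? k
  ... | yes _ = refl
  ... | no ¬p = contradiction p ¬p

  sumWord-right : ∀ k m g h → Sum k m h (sumWord k g h)
  sumWord-right k m g h {i} _ with k + i <? k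
  ... | yes p = contradiction p (≤⇒≯ (m≤m+n k i))
  ... | no  _ = cong (λ j → k + h j) (m+n∸m≡n k i)

  wrapWord : ℕ → ℕ → (ℕ → ℕ) → ℕ → ℕ
  wrapWord s N g zero = suc (suc N)
  wrapWord s N g (suc v) with v ≟ s | v ≟ suc N
  ... | yes _ | _     = 0
  ... | no  _ | yes _ = suc s
  ... | no  _ | no  _ = inner s (g (unskip s v))

  wrapWord-wrap : ∀ s N g → s ≤ N → Wrap s N g (wrapWord s N g)
  wrapWord-wrap s N g s≤N .at-zero = refl
  wrapWord-wrap s N g s≤N .at-mid with s ≟ s
  ... | yes _ = refl
  ... | no ¬p = contradiction refl ¬p
  wrapWord-wrap s N g s≤N .at-top with suc N ≟ s | suc N ≟ suc N
  ... | yes refl | _     = contradiction s≤N (<⇒≱ ≤-refl)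
  ... | no _     | yes _ = refl
  ... | no _     | no ¬p = contradiction refl ¬p
  wrapWord-wrap s N g s≤N .at-inner {i} p with skip s i ≟ s | skip s i ≟ suc N
  ... | yes q | _     = contradiction q (skip≢ s i)
  ... | no _  | yes q = contradiction q (<⇒≢ (≤-pred (inner< s p)))
  ... | no _  | no _  = cong (inner s ∘ g) (unskip-skip s i)

  wrap-resp : ∀ {s N g f f′} → s ≤ N → Agree (3 + N) f′ f → Wrap s N g f → Wrap s N g f′
  wrap-resp {s} s≤N a w = record
    { at-zero  = trans (a (s≤s z≤n)) (at-zero w)
    ; at-mid   = trans (a (s≤s (s≤s (≤-trans s≤N (n≤1+n _))))) (at-mid w)
    ; at-top   = trans (a ≤-refl) (at-top w)
    ; at-inner = λ p → trans (a (<-trans (inner< s p) ≤-refl)) (at-inner w p)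
    }

  decreasing-resp : ∀ {n f f′} → Agree n f′ f → Decreasing n f → Decreasing n f′
  decreasing-resp a d {i} p = trans (cong (_+ suc i) (a p)) (d p)

  core-exists : ∀ γ → ∃[ f ] IsCore γ f
  core-exists (pair s r) =
    sumWord s (decreasingWord s) (decreasingWord r) ,
    decreasing-resp (sumWord-left s (decreasingWord s) (decreasingWord r)) (decreasingWord-decreasing s) ,
    decreasingWord r , sumWord-right s r (decreasingWord s) (decreasingWord r) , decreasingWord-decreasing r
  core-exists (nest s r) = decreasingWord (2 + (s + r)) , decreasingWord-decreasing (2 + (s + r))
  core-exists (cycA γ) with core-exists γ
  ... | g , c = wrapWord (split γ) (size γ) g , g , wrapWord-wrap (split γ) (size γ) g (split≤size γ) , c
  core-exists (cycB γ) with core-exists γ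
  ... | g , c = wrapWord (split γ) (size γ) g , g , wrapWord-wrap (split γ) (size γ) g (split≤size γ) , c

  tree-exists : ∀ τ → ∃[ f ] IsTree τ f
  tree-exists nil = (λ i → i) , tt
  tree-exists (dec k τ) with tree-exists τ
  ... | h , p = sumWord (suc k) (decreasingWord (suc k)) h ,
    decreasing-resp (sumWord-left (suc k) (decreasingWord (suc k)) h) (decreasingWord-decreasing (suc k)) ,
    h , sumWord-right (suc k) (sizeᵀ τ) (decreasingWord (suc k)) h , p
  tree-exists (cyc γ τ) with core-exists γ | tree-exists τ
  ... | g , c | h , p = sumWord (3 + size γ) w h ,
    (g , wrap-resp (split≤size γ) (sumWord-left (3 + size γ) w h) (wrapWord-wrap (split γ) (size γ) g (split≤size γ)) , c) ,
    h , sumWord-right (3 + size γ) (sizeᵀ τ) w h , p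
    where w = wrapWord (split γ) (size γ) g

-- Cycle counts of coded words

module CycleCounts where

  open import Algebra.Bundles using (CommutativeRing; RawRing)
  import Algebra.Definitions.RawSemiring as RawSemiringOps
  import Algebra.Properties.CommutativeSemigroup as CommutativeSemigroupProperties
  import Algebra.Properties.Semiring.Exp as Exp
  open import Data.Nat.Base using (ℕ; zero; suc; _+_; _≤_; _<_; z≤n; s≤s; pred)
  open import Data.Nat.Properties
    using (+-comm; +-assoc; +-identityʳ; +-suc; +-monoʳ-<; _≟_; _<?_; <-asym; <⇒≢; <-trans; ≤-refl; suc-injective)
  open import Data.Product.Base using (_×_; _,_)
  open import Data.Empty using (⊥)
  open import Function.Base using (_∘_)
  open import Level using (Level)
  open import Relation.Binary.PropositionalEquality using (_≡_; refl; sym; trans; cong; cong₂; subst; module ≡-Reasoning)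
  open import Relation.Nullary using (¬_; Dec; yes; no)
  open import Relation.Nullary.Decidable using (_×-dec_)
  open import Relation.Nullary.Negation using (contradiction)
  import Relation.Binary.Reasoning.Setoid as SetoidReasoning
  open Trees
  open TreeSeries
  open Permutations

  indicator : ∀ {P : Set} → Dec P → ℕ
  indicator (yes _) = 1
  indicator (no _)  = 0

  indicator-cong : ∀ {P Q : Set} (p : Dec P) (q : Dec Q) → (P → Q) → (Q → P) → indicator p ≡ indicator q
  indicator-cong (yes p) (yes q) f g = refl
  indicator-cong (yes p) (no ¬q) f g = contradiction (f p) ¬q
  indicator-cong (no ¬p) (yes q) f g = contradiction (g q) ¬p
  indicator-cong (no ¬p) (no ¬q) f g = refl

  indicator-no : ∀ {P : Set} (p : Dec P) → ¬ P → indicator p ≡ 0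
  indicator-no (yes p) ¬p = contradiction p ¬p
  indicator-no (no _)  _  = refl

  sum : ℕ → (ℕ → ℕ) → ℕ
  sum zero    u = 0
  sum (suc n) u = u 0 + sum n (u ∘ suc)

  sum-cong : ∀ n {u v} → (∀ {i} → i < n → u i ≡ v i) → sum n u ≡ sum n v
  sum-cong zero    h = refl
  sum-cong (suc n) h = cong₂ _+_ (h (s≤s z≤n)) (sum-cong n (λ p → h (s≤s p)))

  sum-+ : ∀ m n u → sum (m + n) u ≡ sum m u + sum n (λ i → u (m + i))
  sum-+ zero    n u = refl
  sum-+ (suc m) n u = trans (cong (u 0 +_) (sum-+ m n (u ∘ suc))) (sym (+-assoc (u 0) _ _))

  sum-last : ∀ n u → sum (suc n) u ≡ sum n u + u n
  sum-last zero    u = +-comm (u 0) 0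
  sum-last (suc n) u = trans (cong (u 0 +_) (sum-last n (u ∘ suc))) (sym (+-assoc (u 0) _ _))

  sum-skip : ∀ s {n} u → s ≤ n → sum (suc n) u ≡ u s + sum n (u ∘ skip s)
  sum-skip zero            u p       = refl
  sum-skip (suc s) {suc n} u (s≤s p) = begin
    u 0 + sum (suc n) (u ∘ suc)                        ≡⟨ cong (u 0 +_) (sum-skip s (u ∘ suc) p) ⟩
    u 0 + (u (suc s) + sum n (u ∘ suc ∘ skip s))       ≡⟨ +-assoc (u 0) _ _ ⟨
    u 0 + u (suc s) + sum n (u ∘ suc ∘ skip s)         ≡⟨ cong (_+ sum n (u ∘ suc ∘ skip s)) (+-comm (u 0) _) ⟩
    u (suc s) + u 0 + sum n (u ∘ suc ∘ skip s)         ≡⟨ +-assoc (u (suc s)) _ _ ⟩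
    u (suc s) + (u 0 + sum n (u ∘ suc ∘ skip s))       ∎
    where open ≡-Reasoning

  -- In a permutation whose cycles have length at most 3: i is the least element of a k-cycle.
  Least : ℕ → (ℕ → ℕ) → ℕ → Set
  Least 1 f i = f i ≡ i
  Least 2 f i = f (f i) ≡ i × i < f i
  Least 3 f i = f (f (f i)) ≡ i × i < f i × i < f (f i)
  Least _ f i = ⊥

  least? : ∀ k f i → Dec (Least k f i)
  least? 0 f i = no λ ()
  least? 1 f i = f i ≟ i
  least? 2 f i = (f (f i) ≟ i) ×-dec (i <? f i)
  least? 3 f i = (f (f (f i)) ≟ i) ×-dec ((i <? f i) ×-dec (i <? f (f i)))
  least? (suc (suc (suc (suc _)))) f i = no λ ()

  cycleCount : ℕ → (ℕ → ℕ) → ℕ → ℕ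
  cycleCount n f k = sum n (λ i → indicator (least? k f i))

  least-indicator : ∀ k {f g i j} → (Least k f i → Least k g j) → (Least k g j → Least k f i) →
    indicator (least? k f i) ≡ indicator (least? k g j)
  least-indicator k p q = indicator-cong (least? k _ _) (least? k _ _) p q

  module _ (ι : ℕ → ℕ) (mono : ∀ {i j} → i < j → ι i < ι j) {m : ℕ} {h f : ℕ → ℕ}
    (bd : ∀ {i} → i < m → h i < m) (commutes : ∀ {i} → i < m → f (ι i) ≡ ι (h i)) where
    open StrictlyMonotone ι mono

    private
      e₂ : ∀ {i} → i < m → f (f (ι i)) ≡ ι (h (h i))
      e₂ = commutes² {f = f} bd commutes
      e₃ : ∀ {i} → i < m → f (f (f (ι i))) ≡ ι (h (h (h i)))
      e₃ = commutes³ {f = f} bd commutes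

    least-pattern : ∀ k {i} → i < m → indicator (least? k f (ι i)) ≡ indicator (least? k h i)
    least-pattern 0 p = refl
    least-pattern 1 {i} p = least-indicator 1 {f} {h}
      (λ q → reflects-≡ (trans (sym (commutes p)) q)) (λ q → trans (commutes p) (cong ι q))
    least-pattern 2 {i} p = least-indicator 2 {f} {h}
      (λ (q , a) → reflects-≡ (trans (sym (e₂ p)) q) , reflects-< (subst (ι i <_) (commutes p) a))
      (λ (q , a) → trans (e₂ p) (cong ι q) , subst (ι i <_) (sym (commutes p)) (mono a))
    least-pattern 3 {i} p = least-indicator 3 {f} {h}
      (λ (q , a , b) → reflects-≡ (trans (sym (e₃ p)) q) ,
        reflects-< (subst (ι i <_) (commutes p) a) , reflects-< (subst (ι i <_) (e₂ p) b))
      (λ (q , a , b) → trans (e₃ p) (cong ι q) ,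
        subst (ι i <_) (sym (commutes p)) (mono a) , subst (ι i <_) (sym (e₂ p)) (mono b))
    least-pattern (suc (suc (suc (suc _)))) p = refl

  single : ℕ → ℕ → ℕ
  single m k = indicator (m ≟ k)

  cycleCount-sum : ∀ k m {f h} → Good m h → Sum k m h f →
    ∀ l → cycleCount (k + m) f l ≡ cycleCount k f l + cycleCount m h l
  cycleCount-sum k m {f} {h} g p l = trans (sum-+ k m _)
    (cong (cycleCount k f l +_) (sum-cong m (least-pattern (k +_) (+-monoʳ-< k) {h = h} {f} (Good.bounded g) p l)))

  -- Of the inserted points only `0` is least in its cycle, so the new cycle is counted once, there.
  -- Inside, `inner s` is increasing and preserves least elements.
  cycleCount-wrap : ∀ {s N g f} → CoreWord s N g → Wrap s N g f →
    ∀ k → cycleCount (3 + N) f k ≡ single 3 k + cycleCount N g k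
  cycleCount-wrap {s} {N} {g} {f} c w k = begin
    u 0 + sum (suc (suc N)) (u ∘ suc)
      ≡⟨ cong (u 0 +_) (sum-last (suc N) (u ∘ suc)) ⟩
    u 0 + (sum (suc N) (u ∘ suc) + u (2 + N))
      ≡⟨ cong (λ z → u 0 + (z + u (2 + N))) (sum-skip s (u ∘ suc) (CoreWord.split≤ c)) ⟩
    u 0 + ((u (suc s) + sum N (u ∘ inner s)) + u (2 + N))
      ≡⟨ cong₂ _+_ (zero-value k) (cong₂ _+_ (cong₂ _+_ (mid-value k) inner-value) (top-value k)) ⟩
    single 3 k + (cycleCount N g k + 0)
      ≡⟨ cong (single 3 k +_) (+-identityʳ _) ⟩
    single 3 k + cycleCount N g k ∎
    where
    open ≡-Reasoning
    open Wrap w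
    u : ℕ → ℕ
    u i = indicator (least? k f i)
    s<2+N : suc s < 2 + N
    s<2+N = s≤s (s≤s (CoreWord.split≤ c))
    f²0 : f (f 0) ≡ suc s
    f²0 = trans (cong f at-zero) at-top
    f³0 : f (f (f 0)) ≡ 0
    f³0 = trans (cong f f²0) at-mid
    zero-value : ∀ k → indicator (least? k f 0) ≡ single 3 k
    zero-value 0 = refl
    zero-value 1 = indicator-no (least? 1 f 0) λ q → contradiction (trans (sym at-zero) q) λ ()
    zero-value 2 = indicator-no (least? 2 f 0) λ (q , _) → contradiction (trans (sym f²0) q) λ ()
    zero-value 3 = indicator-cong (least? 3 f 0) (3 ≟ 3) (λ _ → refl)
      (λ _ → f³0 , subst (0 <_) (sym at-zero) (s≤s z≤n) , subst (0 <_) (sym f²0) (s≤s z≤n))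
    zero-value (suc (suc (suc (suc k)))) = sym (indicator-no (3 ≟ 4 + k) λ ())
    i≮fm : ¬ suc s < f (suc s)
    i≮fm p = contradiction (subst (suc s <_) at-mid p) λ ()
    mid-value : ∀ k → indicator (least? k f (suc s)) ≡ 0
    mid-value 0 = refl
    mid-value 1 = indicator-no (least? 1 f (suc s)) λ q → contradiction (trans (sym at-mid) q) λ ()
    mid-value 2 = indicator-no (least? 2 f (suc s)) λ (_ , q) → i≮fm q
    mid-value 3 = indicator-no (least? 3 f (suc s)) λ (_ , q , _) → i≮fm q
    mid-value (suc (suc (suc (suc k)))) = refl
    i≮ft : ¬ 2 + N < f (2 + N)
    i≮ft p = <-asym s<2+N (subst (2 + N <_) at-top p)
    top-value : ∀ k → indicator (least? k f (2 + N)) ≡ 0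
    top-value 0 = refl
    top-value 1 = indicator-no (least? 1 f (2 + N)) λ q → <⇒≢ s<2+N (trans (sym at-top) q)
    top-value 2 = indicator-no (least? 2 f (2 + N)) λ (_ , q) → i≮ft q
    top-value 3 = indicator-no (least? 3 f (2 + N)) λ (_ , q , _) → i≮ft q
    top-value (suc (suc (suc (suc k)))) = refl
    inner-value : sum N (u ∘ inner s) ≡ cycleCount N g k
    inner-value = sum-cong N
      (least-pattern (inner s) (inner-mono s) {h = g} {f} (Good.bounded (CoreWord.good c)) at-inner k)

  decreasing-inner : ∀ {n f} → Decreasing (2 + n) f → Decreasing n (pred ∘ f ∘ suc)
  decreasing-inner {n} {f} d {i} p with f (suc i) | d (s≤s (<-trans p ≤-refl))
  ... | zero  | eq = contradiction (suc-injective (suc-injective eq)) (<⇒≢ p)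
  ... | suc v | eq = suc-injective (suc-injective (trans (cong suc (sym (+-suc v (suc i)))) eq))

  -- The reversal exchanges its first and last positions, and this 2-cycle is counted at `0`; what
  -- lies between is again a reversal.
  cycleCount-decreasing : ∀ {n f} → Decreasing (2 + n) f →
    ∀ k → cycleCount (2 + n) f k ≡ single 2 k + cycleCount n (pred ∘ f ∘ suc) k
  cycleCount-decreasing {n} {f} d k = begin
    u 0 + sum (suc n) (u ∘ suc)                    ≡⟨ cong (u 0 +_) (sum-last n (u ∘ suc)) ⟩
    u 0 + (sum n (u ∘ suc) + u (suc n))            ≡⟨ cong₂ _+_ (zero-value k) (cong₂ _+_ inner-value (last-value k)) ⟩
    single 2 k + (cycleCount n (pred ∘ f ∘ suc) k + 0) ≡⟨ cong (single 2 k +_) (+-identityʳ _) ⟩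
    single 2 k + cycleCount n (pred ∘ f ∘ suc) k   ∎
    where
    open ≡-Reasoning
    u : ℕ → ℕ
    u i = indicator (least? k f i)
    f0 : f 0 ≡ suc n
    f0 = decreasing-zero d
    fl : f (suc n) ≡ 0
    fl = decreasing-last d
    f²0 : f (f 0) ≡ 0
    f²0 = trans (cong f f0) fl
    zero-value : ∀ k → indicator (least? k f 0) ≡ single 2 k
    zero-value 0 = refl
    zero-value 1 = indicator-no (least? 1 f 0) λ q → contradiction (trans (sym f0) q) λ ()
    zero-value 2 = indicator-cong (least? 2 f 0) (2 ≟ 2) (λ _ → refl) (λ _ → f²0 , subst (0 <_) (sym f0) (s≤s z≤n))
    zero-value 3 = indicator-no (least? 3 f 0) λ (_ , _ , q) → contradiction (subst (0 <_) f²0 q) λ ()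
    zero-value (suc (suc (suc (suc k)))) = sym (indicator-no (2 ≟ 4 + k) λ ())
    i≮fl : ¬ suc n < f (suc n)
    i≮fl p = contradiction (subst (suc n <_) fl p) λ ()
    last-value : ∀ k → indicator (least? k f (suc n)) ≡ 0
    last-value 0 = refl
    last-value 1 = indicator-no (least? 1 f (suc n)) λ q → contradiction (trans (sym fl) q) λ ()
    last-value 2 = indicator-no (least? 2 f (suc n)) λ (_ , q) → i≮fl q
    last-value 3 = indicator-no (least? 3 f (suc n)) λ (_ , q , _) → i≮fl q
    last-value (suc (suc (suc (suc k)))) = refl
    commutes : ∀ {i} → i < n → f (suc i) ≡ suc (pred (f (suc i)))
    commutes {i} p with f (suc i) | d (s≤s (<-trans p ≤-refl))
    ... | zero  | eq = contradiction (suc-injective (suc-injective eq)) (<⇒≢ p)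
    ... | suc v | _  = refl
    inner-value : sum n (u ∘ suc) ≡ cycleCount n (pred ∘ f ∘ suc) k
    inner-value = sum-cong n
      (least-pattern suc s≤s {h = pred ∘ f ∘ suc} {f} (Good.bounded (decreasing-good (decreasing-inner d))) commutes k)

  cycleCount-one : ∀ {f} → Decreasing 1 f → ∀ k → cycleCount 1 f k ≡ single 1 k
  cycleCount-one {f} d k = trans (+-identityʳ _) (value k)
    where
    f0 : f 0 ≡ 0
    f0 = decreasing-zero d
    value : ∀ k → indicator (least? k f 0) ≡ single 1 k
    value 0 = refl
    value 1 = indicator-cong (least? 1 f 0) (1 ≟ 1) (λ _ → refl) (λ _ → f0)
    value 2 = indicator-no (least? 2 f 0) λ (_ , q) → contradiction (subst (0 <_) f0 q) λ ()
    value 3 = indicator-no (least? 3 f 0) λ (_ , q , _) → contradiction (subst (0 <_) f0 q) λ ()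
    value (suc (suc (suc (suc k)))) = sym (indicator-no (1 ≟ 4 + k) λ ())

  module Monomials {r ℓ : Level} (A : CommutativeRing r ℓ) (t x y : CommutativeRing.Carrier A) where
    open CommutativeRing A renaming (_+_ to _⊕_; _*_ to _·_; refl to ≈-refl; sym to ≈-sym; trans to ≈-trans)
    open RawSemiringOps (RawRing.rawSemiring rawRing) using (_^_)
    open CommutativeSemigroupProperties *-commutativeSemigroup using (interchange)
    open Exp semiring using (^-homo-*)
    open TreeWeights A t x y
    open SetoidReasoning setoid

    monomial : (ℕ → ℕ) → Carrier
    monomial u = (t ^ u 1) · (x ^ u 2) · (y ^ u 3)

    monomial-cong : ∀ u v → (∀ k → u k ≡ v k) → monomial u ≈ monomial v
    monomial-cong u v h = reflexive (cong₂ _·_ (cong₂ _·_ (cong (t ^_) (h 1)) (cong (x ^_) (h 2))) (cong (y ^_) (h 3)))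

    monomial-+ : ∀ u v → monomial (λ k → u k + v k) ≈ monomial u · monomial v
    monomial-+ u v = begin
      (t ^ (u 1 + v 1)) · (x ^ (u 2 + v 2)) · (y ^ (u 3 + v 3))
        ≈⟨ *-cong (*-cong (^-homo-* t (u 1) (v 1)) (^-homo-* x (u 2) (v 2))) (^-homo-* y (u 3) (v 3)) ⟩
      ((t ^ u 1) · (t ^ v 1)) · ((x ^ u 2) · (x ^ v 2)) · ((y ^ u 3) · (y ^ v 3))
        ≈⟨ *-congʳ (interchange _ _ _ _) ⟩
      ((t ^ u 1) · (x ^ u 2)) · ((t ^ v 1) · (x ^ v 2)) · ((y ^ u 3) · (y ^ v 3))
        ≈⟨ interchange _ _ _ _ ⟩
      monomial u · monomial v ∎

    monomial-++ : ∀ u v w {a b} → (∀ k → u k ≡ v k + w k) → monomial v ≈ a → monomial w ≈ b → monomial u ≈ a · b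
    monomial-++ u v w h p q = ≈-trans (monomial-cong u (λ k → v k + w k) h) (≈-trans (monomial-+ v w) (*-cong p q))

    monomial-1 : monomial (single 1) ≈ t
    monomial-1 = ≈-trans (*-identityʳ _) (≈-trans (*-identityʳ _) (*-identityʳ _))

    monomial-2 : monomial (single 2) ≈ x
    monomial-2 = ≈-trans (*-identityʳ _) (≈-trans (*-identityˡ _) (*-identityʳ _))

    monomial-3 : monomial (single 3) ≈ y
    monomial-3 = ≈-trans (*-congʳ (*-identityˡ _)) (≈-trans (*-identityˡ _) (*-identityʳ _))

    monomial-0 : monomial (λ _ → 0) ≈ 1#
    monomial-0 = ≈-trans (*-identityʳ _) (*-identityʳ _)

    dec-monomial : ∀ n {f} → Decreasing n f → monomial (cycleCount n f) ≈ decWeight n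
    dec-monomial 0             d = monomial-0
    dec-monomial 1             {f} d =
      ≈-trans (monomial-cong (cycleCount 1 f) (single 1) (cycleCount-one d)) monomial-1
    dec-monomial (suc (suc n)) {f} d =
      monomial-++ (cycleCount (2 + n) f) (single 2) (cycleCount n (pred ∘ f ∘ suc))
        (cycleCount-decreasing d) monomial-2 (dec-monomial n (decreasing-inner d))

    wrap-monomial : ∀ {s N g f a} → CoreWord s N g → Wrap s N g f →
      monomial (cycleCount N g) ≈ a → monomial (cycleCount (3 + N) f) ≈ y · a
    wrap-monomial {s} {N} {g} {f} c w p =
      monomial-++ (cycleCount (3 + N) f) (single 3) (cycleCount N g) (cycleCount-wrap c w) monomial-3 p

    sum-monomial : ∀ k m {f h a b} → Good m h → Sum k m h f →
      monomial (cycleCount k f) ≈ a → monomial (cycleCount m h) ≈ b → monomial (cycleCount (k + m) f) ≈ a · b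
    sum-monomial k m {f} {h} g p =
      monomial-++ (cycleCount (k + m) f) (cycleCount k f) (cycleCount m h) (cycleCount-sum k m g p)

    core-monomial : ∀ γ {f} → IsCore γ f → monomial (cycleCount (size γ) f) ≈ coreWeight γ
    core-monomial (pair s r) {f} (d , h , p , e) =
      sum-monomial s r {f} (decreasing-good e) p (dec-monomial s d) (dec-monomial r e)
    core-monomial (nest s r) d           = dec-monomial (2 + (s + r)) d
    core-monomial (cycA γ)   (h , w , c) = wrap-monomial (core-sound γ c) w (core-monomial γ c)
    core-monomial (cycB γ)   (h , w , c) = wrap-monomial (core-sound γ c) w (core-monomial γ c)

    tree-monomial : ∀ τ {f} → IsTree τ f → monomial (cycleCount (sizeᵀ τ) f) ≈ treeWeight τ
    tree-monomial nil       _                            = monomial-0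
    tree-monomial (dec k τ) {f} (d , h , p , q)              =
      sum-monomial (suc k) (sizeᵀ τ) {f} (tree-sound τ q) p (dec-monomial (suc k) d) (tree-monomial τ q)
    tree-monomial (cyc γ τ) {f} ((g , w , c) , h , p , q) = ≈-trans
      (sum-monomial (3 + size γ) (sizeᵀ τ) {f} (tree-sound τ q) p
        (wrap-monomial {f = f} (core-sound γ c) w (core-monomial γ c)) (tree-monomial τ q))
      (*-assoc _ _ _)

-- From permutations of finite sets to codes

module Words where

  open import Data.Empty using (⊥-elim)
  open import Data.Fin.Base as Fin using (Fin; zero; suc; toℕ; fromℕ<)
  import Data.Fin.Properties as Fin
  import Data.List.Base as List
  open import Data.List.Base using (List; []; _∷_; length; map; filter; takeWhile; iterate; allFin)
  open import Data.List.Membership.Propositional using (_∈_; find)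
  open import Data.List.Membership.Propositional.Properties
    using (∈-map⁺; ∈-map⁻; ∈-filter⁺; ∈-filter⁻; ∈-allFin; ∈-lookup)
  open import Data.List.Relation.Unary.All as All using (All; []; _∷_)
  import Data.List.Relation.Unary.All.Properties as All
  open import Data.List.Relation.Unary.Any using (here; there)
  open import Data.List.Relation.Unary.AllPairs using ([]; _∷_)
  open import Data.List.Relation.Unary.Unique.Propositional using (Unique)
  import Data.List.Relation.Unary.Unique.Propositional.Properties as Unique
  open import Data.List.Relation.Binary.BagAndSetEquality using (∼bag⇒↭)
  open import Data.List.Membership.Propositional.Properties.WithK using (unique∧set⇒bag)
  open import Data.List.Relation.Binary.Permutation.Propositional using (_↭_)
  open import Data.Nat.Base as ℕ using (ℕ; zero; suc; _+_; _<_; z≤n; s≤s)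
  import Data.Nat.ListAction as ListAction
  import Data.Nat.Properties as ℕ
  open import Data.Nat.Induction using (<-rec)
  open import Data.Product.Base using (Σ-syntax; ∃-syntax; _×_; _,_; proj₁; proj₂)
  open import Data.Sum.Base as Sum using (_⊎_; inj₁; inj₂)
  open import Data.Vec.Base as Vec using (Vec; []; _∷_; lookup; tabulate)
  open import Data.Vec.Properties using (lookup∘tabulate; tabulate∘lookup; tabulate-cong)
  open import Function.Base using (_∘_; id)
  open import Function.Bundles using (mk⇔; Equivalence)
  open import Function.Definitions using (Injective)
  open import Relation.Binary.Definitions using (tri<; tri≈; tri>)
  open import Relation.Binary.PropositionalEquality using (_≡_; _≢_; refl; sym; trans; cong; cong₂; subst; subst₂; module ≡-Reasoning)
  open import Relation.Nullary using (¬_; Dec; yes; no)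
  open import Relation.Nullary.Decidable using (¬?; dec-true; dec-false)
  open import Relation.Nullary.Negation using (contradiction)
  open import Relation.Unary using (Decidable)
  open Trees
  open Permutations
  open CycleCounts
  open import Defs using (Word; IsPermutation; words; ∈-words; Contains; [231]; isPermutation?; contains?; cycleFrom; cycles; c; 𝔖[3]⟨231⟩)

  takeWhile-accept : ∀ {A : Set} {P : A → Set} (P? : Decidable P) {a} as → P a →
    takeWhile P? (a ∷ as) ≡ a ∷ takeWhile P? as
  takeWhile-accept P? {a} as p rewrite dec-true (P? a) p = refl

  takeWhile-reject : ∀ {A : Set} {P : A → Set} (P? : Decidable P) {a} as → ¬ P a → takeWhile P? (a ∷ as) ≡ []
  takeWhile-reject P? {a} as ¬p rewrite dec-false (P? a) ¬p = refl

  -- Distinct points of an orbit bound `n` from below, which guarantees that the `n ∸ 1` iterations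
  -- in `cycleFrom` reach as far as needed.
  unique-bound : ∀ {n} {is : List (Fin n)} → Unique is → length is ℕ.≤ n
  unique-bound {n} {is} u = ℕ.≮⇒≥ λ n< →
    let i , j , i<j , eq = Fin.pigeonhole n< (List.lookup is) in distinct u i j i<j eq
    where
    distinct : ∀ {is : List (Fin n)} → Unique is → ∀ i j → i Fin.< j → List.lookup is i ≢ List.lookup is j
    distinct {_ ∷ is} (a ∷ _) zero    (suc j) _         = All.lookup a (∈-lookup j)
    distinct {_ ∷ is} (_ ∷ u) (suc i) (suc j) (s≤s i<j) = distinct u i j i<j

  module Orbits {n : ℕ} (w : Word n n) (inj : Injective _≡_ _≡_ (lookup w)) where
    π : Fin n → Fin n
    π = lookup w

    Period : Fin n → Set
    Period i = π (π i) ≡ i ⊎ π (π (π i)) ≡ i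

    -- The inequalities make the three cases exclusive, so that the listed cycle determines which
    -- power of `π` first returns to `i`.
    data Orbit (i : Fin n) : Set where
      fixed : π i ≡ i → cycleFrom w i ≡ i ∷ [] → Orbit i
      swap  : π i ≢ i → π (π i) ≡ i → cycleFrom w i ≡ i ∷ π i ∷ [] → Orbit i
      three : π i ≢ i → π (π i) ≢ i → π (π (π i)) ≡ i → cycleFrom w i ≡ i ∷ π i ∷ π (π i) ∷ [] → Orbit i

    private
      unless : ∀ (i : Fin n) → Decidable (_≢ i)
      unless i j = ¬? (j Fin.≟ i)

      stop : ∀ i {j} m → j ≡ i → takeWhile (unless i) (iterate π j m) ≡ []
      stop i zero    e = refl
      stop i (suc m) e = takeWhile-reject (unless i) _ (λ j≢i → j≢i e)

      go : ∀ i j m → j ≢ i → takeWhile (unless i) (iterate π j (suc m)) ≡ j ∷ takeWhile (unless i) (iterate π (π j) m)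
      go i j m j≢i = takeWhile-accept (unless i) (iterate π (π j) m) j≢i

      ≢π : ∀ {i j} → j ≢ i → π i ≢ π j
      ≢π j≢i e = j≢i (sym (inj e))

      unique₂ : ∀ i → π i ≢ i → Unique (i ∷ π i ∷ [])
      unique₂ i p = ((p ∘ sym) ∷ []) ∷ [] ∷ []

      unique₃ : ∀ i → π i ≢ i → π (π i) ≢ i → Unique (i ∷ π i ∷ π (π i) ∷ [])
      unique₃ i p q = ((p ∘ sym) ∷ (q ∘ sym) ∷ []) ∷ (≢π {i} {π i} p ∷ []) ∷ [] ∷ []

      unique₄ : ∀ i → π i ≢ i → π (π i) ≢ i → π (π (π i)) ≢ i → Unique (i ∷ π i ∷ π (π i) ∷ π (π (π i)) ∷ [])
      unique₄ i p q r = ((p ∘ sym) ∷ (q ∘ sym) ∷ (r ∘ sym) ∷ []) ∷ (≢π {i} {π i} p ∷ ≢π {i} {π (π i)} q ∷ [])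
        ∷ (≢π {π i} {π (π i)} (≢π {i} {π i} p ∘ sym) ∷ []) ∷ [] ∷ []

      iterations : ∀ k → suc k ℕ.≤ n → Σ[ m ∈ ℕ ] n ℕ.∸ 1 ≡ k + m
      iterations k k<n with ℕ.m≤n⇒∃[o]m+o≡n k<n
      ... | m , refl = m , refl

    orbit : ∀ i → Period i → Orbit i
    orbit i per with π i Fin.≟ i | π (π i) Fin.≟ i
    ... | yes e | _ = fixed e (cong (i ∷_) (stop i (n ℕ.∸ 1) e))
    ... | no p  | yes e with iterations 1 (unique-bound (unique₂ i p))
    ...   | m , eq = swap p e (cong (i ∷_) (begin
      takeWhile (unless i) (iterate π (π i) (n ℕ.∸ 1))  ≡⟨ cong (takeWhile (unless i) ∘ iterate π (π i)) eq ⟩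
      takeWhile (unless i) (iterate π (π i) (suc m))    ≡⟨ go i (π i) m p ⟩
      π i ∷ takeWhile (unless i) (iterate π (π (π i)) m) ≡⟨ cong (π i ∷_) (stop i m e) ⟩
      π i ∷ []                                          ∎))
      where open ≡-Reasoning
    orbit i per | no p  | no q with iterations 2 (unique-bound (unique₃ i p q))
    ...   | m , eq = three p q e (cong (i ∷_) (begin
      takeWhile (unless i) (iterate π (π i) (n ℕ.∸ 1))        ≡⟨ cong (takeWhile (unless i) ∘ iterate π (π i)) eq ⟩
      takeWhile (unless i) (iterate π (π i) (suc (suc m)))    ≡⟨ go i (π i) (suc m) p ⟩
      π i ∷ takeWhile (unless i) (iterate π (π (π i)) (suc m)) ≡⟨ cong (π i ∷_) (go i (π (π i)) m q) ⟩
      π i ∷ π (π i) ∷ takeWhile (unless i) (iterate π (π (π (π i))) m)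
        ≡⟨ cong (λ js → π i ∷ π (π i) ∷ js) (stop i m e) ⟩
      π i ∷ π (π i) ∷ []                                      ∎))
      where
      open ≡-Reasoning
      e : π (π (π i)) ≡ i
      e = Sum.[ (λ e → contradiction e q) , id ] per

    Short : Fin n → Set
    Short i = length (cycleFrom w i) ∈ 1 ∷ 2 ∷ 3 ∷ []

    orbit-short : ∀ i → Orbit i → Short i
    orbit-short i (fixed _ eq)     = subst (λ C → length C ∈ 1 ∷ 2 ∷ 3 ∷ []) (sym eq) (here refl)
    orbit-short i (swap _ _ eq)    = subst (λ C → length C ∈ 1 ∷ 2 ∷ 3 ∷ []) (sym eq) (there (here refl))
    orbit-short i (three _ _ _ eq) = subst (λ C → length C ∈ 1 ∷ 2 ∷ 3 ∷ []) (sym eq) (there (there (here refl)))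

    -- If `i` did not return within three steps, four distinct points would force `n` to be at least
    -- 4. Then three further entries follow `i` in `cycleFrom w i`, whose length would be at least
    -- 4.
    short-period : ∀ i → Short i → Period i
    short-period i short with π i Fin.≟ i | π (π i) Fin.≟ i | π (π (π i)) Fin.≟ i
    ... | yes e | _     | _     = inj₁ (trans (cong π e) e)
    ... | no _  | yes e | _     = inj₁ e
    ... | no _  | no _  | yes e = inj₂ e
    ... | no p  | no q  | no r with iterations 3 (unique-bound (unique₄ i p q r))
    ...   | m , eq = ⊥-elim (long (subst (λ C → suc (length C) ∈ 1 ∷ 2 ∷ 3 ∷ []) (begin
      takeWhile (unless i) (iterate π (π i) (n ℕ.∸ 1))        ≡⟨ cong (takeWhile (unless i) ∘ iterate π (π i)) eq ⟩
      takeWhile (unless i) (iterate π (π i) (suc (suc (suc m)))) ≡⟨ go i (π i) (suc (suc m)) p ⟩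
      π i ∷ takeWhile (unless i) (iterate π (π (π i)) (suc (suc m))) ≡⟨ cong (π i ∷_) (go i (π (π i)) (suc m) q) ⟩
      π i ∷ π (π i) ∷ takeWhile (unless i) (iterate π (π (π (π i))) (suc m))
        ≡⟨ cong (λ js → π i ∷ π (π i) ∷ js) (go i (π (π (π i))) m r) ⟩
      π i ∷ π (π i) ∷ π (π (π i)) ∷ takeWhile (unless i) (iterate π (π (π (π (π i)))) m) ∎) short))
      where
      open ≡-Reasoning
      long : ∀ {k} → ¬ suc (suc (suc (suc k))) ∈ 1 ∷ 2 ∷ 3 ∷ []
      long (here ())
      long (there (here ()))
      long (there (there (here ())))
      long (there (there (there ())))

    power : ℕ → Fin n → Fin n
    power zero    i = i
    power (suc a) i = π (power a i)

    power-injective : ∀ a → Injective _≡_ _≡_ (power a)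
    power-injective zero    e = e
    power-injective (suc a) e = power-injective a (inj e)

    power-π : ∀ a i → power a (π i) ≡ π (power a i)
    power-π zero    i = refl
    power-π (suc a) i = cong π (power-π a i)

    -- Powers of `π` are injective and commute with `π`, so a period found anywhere on the orbit can
    -- be carried back to `i`.
    power-period : ∀ a i → Period (power a i) → Period i
    power-period a i (inj₁ e) = inj₁ (power-injective a
      (trans (trans (power-π a (π i)) (cong π (power-π a i))) e))
    power-period a i (inj₂ e) = inj₂ (power-injective a
      (trans (trans (power-π a (π (π i))) (cong π (trans (power-π a (π i)) (cong π (power-π a i))))) e))

    cycleFrom-powers : ∀ i → All (λ j → ∃[ a ] j ≡ power a i) (cycleFrom w i)
    cycleFrom-powers i = (0 , refl) ∷ All.takeWhile⁺ (unless i) (powers 1 {π i} refl (n ℕ.∸ 1))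
      where
      powers : ∀ a {j} → j ≡ power a i → ∀ m → All (λ j → ∃[ a ] j ≡ power a i) (iterate π j m)
      powers a e zero    = []
      powers a e (suc m) = (a , e) ∷ powers (suc a) (cong π e) m

    startsLeast? : ∀ i → Dec (All (i Fin.≤_) (cycleFrom w i))
    startsLeast? i = All.all? (i Fin.≤?_) (cycleFrom w i)

    -- Only cycles started at their least element are listed in cycles w; the other points have a
    -- smaller point in their orbit.
    all-period : All (λ C → length C ∈ 1 ∷ 2 ∷ 3 ∷ []) (cycles w) → ∀ i → Period i
    all-period short i = <-rec (λ k → ∀ i → toℕ i ≡ k → Period i) via-least (toℕ i) i refl
      where
      via-least : ∀ k → (∀ {k′} → k′ < k → ∀ i → toℕ i ≡ k′ → Period i) → ∀ i → toℕ i ≡ k → Period i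
      via-least k rec i refl with startsLeast? i
      ... | yes l = short-period i (All.lookup short (∈-map⁺ (cycleFrom w) (∈-filter⁺ startsLeast? (∈-allFin i) l)))
      ... | no ¬l with find (All.¬All⇒Any¬ (i Fin.≤?_) _ ¬l)
      ...   | j , j∈ , i≰j with All.lookup (cycleFrom-powers i) j∈
      ...     | a , refl = power-period a i (rec (ℕ.≰⇒> i≰j) (power a i) refl)

  Represents : ∀ {n} → Word n n → (ℕ → ℕ) → Set
  Represents w f = ∀ i → f (toℕ i) ≡ toℕ (lookup w i)

  toℕ-elim : ∀ {n} (P : ℕ → Set) → (∀ (a : Fin n) → P (toℕ a)) → ∀ {i} → i < n → P i
  toℕ-elim P h p = subst P (Fin.toℕ-fromℕ< p) (h (fromℕ< p))

  indicator-yes : ∀ {P : Set} (p : Dec P) → P → indicator p ≡ 1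
  indicator-yes (yes _) _ = refl
  indicator-yes (no ¬p) p = contradiction p ¬p

  -- `c k` selects starting points, turns them into cycles and selects those by length. Both
  -- selections merge into one condition on the starting point, and the length becomes a sum of
  -- indicators.
  length-filter-map-filter : ∀ {A B : Set} {P : A → Set} {Q : B → Set} {R : A → Set}
    (P? : Decidable P) (Q? : Decidable Q) (R? : Decidable R) (g : A → B) →
    (∀ a → P a → Q (g a) → R a) → (∀ a → R a → P a × Q (g a)) →
    ∀ as → length (filter Q? (map g (filter P? as))) ≡ ListAction.sum (map (indicator ∘ R?) as)
  length-filter-map-filter P? Q? R? g to from []       = refl
  length-filter-map-filter P? Q? R? g to from (a ∷ as) with P? a
  ... | no ¬p = trans (length-filter-map-filter P? Q? R? g to from as)
                  (cong (_+ ListAction.sum (map (indicator ∘ R?) as)) (sym (indicator-no (R? a) (¬p ∘ proj₁ ∘ from a))))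
  ... | yes p with Q? (g a)
  ...   | no ¬q = trans (length-filter-map-filter P? Q? R? g to from as)
                  (cong (_+ ListAction.sum (map (indicator ∘ R?) as)) (sym (indicator-no (R? a) (¬q ∘ proj₂ ∘ from a))))
  ...   | yes q = cong₂ _+_ (sym (indicator-yes (R? a) (to a p q))) (length-filter-map-filter P? Q? R? g to from as)

  sum-tabulate : ∀ n {A : Set} (g : Fin n → A) (φ : A → ℕ) (u : ℕ → ℕ) → (∀ i → φ (g i) ≡ u (toℕ i)) →
    ListAction.sum (map φ (List.tabulate g)) ≡ sum n u
  sum-tabulate zero    g φ u h = refl
  sum-tabulate (suc n) g φ u h = cong₂ _+_ (h zero) (sum-tabulate n (g ∘ suc) φ (u ∘ suc) (h ∘ suc))

  module _ {n} {w : Word n n} {f : ℕ → ℕ} (rep : Represents w f) where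
    private
      π : Fin n → Fin n
      π = lookup w

      rep² : ∀ i → f (f (toℕ i)) ≡ toℕ (π (π i))
      rep² i = trans (cong f (rep i)) (rep (π i))

      rep³ : ∀ i → f (f (f (toℕ i))) ≡ toℕ (π (π (π i)))
      rep³ i = trans (cong f (rep² i)) (rep (π (π i)))

    module _ (good : Good n f) where
      word-injective : Injective _≡_ _≡_ π
      word-injective {i} {j} e = Fin.toℕ-injective
        (Good.injective good (Fin.toℕ<n i) (Fin.toℕ<n j) (trans (rep i) (trans (cong toℕ e) (sym (rep j)))))

      open Orbits w word-injective using (Period; Orbit; fixed; swap; three; orbit; orbit-short; startsLeast?)

      word-period : ∀ i → Period i
      word-period i with Good.periodic good (Fin.toℕ<n i)
      ... | inj₁ e = inj₁ (Fin.toℕ-injective (trans (sym (rep² i)) e))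
      ... | inj₂ e = inj₂ (Fin.toℕ-injective (trans (sym (rep³ i)) e))

      word-permutation : IsPermutation w
      word-permutation = word-injective , surjective
        where
        surjective : ∀ j → ∃[ i ] (∀ {k} → k ≡ i → π k ≡ j)
        surjective j with word-period j
        ... | inj₁ e = π j , λ { refl → e }
        ... | inj₂ e = π (π j) , λ { refl → e }

      private
        LeastCycle : ℕ → Fin n → Set
        LeastCycle k i = All (i Fin.≤_) (cycleFrom w i) × length (cycleFrom w i) ≡ k

        0≡f : ∀ {i} → π i ≡ i → ¬ toℕ i < f (toℕ i)
        0≡f {i} e p = ℕ.<-irrefl refl (subst (toℕ i <_) (trans (rep i) (cong toℕ e)) p)

        ≤-≢ : ∀ {i j : Fin n} {v} → v ≡ toℕ j → i Fin.≤ j → j ≢ i → toℕ i < v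
        ≤-≢ {i} e p q = subst (toℕ i <_) (sym e) (ℕ.≤∧≢⇒< p (q ∘ sym ∘ Fin.toℕ-injective))

        <-≤ : ∀ {i j : Fin n} {v} → v ≡ toℕ j → toℕ i < v → i Fin.≤ j
        <-≤ {i} e p = ℕ.<⇒≤ (subst (toℕ i <_) e p)

        list-cycle : ∀ k i {C} → cycleFrom w i ≡ C → All (i Fin.≤_) C → length C ≡ k → LeastCycle k i
        list-cycle k i eq a l = subst (λ C → All (i Fin.≤_) C × length C ≡ k) (sym eq) (a , l)

        cycle-list : ∀ k i {C} → cycleFrom w i ≡ C → LeastCycle k i → All (i Fin.≤_) C × length C ≡ k
        cycle-list k i eq = subst (λ C → All (i Fin.≤_) C × length C ≡ k) eq

      to-Least : ∀ k i → LeastCycle k i → Least k f (toℕ i)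
      to-Least k i l with orbit i (word-period i)
      to-Least k i l | fixed e eq with cycle-list k i eq l
      ... | _ , refl = trans (rep i) (cong toℕ e)
      to-Least k i l | swap p e eq with cycle-list k i eq l
      ... | _ ∷ a ∷ [] , refl = trans (rep² i) (cong toℕ e) , ≤-≢ (rep i) a p
      to-Least k i l | three p q e eq with cycle-list k i eq l
      ... | _ ∷ a ∷ b ∷ [] , refl = trans (rep³ i) (cong toℕ e) , ≤-≢ (rep i) a p , ≤-≢ (rep² i) b q

      from-Least : ∀ k i → Least k f (toℕ i) → LeastCycle k i
      from-Least 1 i e with orbit i (word-period i)
      ... | fixed _ eq     = list-cycle 1 i eq (ℕ.≤-refl ∷ []) refl
      ... | swap p _ _     = contradiction (Fin.toℕ-injective (trans (sym (rep i)) e)) p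
      ... | three p _ _ _  = contradiction (Fin.toℕ-injective (trans (sym (rep i)) e)) p
      from-Least 2 i (e , a) with orbit i (word-period i)
      ... | fixed p _      = contradiction a (0≡f p)
      ... | swap _ _ eq    = list-cycle 2 i eq (ℕ.≤-refl ∷ <-≤ (rep i) a ∷ []) refl
      ... | three _ q _ _  = contradiction (Fin.toℕ-injective (trans (sym (rep² i)) e)) q
      from-Least 3 i (e , a , b) with orbit i (word-period i)
      ... | fixed p _      = contradiction a (0≡f p)
      ... | swap _ q _     = contradiction (subst (toℕ i <_) (trans (rep² i) (cong toℕ q)) b) (ℕ.<-irrefl refl)
      ... | three _ _ _ eq = list-cycle 3 i eq (ℕ.≤-refl ∷ <-≤ (rep i) a ∷ <-≤ (rep² i) b ∷ []) refl

      c≡cycleCount : ∀ k → c k w ≡ cycleCount n f k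
      c≡cycleCount k = trans
        (length-filter-map-filter startsLeast? (λ C → length C ℕ.≟ k) (λ i → least? k f (toℕ i)) (cycleFrom w)
          (λ i p q → to-Least k i (p , q)) (from-Least k) (allFin n))
        (sum-tabulate n id (λ i → indicator (least? k f (toℕ i))) (λ i → indicator (least? k f i)) (λ _ → refl))

      good⇒avoids : ¬ Contains [231] w
      good⇒avoids (i ∷ j ∷ k ∷ [] , increasing , same) = Good.avoids good
        (increasing zero (suc zero) (s≤s z≤n)) (increasing (suc zero) (suc (suc zero)) (s≤s (s≤s z≤n))) (Fin.toℕ<n k)
        (subst₂ _<_ (sym (rep k)) (sym (rep i)) (Equivalence.to (same (suc (suc zero)) zero) (s≤s z≤n)))
        (subst₂ _<_ (sym (rep i)) (sym (rep j)) (Equivalence.to (same zero (suc zero)) (s≤s (s≤s z≤n))))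

      good⇒∈ : w ∈ 𝔖[3]⟨231⟩ n
      good⇒∈ = ∈-filter⁺ (λ π → ¬? (contains? [231] π))
        (∈-filter⁺ _ (∈-filter⁺ isPermutation? (∈-words w) word-permutation)
          (All.map⁺ (All.universal (λ i → orbit-short i (orbit i (word-period i))) _)))
        good⇒avoids

    occurrence : ∀ {i j k} → i Fin.< j → j Fin.< k → π k Fin.< π i → π i Fin.< π j → Contains [231] w
    occurrence {i} {j} {k} i<j j<k p q = e , increasing , λ a b → mk⇔ (to a b) (from a b)
      where
      e : Word n 3
      e = i ∷ j ∷ k ∷ []
      increasing : ∀ a b → a Fin.< b → lookup e a Fin.< lookup e b
      increasing zero (suc zero)                   _ = i<j
      increasing zero (suc (suc zero))             _ = ℕ.<-trans i<j j<k
      increasing (suc zero) (suc (suc zero))       _ = j<k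
      increasing (suc zero) (suc zero)             (s≤s ())
      increasing (suc (suc zero)) (suc zero)       (s≤s ())
      increasing (suc (suc zero)) (suc (suc zero)) (s≤s (s≤s ()))
      to : ∀ a b → lookup [231] a Fin.< lookup [231] b → π (lookup e a) Fin.< π (lookup e b)
      to zero zero                         (s≤s ())
      to zero (suc zero)                   _ = q
      to zero (suc (suc zero))             ()
      to (suc zero) zero                   (s≤s ())
      to (suc zero) (suc zero)             (s≤s (s≤s ()))
      to (suc zero) (suc (suc zero))       ()
      to (suc (suc zero)) zero             _ = p
      to (suc (suc zero)) (suc zero)       _ = ℕ.<-trans p q
      to (suc (suc zero)) (suc (suc zero)) ()
      [231]-injective : ∀ a b → lookup [231] a ≡ lookup [231] b → a ≡ b
      [231]-injective zero zero                         _ = refl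
      [231]-injective (suc zero) (suc zero)             _ = refl
      [231]-injective (suc (suc zero)) (suc (suc zero)) _ = refl
      [231]-injective zero (suc zero)                   ()
      [231]-injective zero (suc (suc zero))             ()
      [231]-injective (suc zero) zero                   ()
      [231]-injective (suc zero) (suc (suc zero))       ()
      [231]-injective (suc (suc zero)) zero             ()
      [231]-injective (suc (suc zero)) (suc zero)       ()
      -- Both sides compare letters in a linear order, so the converse follows from `to` by
      -- trichotomy and the distinctness of the letters of the pattern.
      from : ∀ a b → π (lookup e a) Fin.< π (lookup e b) → lookup [231] a Fin.< lookup [231] b
      from a b r with Fin.<-cmp (lookup [231] a) (lookup [231] b)
      ... | tri< s _ _ = s
      ... | tri≈ _ s _ with [231]-injective a b s
      ...   | refl = contradiction r (ℕ.<-irrefl refl)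
      from a b r | tri> _ _ s = contradiction r (ℕ.<-asym (to b a s))

    ∈⇒good : w ∈ 𝔖[3]⟨231⟩ n → Good n f
    ∈⇒good w∈ with ∈-filter⁻ (λ π → ¬? (contains? [231] π)) w∈
    ... | w∈₁ , ¬231 with ∈-filter⁻ _ w∈₁
    ...   | w∈₂ , short with ∈-filter⁻ isPermutation? {xs = words n n} w∈₂
    ...     | _ , inj , _ = record
      { bounded  = toℕ-elim (λ i → f i < n) (λ i → subst (_< n) (sym (rep i)) (Fin.toℕ<n (π i)))
      ; periodic = toℕ-elim (λ i → f (f i) ≡ i ⊎ f (f (f i)) ≡ i) (λ i → Sum.map
          (λ e → trans (rep² i) (cong toℕ e)) (λ e → trans (rep³ i) (cong toℕ e)) (Orbits.all-period w inj short i))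
      ; avoids   = λ i<j j<k k<n → av i<j j<k k<n (ℕ.<-trans i<j (ℕ.<-trans j<k k<n)) (ℕ.<-trans j<k k<n)
      }
      where
      av : ∀ {i j k} → i < j → j < k → k < n → i < n → j < n → f k < f i → ¬ f i < f j
      av {i} {j} {k} i<j j<k k<n i<n j<n p q = ¬231 (occurrence
        (subst₂ _<_ (sym (Fin.toℕ-fromℕ< i<n)) (sym (Fin.toℕ-fromℕ< j<n)) i<j)
        (subst₂ _<_ (sym (Fin.toℕ-fromℕ< j<n)) (sym (Fin.toℕ-fromℕ< k<n)) j<k)
        (subst₂ _<_ (value k<n) (value i<n) p) (subst₂ _<_ (value i<n) (value j<n) q))
        where
        value : ∀ {i} (p : i < n) → f i ≡ toℕ (π (fromℕ< p))
        value p = trans (cong f (sym (Fin.toℕ-fromℕ< p))) (rep (fromℕ< p))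

  value : ∀ {m n} → Word m n → ℕ → ℕ
  value []      _       = 0
  value (i ∷ w) zero    = toℕ i
  value (i ∷ w) (suc k) = value w k

  represents-value : ∀ {n} (w : Word n n) → Represents w (value w)
  represents-value = go
    where
    go : ∀ {m n} (w : Word m n) i → value w (toℕ i) ≡ toℕ (lookup w i)
    go (_ ∷ w) zero    = refl
    go (_ ∷ w) (suc i) = go w i

  -- Out-of-range values need a default in `Fin n`; the position at hand always supplies one.
  clamp : ∀ {n} → Fin n → ℕ → Fin n
  clamp {n} i v with v ℕ.<? n
  ... | yes v<n = fromℕ< v<n
  ... | no  _   = i

  toℕ-clamp : ∀ {n} (i : Fin n) {v} → v < n → toℕ (clamp i v) ≡ v
  toℕ-clamp {n} i {v} v<n with v ℕ.<? n
  ... | yes p = Fin.toℕ-fromℕ< p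
  ... | no ¬p = contradiction v<n ¬p

  word : ∀ n → (ℕ → ℕ) → Word n n
  word n f = tabulate λ i → clamp i (f (toℕ i))

  represents-word : ∀ {n f} → Good n f → Represents (word n f) f
  represents-word {n} {f} good i = sym (trans (cong toℕ (lookup∘tabulate (λ i → clamp i (f (toℕ i))) i))
    (toℕ-clamp i (Good.bounded good (Fin.toℕ<n i))))

  represents-unique : ∀ {n} {w w′ : Word n n} {f f′} → Represents w f → Represents w′ f′ → Agree n f f′ → w ≡ w′
  represents-unique {w = w} {w′} p p′ a = trans (sym (tabulate∘lookup w)) (trans
    (tabulate-cong λ i → Fin.toℕ-injective (trans (sym (p i)) (trans (a (Fin.toℕ<n i)) (p′ i))))
    (tabulate∘lookup w′))

  treeFunction : Tree → ℕ → ℕ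
  treeFunction τ = proj₁ (tree-exists τ)

  treeFunction-tree : ∀ τ → IsTree τ (treeFunction τ)
  treeFunction-tree τ = proj₂ (tree-exists τ)

  treeWord : ∀ n → Tree → Word n n
  treeWord n τ = word n (treeFunction τ)

  treeFunction-good : ∀ τ → Good (sizeᵀ τ) (treeFunction τ)
  treeFunction-good τ = tree-sound τ (treeFunction-tree τ)

  treeWord-injective : ∀ {n τ τ′} → sizeᵀ τ ≡ n → sizeᵀ τ′ ≡ n → treeWord n τ ≡ treeWord n τ′ → τ ≡ τ′
  treeWord-injective {n} {τ} {τ′} refl e eq = tree-injective τ τ′ (sym e)
    (toℕ-elim (λ i → treeFunction τ i ≡ treeFunction τ′ i) λ i →
      trans (represents-word (treeFunction-good τ) i) (trans (cong (λ w → toℕ (lookup w i)) eq)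
        (sym (represents-word (subst (λ n → Good n (treeFunction τ′)) e (treeFunction-good τ′)) i))))
    (treeFunction-tree τ) (treeFunction-tree τ′)

  unique-map : ∀ {A B : Set} {P : A → Set} (g : A → B) → (∀ {a a′} → P a → P a′ → g a ≡ g a′ → a ≡ a′) →
    ∀ {as} → All P as → Unique as → Unique (map g as)
  unique-map g inj []       []      = []
  unique-map g inj (p ∷ ps) (a ∷ u) =
    All.map⁺ (All.zipWith (λ (q , a≢) e → a≢ (inj p q e)) (ps , a)) ∷ unique-map g inj ps u

  words-unique : ∀ m n → Unique (words m n)
  words-unique m zero    = [] ∷ []
  words-unique m (suc n) =
    Unique.cartesianProductWith⁺ _∷_ (λ { refl → refl , refl }) (Unique.allFin⁺ m) (words-unique m n)

  -- Duplicate-free lists with the same members are rearrangements of each other. Completeness of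
  -- the codes gives one inclusion and soundness the other.
  words↭trees : ∀ n → 𝔖[3]⟨231⟩ n ↭ map (treeWord n) (trees n)
  words↭trees n = ∼bag⇒↭ (unique∧set⇒bag
    (Unique.filter⁺ _ (Unique.filter⁺ _ (Unique.filter⁺ isPermutation? (words-unique n n))))
    (unique-map (treeWord n) treeWord-injective (trees-size n) (trees-unique n))
    (mk⇔ to from))
    where
    to : ∀ {w} → w ∈ 𝔖[3]⟨231⟩ n → w ∈ map (treeWord n) (trees n)
    to {w} w∈ with tree-complete (suc n) ℕ.≤-refl (∈⇒good {f = value w} (represents-value w) w∈)
    ... | τ , refl , p = subst (_∈ map (treeWord n) (trees n))
      (represents-unique {f′ = value w} (represents-word (treeFunction-good τ)) (represents-value w)
        (tree-agree τ (treeFunction-tree τ) p))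
      (∈-map⁺ (treeWord n) (∈-trees τ))
    from : ∀ {w} → w ∈ map (treeWord n) (trees n) → w ∈ 𝔖[3]⟨231⟩ n
    from w∈ with ∈-map⁻ (treeWord n) w∈
    ... | τ , τ∈ , refl with All.lookup (trees-size n) τ∈
    ...   | refl = good⇒∈ (represents-word (treeFunction-good τ)) (treeFunction-good τ)

-- Summation over all sizes

module Series where

  open import Algebra.Bundles using (CommutativeRing)
  open import Data.Fin.Base using (toℕ)
  open import Data.Integer.Base as ℤ using (+_; 0ℤ; 1ℤ)
  import Data.Integer.Properties as ℤ
  open import Data.List.Base using (List; []; _∷_)
  open import Data.List.Relation.Unary.All using (All; []; _∷_)
  open import Data.Nat.Base as ℕ using (ℕ; zero; suc; s≤s)
  import Data.Nat.Properties as ℕ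
  open import Data.Product.Base using (_,_)
  open import Function.Base using (_∘_)
  open import Level using (0ℓ)
  open import Relation.Binary.PropositionalEquality as ≡ using (_≡_; _≢_; cong; cong₂; subst; module ≡-Reasoning)
  open import Relation.Nullary.Negation.Core using (contradiction)
  open Trees
  open PowerSeriesRings
  open GrammarAlgebra
  open TreeSeries

  open import Defs

  module ℤ⟦y⟧-ring     = PowerSeriesRing ℤ.+-*-commutativeRing
  module ℤ⟦x,y⟧-ring   = PowerSeriesRing ℤ⟦y⟧-ring.ring
  module ℤ⟦t,x,y⟧-ring = PowerSeriesRing ℤ⟦x,y⟧-ring.ring

  seriesRing : CommutativeRing 0ℓ 0ℓ
  seriesRing = ℤ⟦t,x,y⟧-ring.ring

  module S = CommutativeRing seriesRing

  private
    X = variable₁ ℤ⟦y⟧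
    Y = variable₁ ℤ.+-*-rawRing

  t*-zero : ∀ F b d → (t * F) 0 b d ≡ 0ℤ
  t*-zero F = ℤ⟦t,x,y⟧-ring.variable₁-⊠-zero F

  t*-suc : ∀ F a b d → (t * F) (suc a) b d ≡ F a b d
  t*-suc F = ℤ⟦t,x,y⟧-ring.variable₁-⊠-suc F

  x*-zero : ∀ F a d → (x * F) a 0 d ≡ 0ℤ
  x*-zero F a d = ≡.trans (ℤ⟦t,x,y⟧-ring.constant-⊠ X F a 0 d) (ℤ⟦x,y⟧-ring.variable₁-⊠-zero (F a) d)

  x*-suc : ∀ F a b d → (x * F) a (suc b) d ≡ F a b d
  x*-suc F a b d = ≡.trans (ℤ⟦t,x,y⟧-ring.constant-⊠ X F a (suc b) d) (ℤ⟦x,y⟧-ring.variable₁-⊠-suc (F a) b d)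

  y*-zero : ∀ F a b → (y * F) a b 0 ≡ 0ℤ
  y*-zero F a b = ≡.trans (ℤ⟦t,x,y⟧-ring.constant-⊠ (constant ℤ⟦y⟧ Y) F a b 0)
    (≡.trans (ℤ⟦x,y⟧-ring.constant-⊠ Y (F a) b 0) (ℤ⟦y⟧-ring.variable₁-⊠-zero (F a b)))

  y*-suc : ∀ F a b d → (y * F) a b (suc d) ≡ F a b d
  y*-suc F a b d = ≡.trans (ℤ⟦t,x,y⟧-ring.constant-⊠ (constant ℤ⟦y⟧ Y) F a b (suc d))
    (≡.trans (ℤ⟦x,y⟧-ring.constant-⊠ Y (F a) b (suc d)) (ℤ⟦y⟧-ring.variable₁-⊠-suc (F a b) d))

  open TreeWeights seriesRing t x y
  open GrammarSolution seriesRing using (num; den; den*B≈num; den-inverse)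

  -- The size of a word with `a` fixed points, `b` 2-cycles and `d` 3-cycles. The term in `d` stands
  -- first so that `suc d` unfolds to three successors, matching the three shifts in `total-y`.
  degree : ℕ → ℕ → ℕ → ℕ
  degree a b d = d ℕ.* 3 ℕ.+ (b ℕ.* 2 ℕ.+ a)

  degree-t : ∀ a b d → degree (suc a) b d ≡ suc (degree a b d)
  degree-t a b d = ≡.trans (cong (d ℕ.* 3 ℕ.+_) (ℕ.+-suc (b ℕ.* 2) a)) (ℕ.+-suc (d ℕ.* 3) _)

  degree-x : ∀ a b d → degree a (suc b) d ≡ suc (suc (degree a b d))
  degree-x a b d = ≡.trans (ℕ.+-suc (d ℕ.* 3) _) (cong suc (ℕ.+-suc (d ℕ.* 3) _))

  -- The sum over n of F n, provided that every F n is homogeneous of degree n for the grading in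
  -- which t, x, y have degrees 1, 2, 3.
  total : (ℕ → Series) → Series
  total F a b d = F (degree a b d) a b d

  shift-zero : ∀ F a b d → (∀ n → F n a b d ≡ 0ℤ) → ∀ n → shift F n a b d ≡ 0ℤ
  shift-zero F a b d h zero    = ≡.refl
  shift-zero F a b d h (suc n) = h n

  -- Multiplication by `t` lowers the exponent that is read by one, and with it the degree, which is
  -- just the index that `shift` removes.
  total-t : ∀ F → total (shift λ n → t * F n) ≈ t * total F
  total-t F zero    b d = ≡.trans (shift-zero _ 0 b d (λ n → t*-zero (F n) b d) (degree 0 b d))
                                  (≡.sym (t*-zero (total F) b d))
  total-t F (suc a) b d = begin
    shift (λ n → t * F n) (degree (suc a) b d) (suc a) b d
      ≡⟨ cong (λ n → shift (λ n → t * F n) n (suc a) b d) (degree-t a b d) ⟩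
    (t * F (degree a b d)) (suc a) b d                      ≡⟨ t*-suc (F (degree a b d)) a b d ⟩
    F (degree a b d) a b d                                  ≡⟨ t*-suc (total F) a b d ⟨
    (t * total F) (suc a) b d                               ∎
    where open ≡-Reasoning

  total-x : ∀ F → total (shift (shift λ n → x * F n)) ≈ x * total F
  total-x F a zero    d =
    ≡.trans (shift-zero _ a 0 d (shift-zero _ a 0 d (λ n → x*-zero (F n) a d)) (degree a 0 d))
            (≡.sym (x*-zero (total F) a d))
  total-x F a (suc b) d = begin
    shift (shift λ n → x * F n) (degree a (suc b) d) a (suc b) d
      ≡⟨ cong (λ n → shift (shift λ n → x * F n) n a (suc b) d) (degree-x a b d) ⟩
    (x * F (degree a b d)) a (suc b) d                      ≡⟨ x*-suc (F (degree a b d)) a b d ⟩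
    F (degree a b d) a b d                                  ≡⟨ x*-suc (total F) a b d ⟨
    (x * total F) a (suc b) d                               ∎
    where open ≡-Reasoning

  total-y : ∀ F → total (shift (shift (shift λ n → y * F n))) ≈ y * total F
  total-y F a b zero    =
    ≡.trans (shift-zero _ a b 0 (shift-zero _ a b 0 (shift-zero _ a b 0 (λ n → y*-zero (F n) a b))) (degree a b 0))
            (≡.sym (y*-zero (total F) a b))
  total-y F a b (suc d) = ≡.trans (y*-suc (F (degree a b d)) a b d) (≡.sym (y*-suc (total F) a b d))

  total-unit : total unit ≈ 1#
  total-unit zero    zero    zero    = ≡.refl
  total-unit (suc a) zero    zero    = ≡.refl
  total-unit zero    (suc b) zero    = ≡.refl
  total-unit (suc a) (suc b) zero    = ≡.refl
  total-unit zero    zero    (suc d) = ≡.refl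
  total-unit zero    (suc b) (suc d) = ≡.refl
  total-unit (suc a) b       (suc d) = ≡.refl

  -- Geometric series, given by their coefficients, that invert the factors of the numerator as
  -- `den-inverse` requires.
  1/[1-x] 1/[1-2y] : Series
  1/[1-x] zero    b zero    = 1ℤ
  1/[1-x] zero    b (suc d) = 0ℤ
  1/[1-x] (suc a) b d       = 0ℤ

  1/[1-2y] zero    zero    d = + (2 ℕ.^ d)
  1/[1-2y] zero    (suc b) d = 0ℤ
  1/[1-2y] (suc a) b       d = 0ℤ

  1/[1-x]-eq : 1/[1-x] ≈ 1# + x * 1/[1-x]
  1/[1-x]-eq a b d = ≡.trans (coefficients a b d) (cong (λ k → 1# a b d ℤ.+ k) (≡.sym (value a b d)))
    where
    x1/[1-x] : Series
    x1/[1-x] a zero    d = 0ℤ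
    x1/[1-x] a (suc b) d = 1/[1-x] a b d
    value : x * 1/[1-x] ≈ x1/[1-x]
    value a zero    d = x*-zero 1/[1-x] a d
    value a (suc b) d = x*-suc 1/[1-x] a b d
    coefficients : 1/[1-x] ≈ 1# + x1/[1-x]
    coefficients zero    zero    zero    = ≡.refl
    coefficients zero    (suc b) zero    = ≡.refl
    coefficients zero    zero    (suc d) = ≡.refl
    coefficients zero    (suc b) (suc d) = ≡.refl
    coefficients (suc a) zero    d       = ≡.refl
    coefficients (suc a) (suc b) d       = ≡.refl

  1/[1-2y]-eq : 1/[1-2y] ≈ 1# + (y * 1/[1-2y] + y * 1/[1-2y])
  1/[1-2y]-eq a b d = ≡.trans (coefficients a b d) (≡.sym (cong (λ k → 1# a b d ℤ.+ (k ℤ.+ k)) (value a b d)))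
    where
    y1/[1-2y] : Series
    y1/[1-2y] a b zero    = 0ℤ
    y1/[1-2y] a b (suc d) = 1/[1-2y] a b d
    value : y * 1/[1-2y] ≈ y1/[1-2y]
    value a b zero    = y*-zero 1/[1-2y] a b
    value a b (suc d) = y*-suc 1/[1-2y] a b d
    coefficients : 1/[1-2y] ≈ 1# + (y1/[1-2y] + y1/[1-2y])
    coefficients zero    zero    zero    = ≡.refl
    coefficients zero    zero    (suc d) = begin
      + (2 ℕ.^ d ℕ.+ (2 ℕ.^ d ℕ.+ 0))         ≡⟨ cong (λ k → + (2 ℕ.^ d ℕ.+ k)) (ℕ.+-identityʳ _) ⟩
      + (2 ℕ.^ d ℕ.+ 2 ℕ.^ d)                 ∎
      where open ≡-Reasoning
    coefficients zero    (suc b) zero    = ≡.refl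
    coefficients zero    (suc b) (suc d) = ≡.refl
    coefficients (suc a) b       zero    = ≡.refl
    coefficients (suc a) b       (suc d) = ≡.refl

  -- Homogeneity makes the infinite sum converge: each coefficient receives a contribution from a
  -- single size.
  Homogeneous : ℕ → Series → Set
  Homogeneous n F = ∀ a b d → degree a b d ≢ n → F a b d ≡ 0ℤ

  homogeneous-t : ∀ {n F} → Homogeneous n F → Homogeneous (suc n) (t * F)
  homogeneous-t {n} {F} h zero    b d p = t*-zero F b d
  homogeneous-t {n} {F} h (suc a) b d p =
    ≡.trans (t*-suc F a b d) (h a b d λ q → p (≡.trans (degree-t a b d) (cong suc q)))

  homogeneous-x : ∀ {n F} → Homogeneous n F → Homogeneous (suc (suc n)) (x * F)
  homogeneous-x {n} {F} h a zero    d p = x*-zero F a d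
  homogeneous-x {n} {F} h a (suc b) d p =
    ≡.trans (x*-suc F a b d) (h a b d λ q → p (≡.trans (degree-x a b d) (cong (suc ∘ suc) q)))

  homogeneous-y : ∀ {n F} → Homogeneous n F → Homogeneous (suc (suc (suc n))) (y * F)
  homogeneous-y {n} {F} h a b zero    p = y*-zero F a b
  homogeneous-y {n} {F} h a b (suc d) p =
    ≡.trans (y*-suc F a b d) (h a b d λ q → p (cong (suc ∘ suc ∘ suc) q))

  homogeneous-≈ : ∀ {n} F G → G ≈ F → Homogeneous n F → Homogeneous n G
  homogeneous-≈ F G G≈F h a b d p = ≡.trans (G≈F a b d) (h a b d p)

  homogeneous-1 : Homogeneous 0 1#
  homogeneous-1 zero    zero    zero    p = contradiction ≡.refl p
  homogeneous-1 (suc a) b       d       p = ≡.refl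
  homogeneous-1 zero    (suc b) d       p = ≡.refl
  homogeneous-1 zero    zero    (suc d) p = ≡.refl

  homogeneous-dec : ∀ k {n F} → Homogeneous n F → Homogeneous (k ℕ.+ n) (decWeight k * F)
  homogeneous-dec 0             {F = F} h = homogeneous-≈ F (1# * F) (S.*-identityˡ F) h
  homogeneous-dec 1             {F = F} h = homogeneous-t h
  homogeneous-dec (suc (suc k)) {F = F} h =
    homogeneous-≈ (x * ((decWeight k) * F)) (x * (decWeight k) * F) (S.*-assoc x (decWeight k) F) (homogeneous-x (homogeneous-dec k h))

  homogeneous-core : ∀ γ {n F} → Homogeneous n F → Homogeneous (size γ ℕ.+ n) (coreWeight γ * F)
  homogeneous-core (pair s r) {n} {F} h =
    subst (λ k → Homogeneous k (decWeight s * decWeight r * F)) (≡.sym (ℕ.+-assoc s r n))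
      (homogeneous-≈ ((decWeight s) * ((decWeight r) * F)) ((decWeight s) * (decWeight r) * F) (S.*-assoc (decWeight s) (decWeight r) F) (homogeneous-dec s (homogeneous-dec r h)))
  homogeneous-core (nest s r) h = homogeneous-dec (suc (suc (s ℕ.+ r))) h
  homogeneous-core (cycA γ) {n} {F} h =
    homogeneous-≈ (y * ((coreWeight γ) * F)) (y * (coreWeight γ) * F) (S.*-assoc y (coreWeight γ) F) (homogeneous-y (homogeneous-core γ h))
  homogeneous-core (cycB γ) {n} {F} h =
    homogeneous-≈ (y * ((coreWeight γ) * F)) (y * (coreWeight γ) * F) (S.*-assoc y (coreWeight γ) F) (homogeneous-y (homogeneous-core γ h))

  homogeneous-tree : ∀ τ → Homogeneous (sizeᵀ τ) (treeWeight τ)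
  homogeneous-tree nil       = homogeneous-1
  homogeneous-tree (dec k τ) = homogeneous-dec (suc k) (homogeneous-tree τ)
  homogeneous-tree (cyc γ τ) = homogeneous-y (homogeneous-core γ (homogeneous-tree τ))

  homogeneous-T : ∀ n → Homogeneous n (T n)
  homogeneous-T n = go (trees n) (trees-size n)
    where
    go : ∀ τs → All (λ τ → sizeᵀ τ ≡ n) τs → Homogeneous n (Σ treeWeight τs)
    go []       []            a b d p = ≡.refl
    go (τ ∷ τs) (≡.refl ∷ ps) a b d p = cong₂ ℤ._+_ (homogeneous-tree τ a b d p) (go τs ps a b d p)

  sum-vanishing : ∀ (F : ℕ → Series) a b d m → (∀ n → F n a b d ≡ 0ℤ) → sum {m} (λ i → F (toℕ i)) a b d ≡ 0ℤ
  sum-vanishing F a b d zero    h = ≡.refl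
  sum-vanishing F a b d (suc m) h = cong₂ ℤ._+_ (h 0) (sum-vanishing (F ∘ suc) a b d m (h ∘ suc))

  sum-single : ∀ (F : ℕ → Series) a b d {k m} → k ℕ.< m → (∀ n → k ≢ n → F n a b d ≡ 0ℤ) →
    sum {m} (λ i → F (toℕ i)) a b d ≡ F k a b d
  sum-single F a b d {zero}  {suc m} (s≤s p) h =
    ≡.trans (cong (λ k → F 0 a b d ℤ.+ k) (sum-vanishing (F ∘ suc) a b d m (λ n → h (suc n) λ ())))
            (ℤ.+-identityʳ _)
  sum-single F a b d {suc k} {suc m} (s≤s p) h =
    ≡.trans (cong₂ ℤ._+_ (h 0 λ ()) (sum-single (F ∘ suc) a b d p (λ n k≢n → h (suc n) (k≢n ∘ ℕ.suc-injective))))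
            (ℤ.+-identityˡ _)

  total-isSumOf : ∀ {P} → (∀ n → P n ≈ T n) → total T IsSumOf P
  -- A partial sum with more than `degree a b d` terms contains the only size that reaches this
  -- coefficient.
  total-isSumOf {P} P≈T a b d = suc (degree a b d) , λ m m> →
    ≡.trans (sum-single P a b d m> λ n p → homogeneous-≈ (T n) (P n) (P≈T n) (homogeneous-T n) a b d p)
            (P≈T (degree a b d) a b d)

  numerator denominator : Series
  numerator = (1# - x) ^ 2 * (1# - 2 · y)
  denominator = 1# - 3 · x - 3 · y - t + 2 · x ^ 2 + 5 · (x * y) + t * x
    - 5 · (x ^ 2 * y) - 4 · (t * x * y) - t ^ 2 * y

  -- Isolating these two checks avoids comparing num and den with their counterparts under a product,
  -- coefficient by coefficient, which is much slower.
  num≡ : num t x y ≡ numerator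
  num≡ = ≡.refl

  den≡ : den t x y ≡ denominator
  den≡ = ≡.refl

  quotient-resp : ∀ {D D′ N N′ E F : Series} → D ≡ D′ → N ≡ N′ → D S.* E S.≈ S.1# → D S.* F S.≈ N →
    F IsQuotientOf N′ By D′
  quotient-resp {E = E} ≡.refl ≡.refl p q = (E , p) , q

  total-quotient : total T IsQuotientOf numerator By denominator
  total-quotient =
    quotient-resp {den t x y} {denominator} {num t x y} {numerator}
      {total T S.* (1/[1-x] S.* 1/[1-x] S.* 1/[1-2y])} {total T} den≡ num≡
      (den-inverse t x y {total T} {1/[1-x]} {1/[1-2y]} quotient 1/[1-x]-eq 1/[1-2y]-eq) quotient
    where
    quotient : den t x y S.* total T S.≈ num t x y
    -- Each equation at the coefficient `a b d` is the size-graded equation at size `degree a b d`.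
    quotient = den*B≈num t x y (total T) (total D) (total P) (total R) (total N) (total C)
      (total unit) (total (shift λ n → t * T n)) (total (shift λ n → t * D n))
      (total (shift (shift λ n → x * T n))) (total (shift (shift λ n → x * D n)))
      (total (shift (shift λ n → x * P n))) (total (shift (shift λ n → x * R n)))
      (total (shift (shift λ n → x * N n))) (total shift³yC)
      total-unit (total-t T) (total-t D) (total-x T) (total-x D) (total-x P) (total-x R) (total-x N) (total-y C)
      (λ a b d → T-eq (degree a b d) a b d) (λ a b d → D-eq (degree a b d) a b d)
      (λ a b d → P-eq (degree a b d) a b d) (λ a b d → R-eq (degree a b d) a b d)
      (λ a b d → N-eq (degree a b d) a b d) (λ a b d → C-eq (degree a b d) a b d)

-- Weights of permutations computed from their codes

module Summands where

  open import Data.List.Base using (map)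
  import Data.List.Relation.Unary.All as All
  open import Relation.Binary.PropositionalEquality as ≡ using (_≡_)
  open Trees
  open Permutations
  open TreeSeries
  open CycleCounts
  open Words
  open Series
  open import Defs

  open TreeWeights seriesRing t x y
  open Monomials seriesRing t x y

  treeWord-weight : ∀ n τ → sizeᵀ τ ≡ n → weight (treeWord n τ) ≈ treeWeight τ
  treeWord-weight n τ ≡.refl = S.trans {weight (treeWord n τ)} {monomial (cycleCount n (treeFunction τ))} {treeWeight τ}
    (monomial-cong (λ k → c k (treeWord n τ)) (cycleCount n (treeFunction τ))
      (c≡cycleCount {w = treeWord n τ} (represents-word (treeFunction-good τ)) (treeFunction-good τ)))
    (tree-monomial τ (treeFunction-tree τ))

  B-summand≈T : ∀ n → B-summand n ≈ T n
  B-summand≈T n = S.trans {B-summand n} {Σ weight (map (treeWord n) (trees n))} {T n}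
    (Σ-↭ weight (words↭trees n))
    (S.trans {Σ weight (map (treeWord n) (trees n))} {Σ (λ τ → weight (treeWord n τ)) (trees n)} {T n}
      (Σ-map weight (treeWord n) (trees n))
      (Σ-congᴬ (All.map (λ {τ} → treeWord-weight n τ) (trees-size n))))

open import Defs
open import Data.Product.Base using (_×_; ∃-syntax; _,_)

theorem3p1 : ∃[ B ] (B IsSumOf B-summand) ×
    (B IsQuotientOf ((1# - x) ^ 2 * (1# - 2 · y)) By
    (1# - 3 · x - 3 · y - t + 2 · x ^ 2 + 5 · (x * y) + t * x
    - 5 · (x ^ 2 * y) - 4 · (t * x * y) - t ^ 2 * y))
-- The witness found by unification is `total T`, which collects the weights of all codes.
theorem3p1 = _ , Series.total-isSumOf Summands.B-summand≈T , Series.total-quotient
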